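{- There is a deterministic prediction-based online algorithm for online matching on the line which, against any offline algorithm $\textsc{Off}$, attains competitive ratio \[O\left(\min\left\{\log n,\;1+\frac{\eta}{\textsc{Off}}\right\}\right),\] where $n$ is the number of servers (and requests), $\eta$ is the prediction error with respect to $\textsc{Off}$, and $\textsc{Off}$ also denotes the cost of that offline algorithm.
   Context: Online matching on the line: a set $S=\{s_1,\dots,s_n\}$ of server locations on the real line is given. Requests $r_1,\dots,r_n$ (points on the real line) arrive one at a time; upon arrival $r_i$ must be irrevocably matched to a previously unmatched server $s_j$ at cost $|s_j-r_i|$. The objective is to minimize the total cost of the final perfect matching. The configuration of an algorithm after $i$ requests is the set of servers matched so far. For two sets $X,Y$ of $i$ points each, $\mathit{dist}(X,Y)$ is the cost of a minimum-cost perfect matching between $X$ and $Y$. In the prediction setting, in round $i$ together with $r_i$ the algorithm receives a predicted configuration $P_i\subseteq S$ with $|P_i|=i$ (possibly $P_i\not\subseteq P_{i+1}$). For an offline algorithm $\textsc{Off}$ with configuration $\textsc{Off}_i$ after $i$ requests, the error is $\eta=\sum_{i=1}^n\mathit{dist}(P_i,\textsc{Off}_i)$. Competitive ratio $r$ against $\textsc{Off}$ means cost at most $r\cdot\textsc{Off}$ plus a constant independent of the input.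
   Formalization: Server locations and requests are rational points of the line instead of arbitrary real points. -}

module Defs where

open import Data.Nat as ℕ using (ℕ; zero; suc)
open import Data.Nat.Logarithm using (⌊log₂_⌋)
open import Data.Integer using (+_)
open import Data.Rational using (ℚ; 0ℚ; _+_; _-_; _*_; _⊓_; ∣_∣; _/_; _≤_)
open import Data.Fin using (Fin; toℕ)
open import Data.Fin.Subset using (Subset) renaming (∣_∣ to size)
open import Data.Fin.Properties using (_≟_)
open import Data.Bool using (Bool; true; false; _∧_; _∨_; not; if_then_else_)
open import Data.List using (List; []; _∷_; foldr; map; concatMap; filter)
open import Data.Vec using (Vec; []; _∷_; lookup; tabulate)
open import Data.Vec.Functional using () renaming (Vector to FVec)
open import Data.List using (allFin) renaming (_++_ to _++L_)
open import Relation.Nullary.Decidable using (⌊_⌋)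
open import Relation.Binary.PropositionalEquality using (_≡_)

allB : ∀ {A : Set} → (A → Bool) → List A → Bool
allB p = foldr (λ x b → p x ∧ b) true

anyB : ∀ {A : Set} → (A → Bool) → List A → Bool
anyB p = foldr (λ x b → p x ∨ b) false

ℕ→ℚ : ℕ → ℚ
ℕ→ℚ k = + k / 1

sumFin : ∀ {n} → (Fin n → ℚ) → ℚ
sumFin {n} f = foldr (λ i acc → f i + acc) 0ℚ (allFin n)

-- minimum of a list of rationals (the empty list gets 0, never used)
minList : List ℚ → ℚ
minList []       = 0ℚ
minList (x ∷ xs) = foldr _⊓_ x xs

allVecs : ∀ {n} (k : ℕ) → List (Vec (Fin n) k)
allVecs zero    = [] ∷ []
allVecs {n} (suc k) = concatMap (λ i → map (i ∷_) (allVecs k)) (allFin n)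

_==_ : ∀ {n} → Fin n → Fin n → Bool
i == j = ⌊ i ≟ j ⌋

-- Minimum-cost perfect matching between two sets of servers.
-- Servers are indexed by Fin n, located at s : Fin n → ℚ.
-- X, Y are subsets of the server indices.  A perfect matching between X
-- and Y (|X| = |Y|) is given by a map m : Fin n → Fin n that sends X
-- injectively into Y (its values outside X are irrelevant).

isMatching : ∀ {n} → Subset n → Subset n → (Fin n → Fin n) → Bool
isMatching {n} X Y m =
  allB (λ j → not (lookup X j) ∨ lookup Y (m j)) (allFin n)
  ∧ allB (λ j → allB (λ k → not (lookup X j ∧ lookup X k ∧ (m j == m k)) ∨ (j == k))
                   (allFin n))
        (allFin n)

matchingCost : ∀ {n} → (Fin n → ℚ) → Subset n → (Fin n → Fin n) → ℚ
matchingCost s X m =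
  sumFin (λ j → if lookup X j then ∣ s j - s (m j) ∣ else 0ℚ)

dist : ∀ {n} → (Fin n → ℚ) → Subset n → Subset n → ℚ
dist {n} s X Y =
  minList (map (λ v → matchingCost s X (lookup v))
               (filter (λ v → isMatching X Y (lookup v) Data.Bool.≟ true) (allVecs n)))
  where import Data.Bool

-- Online matching on the line with predictions.
--
-- An instance with n servers/requests: server locations s : Fin n → ℚ,
-- requests r : Fin n → ℚ (round i is request r i, 0-indexed), and
-- predicted configurations P : Fin n → Subset n, where P i is the
-- prediction given together with request r i, i.e. after (toℕ i + 1)
-- requests; so validity requires |P i| = toℕ i + 1.

ValidPredictions : ∀ {n} → (Fin n → Subset n) → Set
ValidPredictions P = ∀ i → size (P i) ≡ suc (toℕ i)

-- A deterministic algorithm: for each n, servers, requests and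
-- predictions, it outputs for every round i the server matched to r i.
-- It is online: the choice in round i only depends on s, r j and P j for
-- toℕ j ≤ toℕ i; and it is legal: on every valid input, distinct rounds
-- get distinct servers (each request goes to a previously unmatched
-- server).
record OnlineAlgorithm : Set where
  field
    choose : (n : ℕ) → (s : Fin n → ℚ) → (r : Fin n → ℚ) →
             (P : Fin n → Subset n) → Fin n → Fin n
    online : ∀ n s r r′ P P′ (i : Fin n) →
             (∀ (j : Fin n) → toℕ j ℕ.≤ toℕ i → r j ≡ r′ j) →
             (∀ (j : Fin n) → toℕ j ℕ.≤ toℕ i → P j ≡ P′ j) →
             choose n s r P i ≡ choose n s r′ P′ i
    legal : ∀ n s r P → ValidPredictions P →
            ∀ (i j : Fin n) → choose n s r P i ≡ choose n s r P j → i ≡ j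

open OnlineAlgorithm public

totalCost : ∀ {n} → (Fin n → ℚ) → (Fin n → ℚ) → (Fin n → Fin n) → ℚ
totalCost s r μ = sumFin (λ i → ∣ s (μ i) - r i ∣)

-- An offline algorithm on a given instance is a perfect matching σ
-- (request i ↦ server σ i, σ injective).  Its configuration after
-- round i (i.e. after toℕ i + 1 requests) is {σ j | toℕ j ≤ toℕ i}.
offConfig : ∀ {n} → (Fin n → Fin n) → Fin n → Subset n
offConfig {n} σ i =
  tabulate (λ t → anyB (λ j → ⌊ toℕ j ℕ.≤? toℕ i ⌋ ∧ (σ j == t)) (allFin n))

predError : ∀ {n} → (Fin n → ℚ) → (Fin n → Subset n) → (Fin n → Fin n) → ℚ
predError s P σ = sumFin (λ i → dist s (P i) (offConfig σ i))

-- the log n factor; 1 + ⌊log₂ n⌋ is Θ(log n) for n ≥ 2 and equals 1 for n = 1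
logFactor : ℕ → ℚ
logFactor n = ℕ→ℚ (suc ⌊log₂ n ⌋)

-- Scale the servers to integer positions and move every request to its nearest server, which costs
-- at most the offline cost. Let D z be the number of servers used minus the number of requests seen
-- at positions ≤ z, and E z its final value. Serving a request changes D by one on the path travelled,
-- whereas any perfect matching costs at least Ω = ∑ ∣ E z ∣.
--
-- The greedy rule serves a request in place if possible. Otherwise it goes to the nearer of the two
-- adjacent free servers, unless the walk to the farther one would decrease ∣ D ∣ on most of the way.
-- As ∑ ∣ D ∣ ≥ 0, only the cells where a walk to the nearer server increases ∣ D ∣ matter; classify
-- these walks by the length ρ of the farther side, up to factors 2. Between two free servers D - E
-- counts later requests, hence is monotone, and it forces ∣ E ∣ to be large on the cells of the
-- farther side where D has the wrong sign. If the walk is comparable to ρ, this bounds the number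
-- of walks near a cell by averages of ∣ E ∣ at distance O(ρ). If it is much shorter, it bounds how
-- deep D can sink at a cell, so the cell is crossed that often plus once for every crossing in the
-- opposite direction; such a crossing ends near the cell and has length ≥ ρ, and summed over all
-- scales these account for a small fraction of the total cost. So each scale costs O(Ω), and only
-- the O(log n) scales between Ω / n and Ω contribute.
--
-- An online algorithm can simulate any sequence of configurations at the cost of moving between
-- them: the min-cost matching from its own configuration to the target absorbs the difference. It
-- simulates the greedy rule or the predicted configurations, and switches to the other one whenever
-- the current one has become four times as expensive.
module Submission where

open import Defs

-- The bound for walks much shorter than the farther side is circular, since it charges them to
-- other walks, and most constants are chosen to close this loop. Let Y be the total length. The
-- threshold 1/4 of the greedy rule gives Y ≤ 4 M, where M counts the worsened cells that remain to
-- be bounded. An opposite crossing is charged only if the cell lies within ρ / 16 of its request.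
-- Over all powers of two ρ up to the length of that walk, this charges at most an eighth of the
-- length, so the charges account for at most Y / 2 of 4 M and can be moved to the left. Opposite
-- crossings from farther away cost nothing: after one of them no walk at the same scale that is
-- short enough to be counted crosses the cell again.
--
-- The factor four between the two simulated configurations makes the cost at which a switch occurs
-- at least quadruple from one switch to the next. Everything spent before a switch, and the detour
-- to the other configuration, is then a constant multiple of the cost of the new leader at that
-- moment.

module Line where

  open import Data.Nat
  open import Data.Nat.Properties
  open import Data.Nat.DivMod using (m/n*n≤m; /-monoˡ-≤; m*n/n≡m; m≡m%n+[m/n]*n; m%n<n)
  open import Data.Nat.Logarithm using (⌊log₂_⌋; ⌊log₂⌋-mono-≤; ⌊log₂[2^n]⌋≡n)
  import Data.Nat.Tactic.RingSolver as ℕ-Solver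
  open import Data.Integer as ℤ using (ℤ; -[1+_]; 0ℤ) renaming (+_ to pos)
  import Data.Integer.Properties as ℤₚ
  import Data.Integer.Tactic.RingSolver as ℤ-Solver
  open import Data.Rational as ℚ using (ℚ)
  import Data.Rational.Properties as ℚₚ
  open import Data.Bool using (Bool; true; false; not; if_then_else_; T; _∧_; _∨_)
  import Data.Bool.Properties as Boolₚ
  open import Data.Fin using (Fin; toℕ)
  import Data.Fin.Properties as Finₚ
  open import Data.Fin.Subset using (Subset) renaming (∣_∣ to size)
  open import Data.List as List using (List; []; _∷_; length; allFin)
  open import Data.List.Membership.Propositional using (_∈_; lose)
  open import Data.List.Membership.Propositional.Properties using (∈-map⁺; ∈-map⁻; ∈-filter⁺; ∈-filter⁻; ∈-concatMap⁺; ∈-allFin)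
  open import Data.List.Relation.Unary.All as All using (All; []; _∷_)
  open import Data.List.Relation.Unary.Any using (here; there)
  open import Data.Vec as Vec using (Vec; []; _∷_; lookup; tabulate; toList; zipWith; replicate; map)
  open import Data.Vec.N-ary using (N-ary; curryⁿ; _$ⁿ_; ∀ⁿ)
  open import Data.Vec.Properties using (lookup∘tabulate; length-toList; lookup-map)
  open import Data.Product using (_×_; _,_; proj₁; proj₂; ∃)
  open import Data.Sum using (_⊎_; inj₁; inj₂)
  open import Data.Unit using (⊤; tt)
  open import Function using (_∘_; id)
  open import Algebra.Bundles using (AbelianGroup)
  import Algebra.Properties.Group (AbelianGroup.group ℤₚ.+-0-abelianGroup) as ℤ-Group
  open import Relation.Nullary using (Dec; yes; no; ¬_; contradiction)
  open import Relation.Nullary.Decidable using (_×-dec_; _⊎-dec_; ¬?; ⌊_⌋; decidable-stable)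
  open import Relation.Binary.Definitions using (tri<; tri≈; tri>)
  open import Relation.Binary.PropositionalEquality

  -- Linear arithmetic

  infixl 8 _:+_
  infixl 9 _:*_
  infix 10 #_
  infix 7 _:≤_ _:<_
  infix 6 _·_

  data Lin (n : ℕ) : Set where
    var  : Fin n → Lin n
    #_   : ℕ → Lin n
    _:+_ : Lin n → Lin n → Lin n
    _:*_ : ℕ → Lin n → Lin n

  record Ineq (n : ℕ) : Set where
    constructor _:≤_
    field small big : Lin n

  _:<_ : ∀ {n} → Lin n → Lin n → Ineq n
  a :< b = # 1 :+ a :≤ b

  _·_ : ∀ {n} → ℕ → Ineq n → ℕ × Ineq n
  k · h = k , h

  ⟦_⟧ : ∀ {n} → Lin n → Vec ℕ n → ℕ
  ⟦ var i ⟧ ρ  = lookup ρ i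
  ⟦ # k ⟧ ρ    = k
  ⟦ a :+ b ⟧ ρ = ⟦ a ⟧ ρ + ⟦ b ⟧ ρ
  ⟦ k :* a ⟧ ρ = k * ⟦ a ⟧ ρ

  ⟦_⟧≤ : ∀ {n} → Ineq n → Vec ℕ n → Set
  ⟦ a :≤ b ⟧≤ ρ = ⟦ a ⟧ ρ ≤ ⟦ b ⟧ ρ

  module LinearArithmetic where

    Form : ℕ → Set
    Form n = ℕ × Vec ℕ n

    dot : ∀ {n} → Vec ℕ n → Vec ℕ n → ℕ
    dot []       []       = 0
    dot (c ∷ cs) (x ∷ xs) = c * x + dot cs xs

    value : ∀ {n} → Form n → Vec ℕ n → ℕ
    value (k , cs) ρ = k + dot cs ρ

    unit : ∀ {n} → Fin n → Vec ℕ n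
    unit Fin.zero    = 1 ∷ replicate _ 0
    unit (Fin.suc i) = 0 ∷ unit i

    form : ∀ {n} → Lin n → Form n
    form (var i)  = 0 , unit i
    form (# k)    = k , replicate _ 0
    form (a :+ b) = proj₁ (form a) + proj₁ (form b) , zipWith _+_ (proj₂ (form a)) (proj₂ (form b))
    form (k :* a) = k * proj₁ (form a) , map (k *_) (proj₂ (form a))

    dot-0 : ∀ {n} (ρ : Vec ℕ n) → dot (replicate n 0) ρ ≡ 0
    dot-0 []      = refl
    dot-0 (x ∷ ρ) = dot-0 ρ

    dot-unit : ∀ {n} (i : Fin n) ρ → dot (unit i) ρ ≡ lookup ρ i
    dot-unit Fin.zero    (x ∷ ρ) = trans (cong (1 * x +_) (dot-0 ρ)) (trans (+-identityʳ _) (*-identityˡ x))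
    dot-unit (Fin.suc i) (x ∷ ρ) = dot-unit i ρ

    +-interchange : ∀ a b c d → (a + b) + (c + d) ≡ (a + c) + (b + d)
    +-interchange a b c d = begin
      (a + b) + (c + d)  ≡⟨ +-assoc a b (c + d) ⟩
      a + (b + (c + d))  ≡⟨ cong (a +_) (sym (+-assoc b c d)) ⟩
      a + (b + c + d)    ≡⟨ cong (λ t → a + (t + d)) (+-comm b c) ⟩
      a + (c + b + d)    ≡⟨ cong (a +_) (+-assoc c b d) ⟩
      a + (c + (b + d))  ≡⟨ sym (+-assoc a c (b + d)) ⟩
      (a + c) + (b + d)  ∎
      where open ≡-Reasoning

    dot-+ : ∀ {n} (as bs ρ : Vec ℕ n) → dot (zipWith _+_ as bs) ρ ≡ dot as ρ + dot bs ρ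
    dot-+ []       []       []      = refl
    dot-+ (a ∷ as) (b ∷ bs) (x ∷ ρ) =
      trans (cong₂ _+_ (*-distribʳ-+ x a b) (dot-+ as bs ρ)) (+-interchange (a * x) (b * x) (dot as ρ) (dot bs ρ))

    dot-* : ∀ {n} k (as ρ : Vec ℕ n) → dot (map (k *_) as) ρ ≡ k * dot as ρ
    dot-* k []       []      = sym (*-zeroʳ k)
    dot-* k (a ∷ as) (x ∷ ρ) =
      trans (cong₂ _+_ (*-assoc k a x) (dot-* k as ρ)) (sym (*-distribˡ-+ k (a * x) (dot as ρ)))

    form-correct : ∀ {n} (e : Lin n) ρ → ⟦ e ⟧ ρ ≡ value (form e) ρ
    form-correct (var i)  ρ = sym (dot-unit i ρ)
    form-correct (# k)    ρ = sym (trans (cong (k +_) (dot-0 ρ)) (+-identityʳ k))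
    form-correct (a :+ b) ρ = trans (cong₂ _+_ (form-correct a ρ) (form-correct b ρ))
      (trans (+-interchange (proj₁ (form a)) _ _ _)
             (cong (proj₁ (form a) + proj₁ (form b) +_) (sym (dot-+ (proj₂ (form a)) _ ρ))))
    form-correct (k :* a) ρ = trans (cong (k *_) (form-correct a ρ))
      (trans (*-distribˡ-+ k (proj₁ (form a)) _) (cong (k * proj₁ (form a) +_) (sym (dot-* k (proj₂ (form a)) ρ))))

    _≤ᵛ_ : ∀ {n} → Vec ℕ n → Vec ℕ n → Bool
    []       ≤ᵛ []       = true
    (a ∷ as) ≤ᵛ (b ∷ bs) = (a ≤ᵇ b) ∧ (as ≤ᵛ bs)

    T-∧ : ∀ {a b} → T (a ∧ b) → T a × T b
    T-∧ {true} t = tt , t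

    dot-mono : ∀ {n} (as bs ρ : Vec ℕ n) → T (as ≤ᵛ bs) → dot as ρ ≤ dot bs ρ
    dot-mono []       []       []      t = z≤n
    dot-mono (a ∷ as) (b ∷ bs) (x ∷ ρ) t =
      let t₁ , t₂ = T-∧ {a ≤ᵇ b} t in
      +-mono-≤ (*-monoˡ-≤ x (≤ᵇ⇒≤ a b t₁)) (dot-mono as bs ρ t₂)

    -- The variables range over ℕ, so comparing the constants and the coefficients one by one is
    -- sufficient.
    check : ∀ {n} → Ineq n → Bool
    check (a :≤ b) = (proj₁ (form a) ≤ᵇ proj₁ (form b)) ∧ (proj₂ (form a) ≤ᵛ proj₂ (form b))

    check-sound : ∀ {n} (c : Ineq n) → T (check c) → ∀ ρ → ⟦ c ⟧≤ ρ
    check-sound (a :≤ b) t ρ rewrite form-correct a ρ | form-correct b ρ =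
      let t₁ , t₂ = T-∧ {proj₁ (form a) ≤ᵇ proj₁ (form b)} t in
      +-mono-≤ (≤ᵇ⇒≤ (proj₁ (form a)) (proj₁ (form b)) t₁) (dot-mono (proj₂ (form a)) (proj₂ (form b)) ρ t₂)

    Entails : ∀ {n} → List (ℕ × Ineq n) → Ineq n → Vec ℕ n → Set
    Entails []             g ρ = ⟦ g ⟧≤ ρ
    Entails ((_ , h) ∷ hs) g ρ = ⟦ h ⟧≤ ρ → Entails hs g ρ

    -- A hypothesis a ≤ b is used crosswise: c + k b ≤ d + k a implies c + k a ≤ d + k a, hence c ≤
    -- d. This replaces the subtraction that ℕ does not have.
    transfer : ∀ {n} → List (ℕ × Ineq n) → Ineq n → Ineq n
    transfer []                    g        = g
    transfer ((k , (a :≤ b)) ∷ hs) (c :≤ d) = transfer hs (c :+ k :* b :≤ d :+ k :* a)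

    transfer-sound : ∀ {n} (hs : List (ℕ × Ineq n)) g ρ → ⟦ transfer hs g ⟧≤ ρ → Entails hs g ρ
    transfer-sound []                    g        ρ p   = p
    transfer-sound ((k , (a :≤ b)) ∷ hs) (c :≤ d) ρ p h = weaken hs _ (c :≤ d) ρ
        (λ q → +-cancelʳ-≤ (k * ⟦ a ⟧ ρ) _ _ (≤-trans (+-monoʳ-≤ (⟦ c ⟧ ρ) (*-monoʳ-≤ k h)) q))
        (transfer-sound hs _ ρ p)
      where
      weaken : ∀ {n} (hs : List (ℕ × Ineq n)) g g′ ρ → (⟦ g ⟧≤ ρ → ⟦ g′ ⟧≤ ρ) → Entails hs g ρ → Entails hs g′ ρ
      weaken []       g g′ ρ f e   = f e
      weaken (_ ∷ hs) g g′ ρ f e h = weaken hs g g′ ρ f (e h)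

  open LinearArithmetic using (check; transfer; Entails; check-sound; transfer-sound)

  infix 3 _⊢_
  record Sequent (n : ℕ) : Set where
    constructor _⊢_
    field
      hyps : List (ℕ × Ineq n)
      goal : Ineq n

  variables : ∀ n → Vec (Lin n) n
  variables n = map var (Vec.allFin n)

  -- Farkas' lemma: the numbers attached to the hypotheses are the multipliers of a nonnegative
  -- combination that yields the goal.
  linear : ∀ n (f : N-ary n (Lin n) (Sequent n)) →
           let s = f $ⁿ variables n in
           {_ : T (check (transfer (Sequent.hyps s) (Sequent.goal s)))} →
           ∀ⁿ n (curryⁿ {n = n} (Entails (Sequent.hyps s) (Sequent.goal s)))
  linear n f {t} = curry-∀ n _ (λ ρ → transfer-sound hs g ρ (check-sound (transfer hs g) t ρ))
    where
    hs = Sequent.hyps (f $ⁿ variables n)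
    g  = Sequent.goal (f $ⁿ variables n)

    curry-∀ : ∀ n (P : Vec ℕ n → Set) → (∀ ρ → P ρ) → ∀ⁿ n (curryⁿ {n = n} P)
    curry-∀ zero    P p   = p []
    curry-∀ (suc n) P p x = curry-∀ n (λ ρ → P (x ∷ ρ)) (λ ρ → p (x ∷ ρ))

  -- Sums over ranges

  𝟙 : ∀ {P : Set} → Dec P → ℕ
  𝟙 (yes _) = 1
  𝟙 (no _)  = 0

  𝟙-yes : ∀ {P : Set} (d : Dec P) → P → 𝟙 d ≡ 1
  𝟙-yes (yes _) p = refl
  𝟙-yes (no ¬p) p = contradiction p ¬p

  𝟙-no : ∀ {P : Set} (d : Dec P) → ¬ P → 𝟙 d ≡ 0
  𝟙-no (yes p) ¬p = contradiction p ¬p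
  𝟙-no (no _)  ¬p = refl

  𝟙-mono : ∀ {P Q : Set} (d : Dec P) (e : Dec Q) → (P → Q) → 𝟙 d ≤ 𝟙 e
  𝟙-mono (yes p) e f = ≤-reflexive (sym (𝟙-yes e (f p)))
  𝟙-mono (no _)  e f = z≤n

  𝟙-cong : ∀ {P Q : Set} (d : Dec P) (e : Dec Q) → (P → Q) → (Q → P) → 𝟙 d ≡ 𝟙 e
  𝟙-cong d e f g = ≤-antisym (𝟙-mono d e f) (𝟙-mono e d g)

  𝟙-split : ∀ {P Q : Set} (d : Dec P) (e : Dec Q) → 𝟙 d ≡ 𝟙 (d ×-dec e) + 𝟙 (d ×-dec ¬? e)
  𝟙-split (yes _) (yes _) = refl
  𝟙-split (yes _) (no _)  = refl
  𝟙-split (no _)  e       = refl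

  ∑ : ℕ → (ℕ → ℕ) → ℕ
  ∑ zero    f = 0
  ∑ (suc n) f = f n + ∑ n f

  syntax ∑ n (λ z → e) = ∑[ z < n ] e

  ∑-mono : ∀ n {f g : ℕ → ℕ} → (∀ z → z < n → f z ≤ g z) → ∑ n f ≤ ∑ n g
  ∑-mono zero    h = z≤n
  ∑-mono (suc n) h = +-mono-≤ (h n ≤-refl) (∑-mono n (λ z z<n → h z (m<n⇒m<1+n z<n)))

  ∑-cong : ∀ n {f g : ℕ → ℕ} → (∀ z → z < n → f z ≡ g z) → ∑ n f ≡ ∑ n g
  ∑-cong zero    h = refl
  ∑-cong (suc n) h = cong₂ _+_ (h n ≤-refl) (∑-cong n (λ z z<n → h z (m<n⇒m<1+n z<n)))

  ∑-+ : ∀ n (f g : ℕ → ℕ) → ∑[ z < n ] (f z + g z) ≡ ∑ n f + ∑ n g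
  ∑-+ zero    f g = refl
  ∑-+ (suc n) f g = trans (cong (f n + g n +_) (∑-+ n f g))
                          (LinearArithmetic.+-interchange (f n) (g n) (∑ n f) (∑ n g))

  ∑-* : ∀ n k (f : ℕ → ℕ) → ∑[ z < n ] (k * f z) ≡ k * ∑ n f
  ∑-* zero    k f = sym (*-zeroʳ k)
  ∑-* (suc n) k f = trans (cong (k * f n +_) (∑-* n k f)) (sym (*-distribˡ-+ k (f n) _))

  ∑-0 : ∀ n → ∑[ z < n ] 0 ≡ 0
  ∑-0 zero    = refl
  ∑-0 (suc n) = ∑-0 n

  ∑-swap : ∀ m n (f : ℕ → ℕ → ℕ) → ∑[ i < m ] ∑[ j < n ] f i j ≡ ∑[ j < n ] ∑[ i < m ] f i j
  ∑-swap zero    n f = sym (∑-0 n)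
  ∑-swap (suc m) n f = trans (cong (∑ n (f m) +_) (∑-swap m n f))
                             (sym (∑-+ n (f m) (λ j → ∑[ i < m ] f i j)))

  ∑-term : ∀ n (f : ℕ → ℕ) z → z < n → f z ≤ ∑ n f
  ∑-term (suc n) f z z<1+n with z ≟ n
  ... | yes refl = m≤m+n _ _
  ... | no  z≢n  = m≤n⇒m≤o+n (f n) (∑-term n f z (≤∧≢⇒< (s≤s⁻¹ z<1+n) z≢n))

  ∑-count-≤ : ∀ n {P : ℕ → Set} (P? : ∀ z → Dec (P z)) a b → (∀ z → P z → a ≤ z × z < b) → ∑[ z < n ] 𝟙 (P? z) ≤ b ∸ a
  ∑-count-≤ zero    P? a b h = z≤n
  ∑-count-≤ (suc n) {P} P? a b h with P? n
  ... | no _   = ∑-count-≤ n P? a b h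
  ... | yes pn = begin
    suc (∑[ z < n ] 𝟙 (P? z)) ≤⟨ s≤s (below n) ⟩
    suc (n ∸ a)               ≡⟨ sym (+-∸-assoc 1 (proj₁ (h n pn))) ⟩
    suc n ∸ a                 ≤⟨ ∸-monoˡ-≤ a (proj₂ (h n pn)) ⟩
    b ∸ a                     ∎
    where
    open ≤-Reasoning
    below : ∀ n → ∑[ z < n ] 𝟙 (P? z) ≤ n ∸ a
    below zero = z≤n
    below (suc n) with P? n
    ... | no _   = ≤-trans (below n) (∸-monoˡ-≤ a (n≤1+n n))
    ... | yes pn = ≤-trans (s≤s (below n)) (≤-reflexive (sym (+-∸-assoc 1 (proj₁ (h n pn)))))

  ∑-count-≥ : ∀ n {P : ℕ → Set} (P? : ∀ z → Dec (P z)) a b → b ≤ n → (∀ z → a ≤ z → z < b → P z) → b ∸ a ≤ ∑[ z < n ] 𝟙 (P? z)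
  ∑-count-≥ zero    P? a zero    b≤n h = ≤-reflexive (0∸n≡0 a)
  ∑-count-≥ (suc n) P? a b b≤n h with b ≟ suc n
  ... | no b≢ = m≤n⇒m≤o+n (𝟙 (P? n)) (∑-count-≥ n P? a b (s≤s⁻¹ (≤∧≢⇒< b≤n b≢)) h)
  ... | yes refl with a ≤? n
  ...   | no a≰n = ≤-trans (≤-reflexive (m≤n⇒m∸n≡0 (≰⇒> a≰n))) z≤n
  ...   | yes a≤n = begin
    suc n ∸ a ≡⟨ +-∸-assoc 1 a≤n ⟩
    suc (n ∸ a) ≤⟨ +-mono-≤ (≤-reflexive (sym (𝟙-yes (P? n) (h n a≤n ≤-refl))))
                            (∑-count-≥ n P? a n ≤-refl (λ z a≤z z<n → h z a≤z (m<n⇒m<1+n z<n))) ⟩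
    𝟙 (P? n) + ∑[ z < n ] 𝟙 (P? z) ∎
    where open ≤-Reasoning

  ∑-markov : ∀ n {P : ℕ → Set} (P? : ∀ z → Dec (P z)) (f : ℕ → ℕ) k →
             (∀ z → z < n → P z → k ≤ f z) → k * ∑[ z < n ] 𝟙 (P? z) ≤ ∑ n f
  ∑-markov n P? f k h = ≤-trans (≤-reflexive (sym (∑-* n k (λ z → 𝟙 (P? z))))) (∑-mono n term)
    where
    term : ∀ z → z < n → k * 𝟙 (P? z) ≤ f z
    term z z<n with P? z
    ... | yes p = ≤-trans (≤-reflexive (*-identityʳ k)) (h z z<n p)
    ... | no _  = ≤-trans (≤-reflexive (*-zeroʳ k)) z≤n

  -- Moves

  -- l and q are the nearest locations of free servers on the two sides of the request r, which is
  -- served at q if dir = true and at l if dir = false. Cell z is the interval from z to z + 1.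
  record Move : Set where
    constructor move
    field
      l r q : ℕ
      dir   : Bool

    lo hi olo ohi len olen : ℕ
    lo  = if dir then r else l
    hi  = if dir then q else r
    olo = if dir then l else r
    ohi = if dir then r else q
    len  = hi ∸ lo
    olen = ohi ∸ olo

    Path Other : ℕ → Set
    Path  z = lo ≤ z × z < hi
    Other z = olo ≤ z × z < ohi

    path? : ∀ z → Dec (Path z)
    path? z = (lo ≤? z) ×-dec (z <? hi)

    other? : ∀ z → Dec (Other z)
    other? z = (olo ≤? z) ×-dec (z <? ohi)

  open Move public

  -- A walk to the right lowers D by one on its path, a walk to the left raises it by one. With this
  -- sign every walk lowers the signed value, so that both directions are treated alike.
  signed : Bool → ℤ → ℤ
  signed true  a = a
  signed false a = ℤ.- a

  step : Bool → ℤ → ℤ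
  step true  = ℤ.pred
  step false = ℤ.suc

  shift : Move → (ℕ → ℤ) → ℕ → ℤ
  shift m D z with path? m z
  ... | yes _ = step (dir m) (D z)
  ... | no _  = D z

  shift-path : ∀ m D z → Path m z → shift m D z ≡ step (dir m) (D z)
  shift-path m D z p with path? m z
  ... | yes _ = refl
  ... | no ¬p = contradiction p ¬p

  shift-off : ∀ m D z → ¬ Path m z → shift m D z ≡ D z
  shift-off m D z ¬p with path? m z
  ... | yes p = contradiction p ¬p
  ... | no _  = refl

  signed-step : ∀ s a → signed s (step s a) ≡ ℤ.pred (signed s a)
  signed-step true  a = refl
  signed-step false a = lemma a
    where
    lemma : ∀ a → ℤ.- (ℤ.1ℤ ℤ.+ a) ≡ ℤ.-1ℤ ℤ.+ ℤ.- a
    lemma = ℤ-Solver.solve-∀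

  signed-step-opposite : ∀ s a → signed s (step (not s) a) ≡ ℤ.suc (signed s a)
  signed-step-opposite true  a = refl
  signed-step-opposite false a = lemma a
    where
    lemma : ∀ a → ℤ.- (ℤ.-1ℤ ℤ.+ a) ≡ ℤ.1ℤ ℤ.+ ℤ.- a
    lemma = ℤ-Solver.solve-∀

  ∣signed∣ : ∀ s a → ℤ.∣ signed s a ∣ ≡ ℤ.∣ a ∣
  ∣signed∣ true  a = refl
  ∣signed∣ false a = ℤₚ.∣-i∣≡∣i∣ a

  -- The cells of the path on which ∣ D ∣ grows, and the cells of the other side on which it would grow.
  Worse Blocked : (ℕ → ℤ) → Move → ℕ → Set
  Worse   D m z = Path m z × signed (dir m) (D z) ℤ.≤ 0ℤ
  Blocked D m z = Other m z × 0ℤ ℤ.≤ signed (dir m) (D z)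

  worse? : ∀ D m z → Dec (Worse D m z)
  worse? D m z = path? m z ×-dec (signed (dir m) (D z) ℤ.≤? 0ℤ)

  blocked? : ∀ D m z → Dec (Blocked D m z)
  blocked? D m z = other? m z ×-dec (0ℤ ℤ.≤? signed (dir m) (D z))

  Between : ℕ → ℕ → ℕ → Set
  Between a b r = a < r × r ≤ b

  between? : ∀ a b r → Dec (Between a b r)
  between? a b r = (a <? r) ×-dec (r ≤? b)

  requestsBetween : List Move → ℕ → ℕ → ℕ
  requestsBetween []       a b = 0
  requestsBetween (m ∷ ms) a b = 𝟙 (between? a b (r m)) + requestsBetween ms a b

  -- When m is made, no server strictly between its two ends is free, and free servers only
  -- disappear. So the ends of any later move avoid this open interval. The ends of m themselves may
  -- occur again: one of them is not taken, and the other may carry several servers.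
  After : Move → Move → Set
  After m m′ = (l m′ ≤ l m ⊎ q m ≤ l m′) × (q m′ ≤ l m ⊎ q m ≤ q m′)

  record Wf (m : Move) : Set where
    constructor wf
    field
      l<r : l m < r m
      r<q : r m < q m
  open Wf public

  -- Here z lies on the side that the walk turns away from and w on its path, so the direction
  -- decides which of them is the smaller.
  Oneside : Bool → ℕ → ℕ → List Move → ℕ
  Oneside true  z w ms = requestsBetween ms z w
  Oneside false z w ms = requestsBetween ms w z

  module _ (Z : ℕ) where

    worse blocked : (ℕ → ℤ) → Move → ℕ
    worse   D m = ∑[ z < Z ] 𝟙 (worse? D m z)
    blocked D m = ∑[ z < Z ] 𝟙 (blocked? D m z)

    -- Either the walk decreases ∣ D ∣ on at least three quarters of its path, or it goes to the
    -- nearer side while the walk to the farther side would increase ∣ D ∣ on at least a quarter.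
    Rule : (ℕ → ℤ) → Move → Set
    Rule D m = 4 * worse D m ≤ len m ⊎ (len m ≤ olen m × olen m ≤ 4 * blocked D m)

  total : ((ℕ → ℤ) → Move → ℕ) → (ℕ → ℤ) → List Move → ℕ
  total c D []       = 0
  total c D (m ∷ ms) = c D m + total c (shift m D) ms

  total-+ : ∀ c c′ D ms → total (λ D m → c D m + c′ D m) D ms ≡ total c D ms + total c′ D ms
  total-+ c c′ D []       = refl
  total-+ c c′ D (m ∷ ms) = trans (cong (c D m + c′ D m +_) (total-+ c c′ _ ms))
                                  (LinearArithmetic.+-interchange (c D m) (c′ D m) _ _)

  total-* : ∀ k c D ms → total (λ D m → k * c D m) D ms ≡ k * total c D ms
  total-* k c D []       = sym (*-zeroʳ k)
  total-* k c D (m ∷ ms) = trans (cong (k * c D m +_) (total-* k c _ ms)) (sym (*-distribˡ-+ k (c D m) _))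

  total-∑ : ∀ n (c : ℕ → (ℕ → ℤ) → Move → ℕ) D ms →
            total (λ D m → ∑[ z < n ] c z D m) D ms ≡ ∑[ z < n ] total (c z) D ms
  total-∑ n c D []       = sym (∑-0 n)
  total-∑ n c D (m ∷ ms) = trans (cong ((∑[ z < n ] c z D m) +_) (total-∑ n c _ ms)) (sym (∑-+ n _ _))

  pathLength : (ℕ → ℤ) → Move → ℕ
  pathLength D m = len m

  module _ (Z : ℕ) (E : ℕ → ℤ) where

    -- D z - E z is the number of later requests minus the number of free servers, both at
    -- locations ≤ z; no server strictly between l and q is free.
    Mono : (ℕ → ℤ) → Move → List Move → Set
    Mono D m ms = ∀ z z′ → l m ≤ z → z ≤ z′ → z′ < q m →
                  (D z ℤ.- E z) ℤ.+ pos (requestsBetween (m ∷ ms) z z′) ℤ.≤ D z′ ℤ.- E z′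

    data History : (ℕ → ℤ) → List Move → Set where
      []  : ∀ {D} → History D []
      cons : ∀ {D m ms} → Wf m → q m ≤ Z → Rule Z D m → Mono D m ms → All (After m) ms →
             History (shift m D) ms → History D (m ∷ ms)

    total-mono : ∀ {c c′} → (∀ {D m ms} → History D (m ∷ ms) → c D m ≤ c′ D m) →
                 ∀ {D ms} → History D ms → total c D ms ≤ total c′ D ms
    total-mono h []                       = z≤n
    total-mono h H@(cons _ _ _ _ _ H′) = +-mono-≤ (h H) (total-mono h H′)

    path-count : ∀ {m} → Wf m → q m ≤ Z → len m ≡ ∑[ z < Z ] 𝟙 (path? m z)
    path-count {m} w q≤Z = ≤-antisym (∑-count-≥ Z (path? m) _ _ (hi≤Z m w q≤Z) (λ z → _,_)) (∑-count-≤ Z (path? m) _ _ (λ z p → p))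
      where
      hi≤Z : ∀ m → Wf m → q m ≤ Z → hi m ≤ Z
      hi≤Z (move _ _ _ true)  w q≤Z = q≤Z
      hi≤Z (move _ _ _ false) w q≤Z = ≤-trans (<⇒≤ (r<q w)) q≤Z

    better? : ∀ (D : ℕ → ℤ) m z → Dec (Path m z × ¬ (signed (dir m) (D z) ℤ.≤ 0ℤ))
    better? D m z = path? m z ×-dec ¬? (signed (dir m) (D z) ℤ.≤? 0ℤ)

    better : (ℕ → ℤ) → Move → ℕ
    better D m = ∑[ z < Z ] 𝟙 (better? D m z)

    worse+better : ∀ {m} D → Wf m → q m ≤ Z → len m ≡ worse Z D m + better D m
    worse+better {m} D w q≤Z = trans (path-count w q≤Z)
        (trans (∑-cong Z (λ z _ → 𝟙-split (path? m z) (signed (dir m) (D z) ℤ.≤? 0ℤ)))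
               (∑-+ Z (λ z → 𝟙 (worse? D m z)) (λ z → 𝟙 (better? D m z))))

    norm : (ℕ → ℤ) → ℕ
    norm D = ∑[ z < Z ] ℤ.∣ D z ∣

    -- On the path the signed value a becomes a - 1, and ∣ a - 1 ∣ is ∣ a ∣ + 1 if a ≤ 0 and ∣ a ∣ -
    -- 1 otherwise.
    norm-shift : ∀ D m → norm D + worse Z D m ≡ norm (shift m D) + better D m
    norm-shift D m = begin
      norm D + worse Z D m                                            ≡⟨ sym (∑-+ Z (λ z → ℤ.∣ D z ∣) (λ z → 𝟙 (worse? D m z))) ⟩
      ∑[ z < Z ] (ℤ.∣ D z ∣ + 𝟙 (worse? D m z))                     ≡⟨ ∑-cong Z (λ z _ → cell z) ⟩
      ∑[ z < Z ] (ℤ.∣ shift m D z ∣ + 𝟙 (better? D m z))            ≡⟨ ∑-+ Z (λ z → ℤ.∣ shift m D z ∣) (λ z → 𝟙 (better? D m z)) ⟩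
      norm (shift m D) + better D m                                 ∎
      where
      open ≡-Reasoning
      pred-∣∣ : ∀ a → ℤ.∣ a ∣ + 𝟙 (a ℤ.≤? 0ℤ) ≡ ℤ.∣ ℤ.pred a ∣ + 𝟙 (¬? (a ℤ.≤? 0ℤ))
      pred-∣∣ (pos zero)   = refl
      pred-∣∣ (pos (suc n))  = trans (+-identityʳ _) (+-comm 1 n)
      pred-∣∣ -[1+ n ]   = trans (+-comm _ 1) (sym (+-identityʳ _))

      cell : ∀ z → ℤ.∣ D z ∣ + 𝟙 (worse? D m z) ≡ ℤ.∣ shift m D z ∣ + 𝟙 (better? D m z)
      cell z with path? m z
      ... | no _  = refl
      ... | yes p = begin
        ℤ.∣ D z ∣ + 𝟙 (yes p ×-dec (a ℤ.≤? 0ℤ))            ≡⟨ cong₂ _+_ (sym (∣signed∣ s (D z))) (𝟙-cong _ _ proj₂ (p ,_)) ⟩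
        ℤ.∣ a ∣ + 𝟙 (a ℤ.≤? 0ℤ)                            ≡⟨ pred-∣∣ a ⟩
        ℤ.∣ ℤ.pred a ∣ + 𝟙 (¬? (a ℤ.≤? 0ℤ))                     ≡⟨ cong₂ _+_ (trans (cong ℤ.∣_∣ (sym (signed-step s (D z)))) (∣signed∣ s (step s (D z)))) (𝟙-cong _ _ (p ,_) proj₂) ⟩
        ℤ.∣ step s (D z) ∣ + 𝟙 (yes p ×-dec ¬? (a ℤ.≤? 0ℤ))   ∎
        where
        s = dir m
        a = signed s (D z)

    -- The moves that violate the first alternative of `Rule`, hence satisfy the second. All others
    -- worsen at most a quarter of their path and are absorbed in `total-length`.
    near : (ℕ → ℤ) → Move → Set
    near D m = len m < 4 * worse Z D m × len m ≤ olen m × olen m ≤ 4 * blocked Z D m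

    near? : ∀ D m → Dec (near D m)
    near? D m = (len m <? 4 * worse Z D m) ×-dec ((len m ≤? olen m) ×-dec (olen m ≤? 4 * blocked Z D m))

    nearWorse : (ℕ → ℤ) → Move → ℕ
    nearWorse D m = 𝟙 (near? D m) * worse Z D m

    total-better : ∀ {D ms} → History D ms → total better D ms ≤ norm D + total (worse Z) D ms
    total-better []                              = z≤n
    total-better {D} {m ∷ ms} (cons _ _ _ _ _ H) =
      linear 6 (λ b w n n′ B W → 1 · n′ :+ b :≤ n :+ w ∷ 1 · B :≤ n′ :+ W ∷ [] ⊢ b :+ B :≤ n :+ (w :+ W))
        (better D m) (worse Z D m) (norm D) (norm (shift m D)) (total better _ ms) (total (worse Z) _ ms)
        (≤-reflexive (sym (norm-shift D m))) (total-better H)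

    -- The potential ∑ ∣ D ∣ starts at 0 and stays nonnegative, so at most as many cells get better
    -- as get worse, and the length Y is at most 2 W. Moves that are not near satisfy 4 worse ≤
    -- length, so 4 W ≤ Y + 4 M. Together 2 Y ≤ Y + 4 M.
    total-length : ∀ {D ms} → History D ms → (∀ z → D z ≡ 0ℤ) →
                   total pathLength D ms ≤ 4 * total nearWorse D ms
    total-length {D} {ms} H D≡0 =
      linear 5 (λ Y W B M N → 2 · Y :≤ W :+ B ∷ 2 · B :≤ N :+ W ∷ 2 · N :≤ # 0 ∷ 1 · 4 :* W :≤ Y :+ 4 :* M ∷ [] ⊢ Y :≤ 4 :* M)
        (total pathLength D ms) (total (worse Z) D ms) (total better D ms) (total nearWorse D ms) (norm D)
        (≤-trans (total-mono (λ { {D} (cons w q≤Z _ _ _ _) → ≤-reflexive (worse+better D w q≤Z) }) H)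
                 (≤-reflexive (total-+ (worse Z) better D ms)))
        (total-better H)
        (≤-reflexive (trans (∑-cong Z (λ z _ → cong ℤ.∣_∣ (D≡0 z))) (∑-0 Z)))
        (begin
          4 * total (worse Z) D ms                                 ≡⟨ sym (total-* 4 (worse Z) D ms) ⟩
          total (λ D m → 4 * worse Z D m) D ms                   ≤⟨ total-mono (λ {D} {m} H → perMove H) H ⟩
          total (λ D m → pathLength D m + 4 * nearWorse D m) D ms ≡⟨ total-+ pathLength (λ D m → 4 * nearWorse D m) D ms ⟩
          total pathLength D ms + total (λ D m → 4 * nearWorse D m) D ms ≡⟨ cong (total pathLength D ms +_) (total-* 4 nearWorse D ms) ⟩
          total pathLength D ms + 4 * total nearWorse D ms        ∎)
      where
      open ≤-Reasoning
      perMove : ∀ {D m ms} → History D (m ∷ ms) → 4 * worse Z D m ≤ len m + 4 * nearWorse D m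
      perMove {D} {m} (cons _ _ rule _ _ _) with near? D m
      ... | yes _ = ≤-trans (≤-reflexive (cong (4 *_) (sym (*-identityˡ (worse Z D m))))) (m≤n+m _ (len m))
      ... | no ¬near with len m <? 4 * worse Z D m | rule
      ...   | no ≮  | _          = m≤n⇒m≤n+o _ (≮⇒≥ ≮)
      ...   | yes < | inj₁ ≤len  = m≤n⇒m≤n+o _ ≤len
      ...   | yes < | inj₂ (a , b) = contradiction (< , a , b) ¬near

  -- Crossings

  i≤∣i∣ : ∀ a → a ℤ.≤ pos ℤ.∣ a ∣
  i≤∣i∣ (pos n)  = ℤₚ.≤-refl
  i≤∣i∣ -[1+ n ] = ℤ.-≤+

  -i≤∣i∣ : ∀ a → ℤ.- a ℤ.≤ pos ℤ.∣ a ∣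
  -i≤∣i∣ a = subst (λ t → ℤ.- a ℤ.≤ pos t) (ℤₚ.∣-i∣≡∣i∣ a) (i≤∣i∣ (ℤ.- a))

  a≤0⇒∣a∣≡-a : ∀ {a} → a ℤ.≤ 0ℤ → pos ℤ.∣ a ∣ ≡ ℤ.- a
  a≤0⇒∣a∣≡-a {pos zero} p   = refl
  a≤0⇒∣a∣≡-a { -[1+ n ]} p = refl
  a≤0⇒∣a∣≡-a {pos (suc n)} (ℤ.+≤+ ())

  -- The hypothesis says N - a ≤ e′ - e - b. The sign of a turns - a into ∣ a ∣, and the sign of b
  -- allows it to be dropped.
  gap-bound : ∀ N {a b e e′} → a ℤ.≤ 0ℤ → 0ℤ ℤ.≤ b → (b ℤ.- e′) ℤ.+ pos N ℤ.≤ a ℤ.- e →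
              N + ℤ.∣ a ∣ ≤ ℤ.∣ e′ ∣ + ℤ.∣ e ∣
  gap-bound N {a} {b} {e} {e′} a≤0 0≤b h = ℤₚ.drop‿+≤+ (begin
    pos N ℤ.+ pos ℤ.∣ a ∣                              ≡⟨ cong (λ t → pos N ℤ.+ t) (a≤0⇒∣a∣≡-a a≤0) ⟩
    pos N ℤ.- a                                        ≡⟨ identity₁ (pos N) a b e′ ⟩
    ((b ℤ.- e′) ℤ.+ pos N) ℤ.+ (e′ ℤ.- b ℤ.- a)        ≤⟨ ℤₚ.+-monoˡ-≤ (e′ ℤ.- b ℤ.- a) h ⟩
    (a ℤ.- e) ℤ.+ (e′ ℤ.- b ℤ.- a)                     ≡⟨ identity₂ a b e e′ ⟩
    (e′ ℤ.+ ℤ.- e) ℤ.+ ℤ.- b                           ≤⟨ ℤₚ.+-monoʳ-≤ (e′ ℤ.+ ℤ.- e) (ℤₚ.neg-mono-≤ 0≤b) ⟩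
    (e′ ℤ.+ ℤ.- e) ℤ.+ 0ℤ                              ≡⟨ ℤₚ.+-identityʳ _ ⟩
    e′ ℤ.+ ℤ.- e                                       ≤⟨ ℤₚ.+-mono-≤ (i≤∣i∣ e′) (-i≤∣i∣ e) ⟩
    pos ℤ.∣ e′ ∣ ℤ.+ pos ℤ.∣ e ∣                       ∎)
    where
    open ℤₚ.≤-Reasoning
    identity₁ : ∀ n a b e′ → n ℤ.- a ≡ ((b ℤ.- e′) ℤ.+ n) ℤ.+ (e′ ℤ.- b ℤ.- a)
    identity₁ = ℤ-Solver.solve-∀
    identity₂ : ∀ a b e e′ → (a ℤ.- e) ℤ.+ (e′ ℤ.- b ℤ.- a) ≡ (e′ ℤ.+ ℤ.- e) ℤ.+ ℤ.- b
    identity₂ = ℤ-Solver.solve-∀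

  -- The distance from r to the far end of cell z.
  τ : ℕ → ℕ → ℕ
  τ r z = (r ∸ z) + (suc z ∸ r)

  τ-left : ∀ {r z} → z < r → τ r z ≡ r ∸ z
  τ-left {r} {z} z<r = trans (cong (r ∸ z +_) (m≤n⇒m∸n≡0 z<r)) (+-identityʳ _)

  τ-right : ∀ {r z} → r ≤ z → τ r z ≡ suc z ∸ r
  τ-right {r} {z} r≤z = cong (_+ (suc z ∸ r)) (m≤n⇒m∸n≡0 r≤z)

  -- The later walk passes w, which lies between the ends of m₀, and must end outside them. It
  -- therefore traverses the whole other side of m₀ after starting from a request beyond w.
  opposite-long : ∀ s {m₀ m w} → dir m₀ ≡ s → dir m ≡ not s → After m₀ m → Path m₀ w → Path m w → olen m₀ ≤ len m
  opposite-long true  {move _ _ _ true}  {move _ _ _ false} refl refl (inj₁ l≤l₀ , _) (r₀≤w , _) (_ , w<r) =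
    ∸-mono (≤-trans r₀≤w (<⇒≤ w<r)) l≤l₀
  opposite-long true  {move _ _ _ true}  {move _ _ _ false} refl refl (inj₂ q₀≤l , _) (_ , w<q₀) (l≤w , _) =
    contradiction (≤-trans q₀≤l l≤w) (<⇒≱ w<q₀)
  opposite-long false {move _ _ _ false} {move _ _ _ true}  refl refl (_ , inj₂ q₀≤q) (_ , w<r₀) (r≤w , _) =
    ∸-mono q₀≤q (≤-trans r≤w (<⇒≤ w<r₀))
  opposite-long false {move _ _ _ false} {move _ _ _ true}  refl refl (_ , inj₁ q≤l₀) (l₀≤w , _) (_ , w<q) =
    contradiction (≤-trans q≤l₀ l₀≤w) (<⇒≱ w<q)

  -- The later walk starts on the far side of w and must leave the interval between the ends of m₀,
  -- so it covers everything from w to the request of m₀.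
  later-longer : ∀ s {m₀ m w} → dir m₀ ≡ not s → dir m ≡ s → Wf m₀ → After m₀ m → Path m₀ w → Path m w → τ (r m₀) w ≤ len m
  later-longer true  {move _ _ _ false} {move _ _ _ true}  refl refl w₀ (_ , inj₂ q₀≤q) (_ , w<r₀) (r≤w , _) =
    ≤-trans (≤-reflexive (τ-left w<r₀)) (∸-mono (≤-trans (<⇒≤ (r<q w₀)) q₀≤q) r≤w)
  later-longer true  {move _ _ _ false} {move _ _ _ true}  refl refl w₀ (_ , inj₁ q≤l₀) (l₀≤w , _) (_ , w<q) =
    contradiction (≤-trans q≤l₀ l₀≤w) (<⇒≱ w<q)
  later-longer false {move _ _ _ true}  {move _ _ _ false} refl refl w₀ (inj₁ l≤l₀ , _) (r₀≤w , _) (_ , w<r) =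
    ≤-trans (≤-reflexive (τ-right r₀≤w)) (∸-mono w<r (≤-trans l≤l₀ (<⇒≤ (l<r w₀))))
  later-longer false {move _ _ _ true}  {move _ _ _ false} refl refl w₀ (inj₂ q₀≤l , _) (_ , w<q₀) (l≤w , _) =
    contradiction (≤-trans q₀≤l l≤w) (<⇒≱ w<q₀)

  negPart : ℤ → ℕ
  negPart (pos _)  = 0
  negPart -[1+ n ] = suc n

  negPart-pred : ∀ a → negPart a ≤ negPart (ℤ.pred a)
  negPart-pred (pos n)  = z≤n
  negPart-pred -[1+ n ] = n≤1+n _

  negPart-pred-≤0 : ∀ {a} → a ℤ.≤ 0ℤ → negPart (ℤ.pred a) ≡ suc (negPart a)
  negPart-pred-≤0 {pos zero}    p = refl
  negPart-pred-≤0 { -[1+ n ]}   p = refl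
  negPart-pred-≤0 {pos (suc n)} (ℤ.+≤+ ())

  negPart-suc : ∀ a → negPart a ≤ suc (negPart (ℤ.suc a))
  negPart-suc (pos n)          = z≤n
  negPart-suc -[1+ zero ]      = ≤-refl
  negPart-suc -[1+ suc n ]     = ≤-refl

  negPart-≤0 : ∀ {a} → a ℤ.≤ 0ℤ → negPart a ≡ ℤ.∣ a ∣
  negPart-≤0 {pos zero}    p = refl
  negPart-≤0 { -[1+ n ]}   p = refl
  negPart-≤0 {pos (suc n)} (ℤ.+≤+ ())

  module _ (Z : ℕ) (E : ℕ → ℤ) where

    private
      Hist = History Z E

    -- For a walk to the left, z and w are exchanged and both sides change sign; the two reversals
    -- cancel.
    signed-mono : ∀ {D m ms z w} → Hist D (m ∷ ms) → Other m z → Path m w →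
                  (signed (dir m) (D z) ℤ.- signed (dir m) (E z)) ℤ.+ pos (Oneside (dir m) z w (m ∷ ms))
                  ℤ.≤ signed (dir m) (D w) ℤ.- signed (dir m) (E w)
    signed-mono {D} {move l r q true}  {ms} {z} {w} (cons wf₀ _ _ mono _ _) (l≤z , z<r) (r≤w , w<q) =
      mono z w l≤z (≤-trans (<⇒≤ z<r) r≤w) w<q
    signed-mono {D} {move l r q false} {ms} {z} {w} (cons wf₀ _ _ mono _ _) (r≤z , z<q) (l≤w , w<r) =
      subst₂ ℤ._≤_ (identity₁ (D w) (E w) (D z) (E z) (pos N)) (identity₂ (D w) (E w) (D z) (E z) (pos N))
        (ℤₚ.+-monoʳ-≤ ((ℤ.- (D z ℤ.- E z)) ℤ.- (D w ℤ.- E w)) (mono w z l≤w (≤-trans (<⇒≤ w<r) r≤z) z<q))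
      where
      N = requestsBetween (move l r q false ∷ ms) w z
      identity₁ : ∀ dw ew dz ez n → ((ℤ.- (dz ℤ.- ez)) ℤ.- (dw ℤ.- ew)) ℤ.+ ((dw ℤ.- ew) ℤ.+ n)
                                    ≡ ((ℤ.- dz) ℤ.- (ℤ.- ez)) ℤ.+ n
      identity₁ = ℤ-Solver.solve-∀
      identity₂ : ∀ dw ew dz ez n → ((ℤ.- (dz ℤ.- ez)) ℤ.- (dw ℤ.- ew)) ℤ.+ (dz ℤ.- ez)
                                    ≡ (ℤ.- dw) ℤ.- (ℤ.- ew)
      identity₂ = ℤ-Solver.solve-∀

    -- Requests between a blocked and a worsened cell will have to be served across one of the two.
    blocked-worse : ∀ {D m ms z w} → Hist D (m ∷ ms) → Blocked D m z → Worse D m w →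
                    Oneside (dir m) z w (m ∷ ms) + ℤ.∣ D w ∣ ≤ ℤ.∣ E z ∣ + ℤ.∣ E w ∣
    blocked-worse {D} {m} {ms} {z} {w} H (oz , 0≤Dz) (pw , Dw≤0) =
      subst₂ _≤_ (cong (Oneside (dir m) z w (m ∷ ms) +_) (∣signed∣ (dir m) (D w)))
                 (cong₂ _+_ (∣signed∣ (dir m) (E z)) (∣signed∣ (dir m) (E w)))
        (gap-bound (Oneside (dir m) z w (m ∷ ms)) Dw≤0 0≤Dz (signed-mono H oz pw))

    Oneside-head : ∀ m ms {z w} → Other m z → Path m w → 1 ≤ Oneside (dir m) z w (m ∷ ms)
    Oneside-head (move l r q true)  ms {z} {w} (_ , z<r) (r≤w , _) =
      ≤-trans (≤-reflexive (sym (𝟙-yes (between? z w r) (z<r , r≤w)))) (m≤m+n _ _)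
    Oneside-head (move l r q false) ms {z} {w} (r≤z , _) (_ , w<r) =
      ≤-trans (≤-reflexive (sym (𝟙-yes (between? w z r) (w<r , r≤z)))) (m≤m+n _ _)

    Opposite : Bool → ℕ → ℕ → Move → Set
    Opposite s w ρ m = dir m ≡ not s × Path m w × 16 * τ (r m) w ≤ ρ × ρ ≤ len m

    opposite? : ∀ s w ρ m → Dec (Opposite s w ρ m)
    opposite? s w ρ m = (dir m Boolₚ.≟ not s) ×-dec (path? m w ×-dec ((16 * τ (r m) w ≤? ρ) ×-dec (ρ ≤? len m)))

    record Crossing (s : Bool) (w ρ : ℕ) (D : ℕ → ℤ) (m : Move) : Set where
      constructor crossing
      field
        direction : dir m ≡ s
        worsens   : Worse D m w
        short     : 16 * len m ≤ ρ
        long      : ρ ≤ olen m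

    -- Once w has been crossed, N + min K (negPart D) grows only when U does; an opposite crossing
    -- that is not counted in U comes from so far away that w is never crossed again.
    module _ (s : Bool) (w ρ K : ℕ) {Ev : (ℕ → ℤ) → Move → Set} (ev? : ∀ D m → Dec (Ev D m))
             (ev⇒crossing : ∀ {D m} → Ev D m → Crossing s w ρ D m)
             (shallow : ∀ {D m ms} → Hist D (m ∷ ms) → Ev D m → suc ℤ.∣ D w ∣ ≤ K) where

      private
        N U : (ℕ → ℤ) → List Move → ℕ
        N = total (λ D m → 𝟙 (ev? D m))
        U = total (λ D m → 𝟙 (opposite? s w ρ m))

        -- Walks that are not events may push D at w arbitrarily far down. The cap K keeps the
        -- potential bounded, and `shallow` guarantees that an event is never stopped by the cap.
        depth : (ℕ → ℤ) → ℕ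
        depth D = K ⊓ negPart (signed s (D w))

        depth-event : ∀ {D m ms} → Hist D (m ∷ ms) → Ev D m → suc (depth D) ≤ depth (shift m D)
        depth-event {D} {m} H e with ev⇒crossing e
        ... | crossing refl (pw , D≤0) _ _ = begin
          suc (K ⊓ negPart a)             ≤⟨ s≤s (m⊓n≤n K (negPart a)) ⟩
          suc (negPart a)                 ≡⟨ sym (m≥n⇒m⊓n≡n bound) ⟩
          K ⊓ suc (negPart a)             ≡⟨ cong (K ⊓_) (sym (negPart-pred-≤0 D≤0)) ⟩
          K ⊓ negPart (ℤ.pred a)          ≡⟨ cong (λ t → K ⊓ negPart t) (sym (signed-step s (D w))) ⟩
          K ⊓ negPart (signed s (step s (D w))) ≡⟨ cong (λ t → K ⊓ negPart (signed s t)) (sym (shift-path m D w pw)) ⟩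
          depth (shift m D)               ∎
          where
          open ≤-Reasoning
          a = signed s (D w)
          bound : suc (negPart a) ≤ K
          bound = subst (λ t → suc t ≤ K) (sym (trans (negPart-≤0 D≤0) (∣signed∣ s (D w)))) (shallow H e)

        depth-same : ∀ {D m} → dir m ≡ s → Path m w → depth D ≤ depth (shift m D)
        depth-same {D} {m} refl pw = ⊓-monoʳ-≤ K (≤-trans (negPart-pred _)
          (≤-reflexive (cong negPart (trans (sym (signed-step s (D w))) (cong (signed s) (sym (shift-path m D w pw)))))))

        depth-opposite : ∀ {D m} → dir m ≡ not s → Path m w → depth D ≤ suc (depth (shift m D))
        depth-opposite {D} {m} d pw = ≤-trans (⊓-mono-≤ (n≤1+n K) (negPart-suc _))
          (≤-reflexive (cong (λ t → suc (K ⊓ negPart t)) (trans (sym (signed-step-opposite s (D w)))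
             (cong (signed s) (sym (trans (shift-path m D w pw) (cong (λ t → step t (D w)) d)))))))

        depth-off : ∀ {D m} → ¬ Path m w → depth D ≡ depth (shift m D)
        depth-off {D} {m} ¬p = cong (λ t → K ⊓ negPart (signed s t)) (sym (shift-off m D w ¬p))

        -- By `later-longer`, a later crossing of w in direction s is at least as long as the
        -- distance from the request of m₀ to w. That distance exceeds ρ / 16, so the crossing is
        -- too long for an event.
        dead : ∀ {m₀ D ms} → dir m₀ ≡ not s → Wf m₀ → Path m₀ w → ρ < 16 * τ (r m₀) w →
               All (After m₀) ms → N D ms ≡ 0
        dead {ms = []}     d wf₀ p far []       = refl
        dead {m₀} {D} {m ∷ ms} d wf₀ p far (a ∷ as) with ev? D m
        ... | no _  = dead d wf₀ p far as
        ... | yes e with ev⇒crossing e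
        ...   | crossing ds (pw , _) short _ =
          contradiction (≤-trans (*-monoʳ-≤ 16 (later-longer s d ds wf₀ a p pw)) short) (<⇒≱ far)

        not-same : ∀ {d} s → d ≢ s → d ≡ not s
        not-same {true}  true  n = contradiction refl n
        not-same {true}  false n = refl
        not-same {false} true  n = refl
        not-same {false} false n = contradiction refl n

        -- The earlier crossing m₀ is kept as a witness: its long other side forces every later
        -- opposite crossing of w to have length at least ρ, as `Opposite` demands. An event raises
        -- the depth by one, and only an opposite crossing can lower it, by at most one.
        active : ∀ {m₀ D ms} → dir m₀ ≡ s → Path m₀ w → ρ ≤ olen m₀ → All (After m₀) ms →
                 Hist D ms → N D ms + depth D ≤ U D ms + K
        active {D = D} d₀ p₀ long₀ [] [] = m⊓n≤m K _
        active {m₀} {D} {m ∷ ms} d₀ p₀ long₀ (a₀ ∷ as₀) H@(cons wf₁ q≤Z rule mono as H′) with ev? D m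
        ... | yes e =
          linear 6 (λ n d d′ u o k → 1 · n :+ d′ :≤ u :+ k ∷ 1 · d :< d′ ∷ [] ⊢ (# 1 :+ n) :+ d :≤ (o :+ u) :+ k)
            (N (shift m D) ms) (depth D) (depth (shift m D)) (U (shift m D) ms) (𝟙 (opposite? s w ρ m)) K
            (active d₀ p₀ long₀ as₀ H′) (depth-event H e)
        ... | no _ with path? m w | dir m Boolₚ.≟ s
        ...   | no ¬p | _ =
          linear 6 (λ n d d′ u o k → 1 · n :+ d′ :≤ u :+ k ∷ 1 · d :≤ d′ ∷ [] ⊢ n :+ d :≤ (o :+ u) :+ k)
            (N (shift m D) ms) (depth D) (depth (shift m D)) (U (shift m D) ms) _ K
            (active d₀ p₀ long₀ as₀ H′) (≤-reflexive (depth-off {D} {m} ¬p))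
        ...   | yes p | yes d =
          linear 6 (λ n d d′ u o k → 1 · n :+ d′ :≤ u :+ k ∷ 1 · d :≤ d′ ∷ [] ⊢ n :+ d :≤ (o :+ u) :+ k)
            (N (shift m D) ms) (depth D) (depth (shift m D)) (U (shift m D) ms) _ K
            (active d₀ p₀ long₀ as₀ H′) (depth-same {D} {m} d p)
        ...   | yes p | no d≢s with 16 * τ (r m) w ≤? ρ
        ...     | yes close =
          linear 6 (λ n d d′ u o k → 1 · n :+ d′ :≤ u :+ k ∷ 1 · d :≤ # 1 :+ d′ ∷ 1 · # 1 :≤ o ∷ [] ⊢ n :+ d :≤ (o :+ u) :+ k)
            (N (shift m D) ms) (depth D) (depth (shift m D)) (U (shift m D) ms) _ K
            (active d₀ p₀ long₀ as₀ H′) (depth-opposite {D} {m} (not-same s d≢s) p)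
            (≤-reflexive (sym (𝟙-yes ((dir m Boolₚ.≟ not s) ×-dec (yes p ×-dec (yes close ×-dec (ρ ≤? len m))))
              (not-same s d≢s , p , close , ≤-trans long₀ (opposite-long s d₀ (not-same s d≢s) a₀ p₀ p)))))
        ...     | no far =
          ≤-trans (≤-reflexive (cong (_+ depth D) (dead (not-same s d≢s) wf₁ p (≰⇒> far) as)))
                  (≤-trans (m⊓n≤m K _) (m≤n+m K _))

      -- Moves before the first event add nothing to the left side, whatever they do to D. From the
      -- first event on, `active` applies with this event as the witness.
      crossing-count : ∀ {D ms} → Hist D ms → N D ms ≤ U D ms + K
      crossing-count [] = z≤n
      crossing-count {D} {m ∷ ms} H@(cons wf₁ q≤Z rule mono as H′) with ev? D m
      ... | no _ = ≤-trans (crossing-count H′) (+-monoˡ-≤ K (m≤n+m _ _))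
      ... | yes e with ev⇒crossing e
      ...   | crossing d (p , _) _ long =
        linear 6 (λ n d d′ u o k → 1 · n :+ d′ :≤ u :+ k ∷ 1 · d :< d′ ∷ [] ⊢ # 1 :+ n :≤ (o :+ u) :+ k)
          (N (shift m D) ms) (depth D) (depth (shift m D)) (U (shift m D) ms) (𝟙 (opposite? s w ρ m)) K
          (active d p long as H′) (depth-event H e)

  -- Comparable sides

  ∣-∣-< : ∀ {m n k} → m < n + k → n < m + k → ∣ m - n ∣ < k
  ∣-∣-< {m} {n} {k} p q with ≤-total m n
  ... | inj₁ m≤n = subst (_< k) (sym (m≤n⇒∣m-n∣≡n∸m m≤n)) (m<n+o⇒m∸n<o n m {k} {{>-nonZero k>0}} q)
    where k>0 = linear 3 (λ m n k → 1 · m :≤ n ∷ 1 · n :< m :+ k ∷ [] ⊢ # 0 :< k) m n k m≤n q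
  ... | inj₂ n≤m = subst (_< k) (sym (m≤n⇒∣n-m∣≡n∸m n≤m)) (m<n+o⇒m∸n<o m n {k} {{>-nonZero k>0}} p)
    where k>0 = linear 3 (λ m n k → 1 · m :≤ n ∷ 1 · n :< m :+ k ∷ [] ⊢ # 0 :< k) n m k n≤m p

  ∣-∣-<⁻ : ∀ {m n k} → ∣ m - n ∣ < k → m < n + k
  ∣-∣-<⁻ {m} {n} {k} p = linear 4 (λ m n k d → 1 · d :< k ∷ 1 · m :≤ n :+ d ∷ [] ⊢ m :< n :+ k) m n k ∣ m - n ∣ p (m≤n+∣m-n∣ m n)

  len+lo : ∀ {m} → Wf m → len m + lo m ≡ hi m
  len+lo {move _ _ _ true}  w = m∸n+n≡m (<⇒≤ (r<q w))
  len+lo {move _ _ _ false} w = m∸n+n≡m (<⇒≤ (l<r w))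

  olen+olo : ∀ {m} → Wf m → olen m + olo m ≡ ohi m
  olen+olo {move _ _ _ true}  w = m∸n+n≡m (<⇒≤ (l<r w))
  olen+olo {move _ _ _ false} w = m∸n+n≡m (<⇒≤ (r<q w))

  other-path-distance : ∀ {m z w} → Wf m → Other m z → Path m w → ∣ w - z ∣ < len m + olen m
  other-path-distance {m@(move l r q true)} {z} {w} wf₀ (l≤z , z<r) (r≤w , w<q) = ∣-∣-<
    (linear 7 (λ l r q z w a b → 1 · w :< q ∷ 1 · q :≤ a :+ r ∷ 1 · r :≤ b :+ l ∷ 1 · l :≤ z ∷ [] ⊢ w :< z :+ (a :+ b))
      l r q z w (len m) (olen m) w<q (≤-reflexive (sym (len+lo wf₀))) (≤-reflexive (sym (olen+olo wf₀))) l≤z)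
    (linear 5 (λ z r w a b → 1 · z :< r ∷ 1 · r :≤ w ∷ [] ⊢ z :< w :+ (a :+ b)) z r w (len m) (olen m) z<r r≤w)
  other-path-distance {m@(move l r q false)} {z} {w} wf₀ (r≤z , z<q) (l≤w , w<r) = ∣-∣-<
    (linear 5 (λ z r w a b → 1 · w :< r ∷ 1 · r :≤ z ∷ [] ⊢ w :< z :+ (a :+ b)) z r w (len m) (olen m) w<r r≤z)
    (linear 7 (λ l r q z w a b → 1 · z :< q ∷ 1 · q :≤ b :+ r ∷ 1 · r :≤ a :+ l ∷ 1 · l :≤ w ∷ [] ⊢ z :< w :+ (a :+ b))
      l r q z w (len m) (olen m) z<q (≤-reflexive (sym (olen+olo wf₀))) (≤-reflexive (sym (len+lo wf₀))) l≤w)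

  module _ (Z r t : ℕ) {P : ℕ → Set} (P? : ∀ z → Dec (P z)) where

    count-left : (∀ z → P z → z < r × τ r z ≤ t) → ∑[ z < Z ] 𝟙 (P? z) ≤ t
    count-left h = ≤-trans (∑-count-≤ Z P? (r ∸ t) r inside) (m≤n+o⇒m∸n≤o r (r ∸ t) (m≤n+m∸n r t ⟨≡⟩ +-comm t (r ∸ t)))
      where
      infixl 4 _⟨≡⟩_
      _⟨≡⟩_ : ∀ {a b c} → a ≤ b → b ≡ c → a ≤ c
      p ⟨≡⟩ refl = p
      inside : ∀ z → P z → r ∸ t ≤ z × z < r
      inside z p with h z p
      ... | z<r , τ≤t = m≤n+o⇒m∸n≤o r t (m∸n≤o⇒m≤n+o r z (≤-trans (≤-reflexive (sym (τ-left z<r))) τ≤t) ⟨≡⟩ +-comm z t) , z<r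
        where
        m∸n≤o⇒m≤n+o : ∀ m n {o} → m ∸ n ≤ o → m ≤ n + o
        m∸n≤o⇒m≤n+o m n p = ≤-trans (m≤n+m∸n m n) (+-monoʳ-≤ n p)

    count-right : (∀ z → P z → r ≤ z × τ r z ≤ t) → ∑[ z < Z ] 𝟙 (P? z) ≤ t
    count-right h = ≤-trans (∑-count-≤ Z P? r (r + t) inside) (≤-reflexive (m+n∸m≡n r t))
      where
      inside : ∀ z → P z → r ≤ z × z < r + t
      inside z p with h z p
      ... | r≤z , τ≤t = r≤z , ≤-trans (m≤n+m∸n (suc z) r) (+-monoʳ-≤ r (≤-trans (≤-reflexive (sym (τ-right r≤z))) τ≤t))

  count-path : ∀ Z m t {P : ℕ → Set} (P? : ∀ z → Dec (P z)) → (∀ z → P z → Path m z × τ (r m) z ≤ t) →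
               ∑[ z < Z ] 𝟙 (P? z) ≤ t
  count-path Z (move l r q true)  t P? h = count-right Z r t P? (λ z p → proj₁ (proj₁ (h z p)) , proj₂ (h z p))
  count-path Z (move l r q false) t P? h = count-left Z r t P? (λ z p → proj₂ (proj₁ (h z p)) , proj₂ (h z p))

  count-other : ∀ Z m t {P : ℕ → Set} (P? : ∀ z → Dec (P z)) → (∀ z → P z → Other m z × τ (r m) z ≤ t) →
                ∑[ z < Z ] 𝟙 (P? z) ≤ t
  count-other Z (move l r q true)  t P? h = count-left Z r t P? (λ z p → proj₂ (proj₁ (h z p)) , proj₂ (h z p))
  count-other Z (move l r q false) t P? h = count-right Z r t P? (λ z p → proj₁ (proj₁ (h z p)) , proj₂ (h z p))

  count-path-≥ : ∀ Z {m} c {P : ℕ → Set} (P? : ∀ z → Dec (P z)) → Wf m → q m ≤ Z → c ≤ len m →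
                 (∀ z → Path m z → τ (r m) z ≤ c → P z) → c ≤ ∑[ z < Z ] 𝟙 (P? z)
  count-path-≥ Z {move l r q true} c P? w q≤Z c≤len h =
    ≤-trans (≤-reflexive (sym (m+n∸m≡n r c)))
            (∑-count-≥ Z P? r (r + c) (≤-trans r+c≤q q≤Z)
              (λ z r≤z z<r+c → h z (r≤z , ≤-trans z<r+c r+c≤q)
                 (≤-trans (≤-reflexive (τ-right r≤z)) (≤-trans (∸-monoˡ-≤ r z<r+c) (≤-reflexive (m+n∸m≡n r c))))))
    where
    r+c≤q : r + c ≤ q
    r+c≤q = ≤-trans (+-monoʳ-≤ r c≤len) (≤-reflexive (m+[n∸m]≡n (<⇒≤ (r<q w))))
  count-path-≥ Z {move l r q false} c P? w q≤Z c≤len h =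
    ≤-trans (≤-reflexive (sym (m∸[m∸n]≡n c≤r)))
            (∑-count-≥ Z P? (r ∸ c) r (≤-trans (<⇒≤ (r<q w)) q≤Z)
              (λ z r∸c≤z z<r → h z (≤-trans l≤r∸c r∸c≤z , z<r)
                 (≤-trans (≤-reflexive (τ-left z<r)) (≤-trans (∸-monoʳ-≤ r r∸c≤z) (≤-reflexive (m∸[m∸n]≡n c≤r))))))
    where
    c≤r : c ≤ r
    c≤r = ≤-trans c≤len (m∸n≤m r l)
    l≤r∸c : l ≤ r ∸ c
    l≤r∸c = ≤-trans (≤-reflexive (sym (m∸[m∸n]≡n (<⇒≤ (l<r w))))) (∸-monoʳ-≤ r c≤len)

  module Window (Z : ℕ) (E : ℕ → ℤ) where

    Ω : ℕ
    Ω = ∑[ z < Z ] ℤ.∣ E z ∣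

    -- The radius 4 ρ exceeds the length of both sides together for a move with len ≤ olen < 2 ρ, so
    -- the window around a cell of its path contains everything that the move can see.
    inWindow : ℕ → ℕ → ℕ → ℕ
    inWindow ρ w z = 𝟙 (∣ w - z ∣ <? 4 * ρ)

    mass : ℕ → ℕ → ℕ
    mass ρ w = ∑[ z < Z ] (inWindow ρ w z * ℤ.∣ E z ∣)

    mass-term : ∀ {ρ w z} → ∣ w - z ∣ < 4 * ρ → inWindow ρ w z * ℤ.∣ E z ∣ ≡ ℤ.∣ E z ∣
    mass-term {ρ} {w} {z} p = trans (cong (_* ℤ.∣ E z ∣) (𝟙-yes (∣ w - z ∣ <? 4 * ρ) p)) (*-identityˡ _)

    ∑-mass : ∀ ρ → ∑[ w < Z ] mass ρ w ≤ 8 * ρ * Ω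
    ∑-mass ρ = begin
      ∑[ w < Z ] ∑[ z < Z ] (inWindow ρ w z * ℤ.∣ E z ∣) ≡⟨ ∑-swap Z Z (λ w z → inWindow ρ w z * ℤ.∣ E z ∣) ⟩
      ∑[ z < Z ] ∑[ w < Z ] (inWindow ρ w z * ℤ.∣ E z ∣) ≤⟨ ∑-mono Z (λ z _ → column z) ⟩
      ∑[ z < Z ] (8 * ρ * ℤ.∣ E z ∣)                     ≡⟨ ∑-* Z (8 * ρ) (λ z → ℤ.∣ E z ∣) ⟩
      8 * ρ * Ω                                          ∎
      where
      open ≤-Reasoning
      column : ∀ z → ∑[ w < Z ] (inWindow ρ w z * ℤ.∣ E z ∣) ≤ 8 * ρ * ℤ.∣ E z ∣
      column z = begin
        ∑[ w < Z ] (inWindow ρ w z * e)  ≡⟨ ∑-cong Z (λ w _ → *-comm (inWindow ρ w z) e) ⟩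
        ∑[ w < Z ] (e * inWindow ρ w z)  ≡⟨ ∑-* Z e (λ w → inWindow ρ w z) ⟩
        e * ∑[ w < Z ] inWindow ρ w z    ≤⟨ *-monoʳ-≤ e (∑-count-≤ Z (λ w → ∣ w - z ∣ <? 4 * ρ) (z ∸ 4 * ρ) (z + 4 * ρ)
                                              (λ w p → m≤n+o⇒m∸n≤o z (4 * ρ) (<⇒≤ (subst (z <_) (+-comm w (4 * ρ)) (∣-∣-<⁻ (subst (_< 4 * ρ) (∣-∣-comm w z) p)))) , ∣-∣-<⁻ p)) ⟩
        e * (z + 4 * ρ ∸ (z ∸ 4 * ρ))    ≤⟨ *-monoʳ-≤ e (m≤n+o⇒m∸n≤o (z + 4 * ρ) (z ∸ 4 * ρ)
                                              (linear 3 (λ z t ρ → 1 · z :≤ 4 :* ρ :+ t ∷ [] ⊢ z :+ 4 :* ρ :≤ t :+ 8 :* ρ) z (z ∸ 4 * ρ) ρ (m≤n+m∸n z (4 * ρ)))) ⟩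
        e * (8 * ρ)                      ≡⟨ *-comm e (8 * ρ) ⟩
        8 * ρ * e                        ∎
        where e = ℤ.∣ E z ∣

    private
      Hist = History Z E

    -- The field `start` puts w within about ρ / 128 of the request. As τ measures to the far end of
    -- the cell, the summand 128 is one cell of slack: the first cell of the path qualifies even for
    -- small ρ.
    record Comparable (s : Bool) (w ρ : ℕ) (D : ℕ → ℤ) (m : Move) : Set where
      constructor comparable
      field
        direction : dir m ≡ s
        crosses   : Path m w
        start     : 128 * τ (r m) w < ρ + 128
        long      : ρ < 16 * len m
        shorter   : len m ≤ olen m
        olen<     : olen m < 2 * ρ
        worsens   : len m < 4 * worse Z D m
        blocks    : olen m ≤ 4 * blocked Z D m

    comparable? : ∀ s w ρ D m → Dec (Comparable s w ρ D m)
    comparable? s w ρ D m with (dir m Boolₚ.≟ s) ×-dec (path? m w) ×-dec (128 * τ (r m) w <? ρ + 128) ×-dec (ρ <? 16 * len m)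
                               ×-dec (len m ≤? olen m) ×-dec (olen m <? 2 * ρ) ×-dec (len m <? 4 * worse Z D m) ×-dec (olen m ≤? 4 * blocked Z D m)
    ... | yes (a , b , c , d , e , f , g , h) = yes (comparable a b c d e f g h)
    ... | no ¬p = no λ { (comparable a b c d e f g h) → ¬p (a , b , c , d , e , f , g , h) }

    module _ (s : Bool) (w ρ : ℕ) where

      private
        N : (ℕ → ℤ) → List Move → ℕ
        N = total (λ D m → 𝟙 (comparable? s w ρ D m))

      Far : (ℕ → ℤ) → Move → ℕ → Set
      Far D m z = Blocked D m z × ρ ≤ 128 * τ (r m) z

      far? : ∀ D m z → Dec (Far D m z)
      far? D m z = blocked? D m z ×-dec (ρ ≤? 128 * τ (r m) z)

      Beyond : (ℕ → ℤ) → Move → ℕ → Set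
      Beyond D m z = Worse D m z × τ (r m) w ≤ τ (r m) z

      beyond? : ∀ D m z → Dec (Beyond D m z)
      beyond? D m z = worse? D m z ×-dec (τ (r m) w ≤? τ (r m) z)

      -- Every comparable move at w has its request on the near side of w and at distance less than
      -- ρ / 128 from it. A far cell lies at least that much behind the request of m, which is
      -- itself not beyond w, and z′ is not before w. So the request of m′ is caught between them.
      separates : ∀ {D m D′ m′ z z′} → Comparable s w ρ D m → Far D m z → Beyond D m z′ → Comparable s w ρ D′ m′ → Wf m →
                  1 ≤ Oneside s z z′ (m′ ∷ [])
      separates {m = move l r q true} {m′ = move l′ r′ q′ true} {z} {z′}
                (comparable refl (r≤w , _) _ _ _ _ _ _) (((_ , z<r) , _) , far) (((r≤z′ , _) , _) , τ≤τ)
                (comparable refl (r′≤w , _) start _ _ _ _ _) wf₀ =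
        ≤-trans (≤-reflexive (sym (𝟙-yes (between? z z′ r′) (z<r′ , ≤-trans r′≤w w≤z′)))) (m≤m+n _ _)
        where
        w≤z′ : w ≤ z′
        w≤z′ = linear 5 (λ w z r a b → 1 · # 1 :+ w :≤ r :+ a ∷ 1 · a :≤ b ∷ 1 · r :+ b :≤ # 1 :+ z ∷ [] ⊢ w :≤ z)
          w z′ r (τ r w) (τ r z′)
          (≤-trans (m≤n+m∸n (suc w) r) (+-monoʳ-≤ r (≤-reflexive (sym (τ-right r≤w)))))
          τ≤τ
          (≤-reflexive (trans (cong (r +_) (τ-right r≤z′)) (m+[n∸m]≡n (m≤n⇒m≤1+n r≤z′))))
        z<r′ : z < r′
        z<r′ = *-cancelˡ-< 128 _ _ (linear 7 (λ z r r′ w ρ a b → 128 · r :≤ w ∷ 128 · # 1 :+ w :≤ r′ :+ a ∷ 1 · 128 :* a :< ρ :+ # 128 ∷ 1 · ρ :≤ 128 :* b ∷ 128 · z :+ b :≤ r ∷ []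
                             ⊢ 128 :* z :< 128 :* r′) z r r′ w ρ (τ r′ w) (τ r z)
          r≤w
          (≤-trans (m≤n+m∸n (suc w) r′) (+-monoʳ-≤ r′ (≤-reflexive (sym (τ-right r′≤w)))))
          start far
          (≤-reflexive (trans (cong (z +_) (τ-left z<r)) (m+[n∸m]≡n (<⇒≤ z<r)))))
      separates {m = move l r q false} {m′ = move l′ r′ q′ false} {z} {z′}
                (comparable refl (_ , w<r) _ _ _ _ _ _) (((r≤z , _) , _) , far) (((_ , z′<r) , _) , τ≤τ)
                (comparable refl (_ , w<r′) start _ _ _ _ _) wf₀ =
        ≤-trans (≤-reflexive (sym (𝟙-yes (between? z′ z r′) (≤-<-trans z′≤w w<r′ , r′≤z)))) (m≤m+n _ _)
        where
        z′≤w : z′ ≤ w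
        z′≤w = linear 5 (λ w z r a b → 1 · r :≤ w :+ a ∷ 1 · a :≤ b ∷ 1 · z :+ b :≤ r ∷ [] ⊢ z :≤ w)
          w z′ r (τ r w) (τ r z′)
          (≤-trans (m≤n+m∸n r w) (+-monoʳ-≤ w (≤-reflexive (sym (τ-left w<r)))))
          τ≤τ
          (≤-reflexive (trans (cong (z′ +_) (τ-left z′<r)) (m+[n∸m]≡n (<⇒≤ z′<r))))
        r′≤z : r′ ≤ z
        r′≤z = s≤s⁻¹ (*-cancelˡ-< 128 _ _ (linear 7 (λ z r r′ w ρ a b → 128 · # 1 :+ w :≤ r ∷ 128 · r′ :≤ w :+ a ∷ 1 · 128 :* a :< ρ :+ # 128 ∷ 1 · ρ :≤ 128 :* b ∷ 128 · r :+ b :≤ # 1 :+ z ∷ []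
                             ⊢ 128 :* r′ :< 128 :* (# 1 :+ z)) z r r′ w ρ (τ r′ w) (τ r z)
          w<r
          (≤-trans (m≤n+m∸n r′ w) (+-monoʳ-≤ w (≤-reflexive (sym (τ-left w<r′)))))
          start far
          (≤-reflexive (trans (cong (r +_) (τ-right r≤z)) (m+[n∸m]≡n (m≤n⇒m≤1+n r≤z))))))

      Oneside-∷ : ∀ s {z z′} m ms → Oneside s z z′ (m ∷ ms) ≡ Oneside s z z′ (m ∷ []) + Oneside s z z′ ms
      Oneside-∷ true  {z} {z′} m ms = cong (_+ requestsBetween ms z z′) (sym (+-identityʳ (𝟙 (between? z z′ (r m)))))
      Oneside-∷ false {z} {z′} m ms = cong (_+ requestsBetween ms z′ z) (sym (+-identityʳ (𝟙 (between? z′ z (r m)))))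

      N≤Oneside : ∀ {D m z z′} → Comparable s w ρ D m → Far D m z → Beyond D m z′ → Wf m →
                  ∀ {D′ ms} → N D′ ms ≤ Oneside s z z′ ms
      N≤Oneside c f b wf₀ {ms = []} = z≤n
      N≤Oneside {z = z} {z′} c f b wf₀ {D′} {m′ ∷ ms} =
        ≤-trans (+-mono-≤ head (N≤Oneside c f b wf₀ {ms = ms})) (≤-reflexive (sym (Oneside-∷ s m′ ms)))
        where
        head : 𝟙 (comparable? s w ρ D′ m′) ≤ Oneside s z z′ (m′ ∷ [])
        head with comparable? s w ρ D′ m′
        ... | yes c′ = separates c f b c′ wf₀
        ... | no _   = z≤n

      -- From len > ρ / 16 and the two inequalities for olen, more than ρ / 64 cells are blocked.
      -- Fewer than half as many cells can lie within ρ / 128 of the request.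
      far-many : ∀ {D m} → Comparable s w ρ D m → ρ ≤ 128 * ∑[ z < Z ] 𝟙 (far? D m z)
      far-many {D} {m} (comparable _ _ _ long shorter _ _ blocks) =
        *-cancelˡ-≤ 4 (linear 7 (λ ρ len olen blk far near t → 8 · ρ :< 16 :* len ∷ 128 · len :≤ olen ∷ 128 · olen :≤ 4 :* blk ∷ 512 · blk :≤ far :+ near ∷ 512 · near :≤ t ∷ 4 · 128 :* t :≤ ρ ∷ [] ⊢ 4 :* ρ :≤ 4 :* (128 :* far))
          ρ (len m) (olen m) (blocked Z D m) (∑[ z < Z ] 𝟙 (far? D m z)) (∑[ z < Z ] 𝟙 (close? z)) (ρ / 128)
          long shorter blocks
          (≤-trans (≤-reflexive (∑-cong Z (λ z _ → 𝟙-split (blocked? D m z) (ρ ≤? 128 * τ (r m) z)))) (≤-reflexive (∑-+ Z (λ z → 𝟙 (far? D m z)) (λ z → 𝟙 (close? z)))))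
          (count-other Z m (ρ / 128) close? (λ z p → proj₁ (proj₁ p) , close-τ z (≰⇒> (proj₂ p))))
          (≤-trans (≤-reflexive (*-comm 128 (ρ / 128))) (m/n*n≤m ρ 128)))
        where
        close? : ∀ z → Dec (Blocked D m z × ¬ (ρ ≤ 128 * τ (r m) z))
        close? z = blocked? D m z ×-dec ¬? (ρ ≤? 128 * τ (r m) z)
        close-τ : ∀ z → 128 * τ (r m) z < ρ → τ (r m) z ≤ ρ / 128
        close-τ z p = subst (_≤ ρ / 128) (m*n/n≡m (τ (r m) z) 128) (/-monoˡ-≤ 128 (≤-trans (≤-reflexive (*-comm (τ (r m) z) 128)) (<⇒≤ p)))

      -- More than a quarter of len, hence more than ρ / 64 cells, get worse, and at most τ - 1 < ρ
      -- / 128 of them precede w.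
      beyond-many : ∀ {D m} → Comparable s w ρ D m → ρ ≤ 128 * ∑[ z < Z ] 𝟙 (beyond? D m z)
      beyond-many {D} {m} (comparable _ crosses start long _ _ worsens _) =
        linear 7 (λ ρ len wrs beyond rest t T → 2 · ρ :< 16 :* len ∷ 32 · len :< 4 :* wrs ∷ 128 · wrs :≤ beyond :+ rest ∷ 128 · rest :≤ t ∷
                    128 · # 1 :+ t :≤ T ∷ 1 · 128 :* T :< ρ :+ # 128 ∷ [] ⊢ ρ :≤ 128 :* beyond)
          ρ (len m) (worse Z D m) (∑[ z < Z ] 𝟙 (beyond? D m z)) (∑[ z < Z ] 𝟙 (before? z)) (pred (τ (r m) w)) (τ (r m) w)
          long worsens
          (≤-trans (≤-reflexive (∑-cong Z (λ z _ → 𝟙-split (worse? D m z) (τ (r m) w ≤? τ (r m) z)))) (≤-reflexive (∑-+ Z (λ z → 𝟙 (beyond? D m z)) (λ z → 𝟙 (before? z)))))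
          (count-path Z m (pred (τ (r m) w)) before? (λ z p → proj₁ (proj₁ p) , <⇒≤pred (≰⇒> (proj₂ p))))
          (≤-reflexive (suc-pred (τ (r m) w) {{>-nonZero (τ>0 (r m) w)}})) start
        where
        before? : ∀ z → Dec (Worse D m z × ¬ (τ (r m) w ≤ τ (r m) z))
        before? z = worse? D m z ×-dec ¬? (τ (r m) w ≤? τ (r m) z)
        τ>0 : ∀ r z → 0 < τ r z
        τ>0 r z with r ≤? z
        ... | yes r≤z = subst (0 <_) (sym (τ-right r≤z)) (m<n⇒0<n∸m (s≤s r≤z))
        ... | no  r≰z = subst (0 <_) (sym (τ-left (≰⇒> r≰z))) (m<n⇒0<n∸m (≰⇒> r≰z))

      in-window-other : ∀ {D m z} → Wf m → Comparable s w ρ D m → Other m z → ∣ w - z ∣ < 4 * ρ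
      in-window-other {m = m} {z} wf₀ (comparable _ p _ _ shorter olen< _ _) o =
        linear 4 (λ d a b ρ → 1 · d :< a :+ b ∷ 1 · a :≤ b ∷ 2 · b :< 2 :* ρ ∷ [] ⊢ d :< 4 :* ρ) ∣ w - z ∣ (len m) (olen m) ρ
          (other-path-distance wf₀ o p) shorter olen<

      in-window-path : ∀ {D m z} → Wf m → Comparable s w ρ D m → Path m z → ∣ w - z ∣ < 4 * ρ
      in-window-path {m = m} {z} wf₀ (comparable _ (lo≤w , w<hi) _ _ shorter olen< _ _) (lo≤z , z<hi) = ∣-∣-< (bound w z lo≤z w<hi) (bound z w lo≤w z<hi)
        where
        bound : ∀ a b → lo m ≤ b → a < hi m → a < b + 4 * ρ
        bound a b lo≤b a<hi = linear 7 (λ a b l h n o ρ → 1 · l :≤ b ∷ 1 · a :< h ∷ 1 · h :≤ n :+ l ∷ 1 · n :≤ o ∷ 1 · o :< 2 :* ρ ∷ [] ⊢ a :< b :+ 4 :* ρ)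
          a b (lo m) (hi m) (len m) (olen m) ρ lo≤b a<hi (≤-reflexive (sym (len+lo wf₀))) shorter olen<

      private
        half : ∀ M {R : ℕ → Set} (R? : ∀ z → Dec (R z)) → (∀ z → R z → ∣ w - z ∣ < 4 * ρ) →
               ρ ≤ 128 * ∑[ z < Z ] 𝟙 (R? z) → (∀ z → z < Z → R z → M ≤ 2 * ℤ.∣ E z ∣) → M * ρ ≤ 256 * mass ρ w
        half M R? R-in R-many h = begin
          M * ρ                                      ≤⟨ *-monoʳ-≤ M R-many ⟩
          M * (128 * ∑[ z < Z ] 𝟙 (R? z))            ≡⟨ *-comm-left M 128 _ ⟩
          128 * (M * ∑[ z < Z ] 𝟙 (R? z))            ≤⟨ *-monoʳ-≤ 128 (∑-markov Z R? (λ z → 2 * (inWindow ρ w z * ℤ.∣ E z ∣)) M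
                                                          (λ z z<Z p → ≤-trans (h z z<Z p) (≤-reflexive (cong (2 *_) (sym (mass-term {ρ} {w} (R-in z p))))))) ⟩
          128 * ∑[ z < Z ] (2 * (inWindow ρ w z * ℤ.∣ E z ∣)) ≡⟨ cong (128 *_) (∑-* Z 2 (λ z → inWindow ρ w z * ℤ.∣ E z ∣)) ⟩
          128 * (2 * mass ρ w)                       ≡⟨ sym (*-assoc 128 2 (mass ρ w)) ⟩
          256 * mass ρ w                             ∎
          where
          open ≤-Reasoning
          *-comm-left : ∀ a b c → a * (b * c) ≡ b * (a * c)
          *-comm-left a b c = trans (sym (*-assoc a b c)) (trans (cong (_* c) (*-comm a b)) (*-assoc b a c))

        -- If some cell z₀ of the first kind has 2 ∣ E z₀ ∣ < M, then pairing it with each cell of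
        -- the second kind gives M ≤ 2 ∣ E ∣ on all of those. Otherwise this holds on all cells of
        -- the first kind. Either way there are at least ρ / 128 such cells in the window.
        two-masses : ∀ M {P Q : ℕ → Set} (P? : ∀ z → Dec (P z)) (Q? : ∀ z → Dec (Q z)) →
                     (∀ z → P z → ∣ w - z ∣ < 4 * ρ) → (∀ z → Q z → ∣ w - z ∣ < 4 * ρ) →
                     (∀ z z′ → P z → Q z′ → M ≤ ℤ.∣ E z ∣ + ℤ.∣ E z′ ∣) →
                     ρ ≤ 128 * ∑[ z < Z ] 𝟙 (P? z) → ρ ≤ 128 * ∑[ z < Z ] 𝟙 (Q? z) → M * ρ ≤ 256 * mass ρ w
        two-masses M {P} {Q} P? Q? P-in Q-in sum P-many Q-many
          with anyUpTo? (λ z → P? z ×-dec ¬? (M ≤? 2 * ℤ.∣ E z ∣)) Z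
        ... | no none = half M P? P-in P-many (λ z z<Z p → decidable-stable (M ≤? _) (λ M≰ → none (z , z<Z , p , M≰)))
        ... | yes (z₀ , z₀<Z , p₀ , M≰) = half M Q? Q-in Q-many (λ z z<Z q →
                linear 3 (λ M e f → 2 · M :≤ e :+ f ∷ 1 · 2 :* e :< M ∷ [] ⊢ M :≤ 2 :* f) M ℤ.∣ E z₀ ∣ ℤ.∣ E z ∣ (sum z₀ z p₀ q) (≰⇒> M≰))

      -- The first comparable move fixes the far and the beyond cells. Its own request and those of
      -- all later comparable moves at w lie between any two of them, so `blocked-worse`, applied at
      -- this single moment, bounds the whole count.
      comparable-count : ∀ {D ms} → Hist D ms → N D ms * ρ ≤ 256 * mass ρ w
      comparable-count [] = z≤n
      comparable-count {D} {m ∷ ms} H@(cons wf₀ q≤Z rule mono as H′) = by-head (comparable? s w ρ D m)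
        where
        later : ℕ
        later = N (shift m D) ms

        pair : Comparable s w ρ D m → ∀ z z′ → Far D m z → Beyond D m z′ → suc later ≤ ℤ.∣ E z ∣ + ℤ.∣ E z′ ∣
        pair c z z′ f b = begin
          suc later                                                 ≤⟨ +-mono-≤ (separates c f b c wf₀) (N≤Oneside c f b wf₀ {ms = ms}) ⟩
          Oneside s z z′ (m ∷ []) + Oneside s z z′ ms               ≡⟨ sym (Oneside-∷ s m ms) ⟩
          Oneside s z z′ (m ∷ ms)                                   ≡⟨ cong (λ d → Oneside d z z′ (m ∷ ms)) (sym (Comparable.direction c)) ⟩
          Oneside (dir m) z z′ (m ∷ ms)                             ≤⟨ m≤m+n _ ℤ.∣ D z′ ∣ ⟩
          Oneside (dir m) z z′ (m ∷ ms) + ℤ.∣ D z′ ∣                ≤⟨ blocked-worse Z E {D} {m} {ms} {z} {z′} H (proj₁ f) (proj₁ b) ⟩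
          ℤ.∣ E z ∣ + ℤ.∣ E z′ ∣                                    ∎
          where open ≤-Reasoning

        by-head : ∀ (d : Dec (Comparable s w ρ D m)) → (𝟙 d + later) * ρ ≤ 256 * mass ρ w
        by-head (no _)  = comparable-count H′
        by-head (yes c) = two-masses (suc later) (far? D m) (beyond? D m)
          (λ z f → in-window-other {D} {m} {z} wf₀ c (proj₁ (proj₁ f))) (λ z b → in-window-path {D} {m} {z} wf₀ c (proj₁ (proj₁ b)))
          (pair c) (far-many {D} {m} c) (beyond-many {D} {m} c)

  -- Scales

  geometric-below : ∀ a n L → ∑[ j < n ] (𝟙 (2 ^ (a + j) ≤? L) * 2 ^ (a + j)) ≤ 2 ^ (a + n)
  geometric-below a zero    L = z≤n
  geometric-below a (suc n) L = begin
    𝟙 (2 ^ (a + n) ≤? L) * 2 ^ (a + n) + _   ≤⟨ +-mono-≤ (*-monoˡ-≤ (2 ^ (a + n)) (𝟙-mono (2 ^ (a + n) ≤? L) (0 ≤? 0) (λ _ → z≤n))) (geometric-below a n L) ⟩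
    1 * 2 ^ (a + n) + 2 ^ (a + n)            ≡⟨ +-comm (1 * 2 ^ (a + n)) _ ⟩
    2 * 2 ^ (a + n)                          ≡⟨ cong (2 ^_) (sym (+-suc a n)) ⟩
    2 ^ (a + suc n)                          ∎
    where open ≤-Reasoning

  geometric : ∀ a n L → ∑[ j < n ] (𝟙 (2 ^ (a + j) ≤? L) * 2 ^ (a + j)) ≤ 2 * L
  geometric a zero    L = z≤n
  geometric a (suc n) L with 2 ^ (a + n) ≤? L
  ... | no _  = geometric a n L
  ... | yes p = linear 3 (λ t s L → 1 · s :≤ t ∷ 2 · t :≤ L ∷ [] ⊢ 1 :* t :+ s :≤ 2 :* L) (2 ^ (a + n)) _ L (geometric-below a n L) p

  bracket : ∀ a n x → 2 ^ a ≤ x → x < 2 ^ (a + n) → ∃ λ j → j < n × 2 ^ (a + j) ≤ x × x < 2 * 2 ^ (a + j)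
  bracket a zero    x lo hi = contradiction lo (<⇒≱ (subst (λ t → x < 2 ^ t) (+-identityʳ a) hi))
  bracket a (suc n) x lo hi with 2 ^ (a + n) ≤? x
  ... | yes p = n , ≤-refl , p , subst (λ t → x < 2 ^ t) (+-suc a n) hi
  ... | no ¬p with bracket a n x lo (≰⇒> ¬p)
  ...   | j , j<n , h = j , m<n⇒m<1+n j<n , h

  n<2^n : ∀ n → n < 2 ^ n
  n<2^n zero    = s≤s z≤n
  n<2^n (suc n) = linear 2 (λ n p → 2 · n :< p ∷ [] ⊢ # 1 :+ n :< 2 :* p) n (2 ^ n) (n<2^n n)

  -- The exponent is minimal, so its predecessor fails and 2 ^ t is at most twice 64 x.
  top-scale : ∀ x → ∃ λ t → 64 * x < 2 ^ t × (t ≡ 0 ⊎ 2 ^ t ≤ 128 * x)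
  top-scale x = least (64 * x) (n<2^n (64 * x))
    where
    least : ∀ t → 64 * x < 2 ^ t → ∃ λ t → 64 * x < 2 ^ t × (t ≡ 0 ⊎ 2 ^ t ≤ 128 * x)
    least zero    h = 0 , h , inj₁ refl
    least (suc t) h with 64 * x <? 2 ^ t
    ... | yes p = least t p
    ... | no ¬p = suc t , h , inj₂ (linear 2 (λ p x → 2 · p :≤ 64 :* x ∷ [] ⊢ 2 :* p :≤ 128 :* x) (2 ^ t) x (≮⇒≥ ¬p))

  -- abstract because the conversion checker unfolds multiples by literals in unary
  abstract

    logBound : ℕ → ℕ → ℕ
    logBound Ω KΩ = 8 * (3 * Ω + (66 * KΩ + 256 * (4096 * KΩ)))

    -- The close crossings Th + Cs enter 4 M with factor 4, hence take at most Y / 2; moving this to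
    -- the left doubles the factor 4 to 8.
    logBound-sound : ∀ Y M β h s c Th Cs Ω KΩ → Y ≤ 4 * M → M ≤ β + (h + (s + 256 * c)) → β ≤ Ω → h ≤ Th + 2 * Ω →
                     s ≤ Cs + 66 * KΩ → c ≤ 4096 * KΩ → 8 * (Th + Cs) ≤ Y → Y ≤ logBound Ω KΩ
    logBound-sound Y M β h s c Th Cs Ω KΩ = with-last (4096 * KΩ)
      where
      with-last : ∀ x → Y ≤ 4 * M → M ≤ β + (h + (s + 256 * c)) → β ≤ Ω → h ≤ Th + 2 * Ω →
                  s ≤ Cs + 66 * KΩ → c ≤ x → 8 * (Th + Cs) ≤ Y → Y ≤ 8 * (3 * Ω + (66 * KΩ + 256 * x))
      with-last x = linear 11
        (λ Y M β h s c Th Cs Ω KΩ x → 2 · Y :≤ 4 :* M ∷ 8 · M :≤ β :+ (h :+ (s :+ 256 :* c)) ∷ 8 · β :≤ Ω ∷ 8 · h :≤ Th :+ 2 :* Ω ∷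
           8 · s :≤ Cs :+ 66 :* KΩ ∷ 2048 · c :≤ x ∷ 1 · 8 :* (Th :+ Cs) :≤ Y ∷ [] ⊢ Y :≤ 8 :* (3 :* Ω :+ (66 :* KΩ :+ 256 :* x)))
        Y M β h s c Th Cs Ω KΩ x

    logConstant : ℕ
    logConstant = 68 * (8 * (3 + (66 * 8 + 256 * (4096 * 8))))

    logBound-linear : ∀ Ω KΩ y → Ω ≤ y → KΩ ≤ 8 * y → 68 * logBound Ω KΩ ≤ logConstant * y
    logBound-linear Ω KΩ y Ω≤y KΩ≤8y = ≤-trans
      (*-monoʳ-≤ 68 (*-monoʳ-≤ 8 (+-mono-≤ (*-monoʳ-≤ 3 Ω≤y) (+-mono-≤ (*-monoʳ-≤ 66 KΩ≤8y) (*-monoʳ-≤ 256 (*-monoʳ-≤ 4096 KΩ≤8y))))))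
      (≤-reflexive (collect 68 8 3 66 256 4096 8 y))
      where
      collect : ∀ a b c d e f g y → a * (b * (c * y + (d * (g * y) + e * (f * (g * y))))) ≡ a * (b * (c + (d * g + e * (f * g)))) * y
      collect = ℕ-Solver.solve-∀

  module Scales (Z : ℕ) (E : ℕ → ℤ) where

    open Window Z E

    private
      Hist = History Z E

    olen>0 : ∀ {m} → Wf m → 0 < olen m
    olen>0 {move _ _ _ true}  w = m<n⇒0<n∸m (l<r w)
    olen>0 {move _ _ _ false} w = m<n⇒0<n∸m (r<q w)

    CloseCrossing : ℕ → ℕ → Move → Set
    CloseCrossing ρ w m = Path m w × 16 * τ (r m) w ≤ ρ × ρ ≤ len m

    closeCrossing? : ∀ ρ w m → Dec (CloseCrossing ρ w m)
    closeCrossing? ρ w m = path? m w ×-dec ((16 * τ (r m) w ≤? ρ) ×-dec (ρ ≤? len m))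

    closeCrossings : ℕ → (ℕ → ℤ) → Move → ℕ
    closeCrossings ρ D m = ∑[ w < Z ] 𝟙 (closeCrossing? ρ w m)

    -- At most ρ / 16 cells of the path lie that close to the request, and none counts if the walk
    -- is shorter than ρ.
    closeCrossings-bound : ∀ ρ D m → 16 * closeCrossings ρ D m ≤ 𝟙 (ρ ≤? len m) * ρ
    closeCrossings-bound ρ D m = bound (ρ ≤? len m)
      where
      open ≤-Reasoning
      near-end : ∀ w → 16 * τ (r m) w ≤ ρ → τ (r m) w ≤ ρ / 16
      near-end w p = subst (_≤ ρ / 16) (m*n/n≡m (τ (r m) w) 16) (/-monoˡ-≤ 16 (≤-trans (≤-reflexive (*-comm (τ (r m) w) 16)) p))

      bound : ∀ (d : Dec (ρ ≤ len m)) → 16 * closeCrossings ρ D m ≤ 𝟙 d * ρ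
      bound (yes _) = begin
        16 * closeCrossings ρ D m   ≤⟨ *-monoʳ-≤ 16 (count-path Z m (ρ / 16) (λ w → closeCrossing? ρ w m) (λ w p → proj₁ p , near-end w (proj₁ (proj₂ p)))) ⟩
        16 * (ρ / 16)               ≡⟨ *-comm 16 (ρ / 16) ⟩
        ρ / 16 * 16                 ≤⟨ m/n*n≤m ρ 16 ⟩
        ρ                           ≡⟨ sym (*-identityˡ ρ) ⟩
        1 * ρ                       ∎
      bound (no ρ≰) = ≤-trans (*-monoʳ-≤ 16 (count-path Z m 0 (λ w → closeCrossing? ρ w m) (λ w p → contradiction (proj₂ (proj₂ p)) ρ≰)))
                              (≤-reflexive (*-zeroʳ 16))

    opposite-close : ∀ w ρ m → 𝟙 (opposite? Z E true w ρ m) + 𝟙 (opposite? Z E false w ρ m) ≤ 𝟙 (closeCrossing? ρ w m)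
    opposite-close w ρ m@(move _ _ _ true) = 𝟙-mono (opposite? Z E false w ρ m) (closeCrossing? ρ w m) proj₂
    opposite-close w ρ m@(move _ _ _ false) = ≤-trans
      (≤-reflexive (trans (cong (𝟙 (opposite? Z E true w ρ m) +_) (𝟙-no (opposite? Z E false w ρ m) (λ { (() , _) }))) (+-identityʳ _)))
      (𝟙-mono (opposite? Z E true w ρ m) (closeCrossing? ρ w m) proj₂)

    module _ (ρ : ℕ) (K : ℕ → ℕ) {Ev : Bool → ℕ → (ℕ → ℤ) → Move → Set} (ev? : ∀ s w D m → Dec (Ev s w D m))
             (ev⇒crossing : ∀ {s w D m} → Ev s w D m → Crossing Z E s w ρ D m)
             (shallow : ∀ {s w D m ms} → Hist D (m ∷ ms) → Ev s w D m → suc ℤ.∣ D w ∣ ≤ K w) where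

      events : (ℕ → ℤ) → Move → ℕ
      events D m = ∑[ w < Z ] (𝟙 (ev? true w D m) + 𝟙 (ev? false w D m))

      events-total : ∀ {D ms} → Hist D ms → total events D ms ≤ total (closeCrossings ρ) D ms + 2 * ∑ Z K
      events-total {D} {ms} H = begin
        total events D ms                                            ≡⟨ total-∑ Z (λ w D m → 𝟙 (ev? true w D m) + 𝟙 (ev? false w D m)) D ms ⟩
        ∑[ w < Z ] total (λ D m → 𝟙 (ev? true w D m) + 𝟙 (ev? false w D m)) D ms ≤⟨ ∑-mono Z (λ w _ → cell w) ⟩
        ∑[ w < Z ] (total (λ D m → 𝟙 (closeCrossing? ρ w m)) D ms + 2 * K w) ≡⟨ ∑-+ Z _ _ ⟩
        ∑[ w < Z ] total (λ D m → 𝟙 (closeCrossing? ρ w m)) D ms + ∑[ w < Z ] (2 * K w) ≡⟨ cong₂ _+_ (sym (total-∑ Z (λ w D m → 𝟙 (closeCrossing? ρ w m)) D ms)) (∑-* Z 2 K) ⟩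
        total (closeCrossings ρ) D ms + 2 * ∑ Z K                   ∎
        where
        open ≤-Reasoning
        N U : Bool → ℕ → ℕ
        N s w = total (λ D m → 𝟙 (ev? s w D m)) D ms
        U s w = total (λ D m → 𝟙 (opposite? Z E s w ρ m)) D ms
        cell : ∀ w → total (λ D m → 𝟙 (ev? true w D m) + 𝟙 (ev? false w D m)) D ms
                   ≤ total (λ D m → 𝟙 (closeCrossing? ρ w m)) D ms + 2 * K w
        cell w = linear 7 (λ t nt nf ut uf c k → 1 · t :≤ nt :+ nf ∷ 1 · nt :≤ ut :+ k ∷ 1 · nf :≤ uf :+ k ∷ 1 · ut :+ uf :≤ c ∷ [] ⊢ t :≤ c :+ 2 :* k)
          _ (N true w) (N false w) (U true w) (U false w) _ (K w)
          (≤-reflexive (total-+ (λ D m → 𝟙 (ev? true w D m)) (λ D m → 𝟙 (ev? false w D m)) D ms))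
          (crossing-count Z E true w ρ (K w) (ev? true w) ev⇒crossing shallow H)
          (crossing-count Z E false w ρ (K w) (ev? false w) ev⇒crossing shallow H)
          (≤-trans (≤-reflexive (sym (total-+ (λ D m → 𝟙 (opposite? Z E true w ρ m)) (λ D m → 𝟙 (opposite? Z E false w ρ m)) D ms)))
                   (total-mono Z E (λ {_} {m} _ → opposite-close w ρ m) H))

    -- Unlike `Short` there is no upper bound for olen: a single class takes all sides longer than
    -- 64 Ω.
    record Huge (ρ : ℕ) (s : Bool) (w : ℕ) (D : ℕ → ℤ) (m : Move) : Set where
      constructor huge
      field
        crosses : Crossing Z E s w ρ D m
        blocks  : olen m ≤ 4 * blocked Z D m

    record Short (ρ : ℕ) (s : Bool) (w : ℕ) (D : ℕ → ℤ) (m : Move) : Set where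
      constructor short
      field
        crosses : Crossing Z E s w ρ D m
        blocks  : olen m ≤ 4 * blocked Z D m
        olen<   : olen m < 2 * ρ

    crossing? : ∀ s w ρ D m → Dec (Crossing Z E s w ρ D m)
    crossing? s w ρ D m with (dir m Boolₚ.≟ s) ×-dec worse? D m w ×-dec (16 * len m ≤? ρ) ×-dec (ρ ≤? olen m)
    ... | yes (a , b , c , d) = yes (crossing a b c d)
    ... | no ¬p = no λ { (crossing a b c d) → ¬p (a , b , c , d) }

    huge? : ∀ ρ s w D m → Dec (Huge ρ s w D m)
    huge? ρ s w D m with crossing? s w ρ D m ×-dec (olen m ≤? 4 * blocked Z D m)
    ... | yes (a , b) = yes (huge a b)
    ... | no ¬p = no λ { (huge a b) → ¬p (a , b) }

    short? : ∀ ρ s w D m → Dec (Short ρ s w D m)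
    short? ρ s w D m with crossing? s w ρ D m ×-dec (olen m ≤? 4 * blocked Z D m) ×-dec (olen m <? 2 * ρ)
    ... | yes (a , b , c) = yes (short a b c)
    ... | no ¬p = no λ { (short a b c) → ¬p (a , b , c) }

    blocked-worse₁ : ∀ {D m ms z w} → Hist D (m ∷ ms) → Blocked D m z → Worse D m w → suc ℤ.∣ D w ∣ ≤ ℤ.∣ E z ∣ + ℤ.∣ E w ∣
    blocked-worse₁ {D} {m} {ms} {z} {w} H b c =
      ≤-trans (+-monoˡ-≤ ℤ.∣ D w ∣ (Oneside-head Z E m ms (proj₁ b) (proj₁ c))) (blocked-worse Z E H b c)

    -- A huge other side contains a blocked cell on which E vanishes.
    huge-shallow : ∀ {ρ} → 64 * Ω < ρ → ∀ {D m ms w} → Hist D (m ∷ ms) → ρ ≤ olen m → olen m ≤ 4 * blocked Z D m →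
                   Worse D m w → suc ℤ.∣ D w ∣ ≤ ℤ.∣ E w ∣
    huge-shallow {ρ} big {D} {m} {w = w} H long blocks wrs with anyUpTo? (λ z → blocked? D m z ×-dec (ℤ.∣ E z ∣ ≟ 0)) Z
    ... | yes (z , _ , b , Ez≡0) = subst (λ t → suc ℤ.∣ D w ∣ ≤ t + ℤ.∣ E w ∣) Ez≡0 (blocked-worse₁ H b wrs)
    ... | no none = contradiction
      (linear 4 (λ b o ρ Ω → 1 · 64 :* Ω :< ρ ∷ 1 · ρ :≤ o ∷ 1 · o :≤ 4 :* b ∷ 4 · b :≤ Ω ∷ [] ⊢ # 0 :< # 0) (blocked Z D m) (olen m) ρ Ω
        big long blocks
        (≤-trans (≤-reflexive (sym (*-identityˡ _))) (∑-markov Z (blocked? D m) (λ z → ℤ.∣ E z ∣) 1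
          (λ z z<Z b → n≢0⇒n>0 (λ e → none (z , z<Z , b , e))))))
      (<-irrefl refl)

    -- The excess e of the depth over ∣ E w ∣ is at most ∣ E z ∣ at every blocked cell z. There are
    -- at least ρ / 4 of these, all in the window, so e is at most their average, 4 mass / ρ.
    short-shallow : ∀ {ρ} .{{_ : NonZero ρ}} {s w D m ms} → Hist D (m ∷ ms) → Short ρ s w D m →
                    suc ℤ.∣ D w ∣ ≤ ℤ.∣ E w ∣ + 4 * mass ρ w / ρ
    short-shallow {ρ} {s} {w} {D} {m} H@(cons wf₀ _ _ _ _ _) (short (crossing _ wrs short₁ long) blocks olen<) =
      ≤-trans (m≤n+m∸n (suc ℤ.∣ D w ∣) ℤ.∣ E w ∣) (+-monoʳ-≤ ℤ.∣ E w ∣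
        (subst (_≤ 4 * mass ρ w / ρ) (m*n/n≡m e ρ) (/-monoˡ-≤ ρ (begin
          e * ρ                    ≤⟨ *-monoʳ-≤ e (≤-trans long blocks) ⟩
          e * (4 * blocked Z D m) ≡⟨ trans (sym (*-assoc e 4 _)) (trans (cong (_* blocked Z D m) (*-comm e 4)) (*-assoc 4 e _)) ⟩
          4 * (e * blocked Z D m) ≤⟨ *-monoʳ-≤ 4 (∑-markov Z (blocked? D m) (λ z → inWindow ρ w z * ℤ.∣ E z ∣) e term) ⟩
          4 * mass ρ w             ∎))))
      where
      open ≤-Reasoning
      e = suc ℤ.∣ D w ∣ ∸ ℤ.∣ E w ∣
      term : ∀ z → z < Z → Blocked D m z → e ≤ inWindow ρ w z * ℤ.∣ E z ∣
      term z z<Z b = ≤-trans (m≤n+o⇒m∸n≤o _ ℤ.∣ E w ∣ (subst (suc ℤ.∣ D w ∣ ≤_) (+-comm ℤ.∣ E z ∣ _) (blocked-worse₁ H b wrs)))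
        (≤-reflexive (sym (mass-term {ρ} {w} (linear 4 (λ d a b ρ → 1 · d :< a :+ b ∷ 1 · 16 :* a :≤ ρ ∷ 1 · b :< 2 :* ρ ∷ [] ⊢ d :< 4 :* ρ)
           ∣ w - z ∣ (len m) (olen m) ρ (other-path-distance wf₀ (proj₁ b) (proj₁ wrs)) short₁ olen<))))

    hugeEvents shortEvents comparableEvents : ℕ → (ℕ → ℤ) → Move → ℕ
    hugeEvents       ρ D m = ∑[ w < Z ] (𝟙 (huge? ρ true w D m) + 𝟙 (huge? ρ false w D m))
    shortEvents      ρ D m = ∑[ w < Z ] (𝟙 (short? ρ true w D m) + 𝟙 (short? ρ false w D m))
    comparableEvents ρ D m = ∑[ w < Z ] (𝟙 (comparable? true w ρ D m) + 𝟙 (comparable? false w ρ D m))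

    huge-total : ∀ {ρ D ms} → 64 * Ω < ρ → Hist D ms → total (hugeEvents ρ) D ms ≤ total (closeCrossings ρ) D ms + 2 * Ω
    huge-total {ρ} big H = events-total ρ (λ w → ℤ.∣ E w ∣) (huge? ρ) Huge.crosses
      (λ { H (huge (crossing _ wrs _ long) blocks) → huge-shallow big H long blocks wrs }) H

    -- Summing K over the cells gives Ω for the first term and 4 · 8 Ω for the averages, and both
    -- directions double it: 66 = 2 (1 + 32).
    short-total : ∀ {ρ} .{{_ : NonZero ρ}} {D ms} → Hist D ms →
                  total (shortEvents ρ) D ms ≤ total (closeCrossings ρ) D ms + 66 * Ω
    short-total {ρ} {D} {ms} H = linear 5 (λ t c k d Ω → 1 · t :≤ c :+ 2 :* k ∷ 2 · k :≤ Ω :+ d ∷ 2 · d :≤ 32 :* Ω ∷ [] ⊢ t :≤ c :+ 66 :* Ω)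
        _ (total (closeCrossings ρ) D ms) (∑ Z K) (∑[ w < Z ] (4 * mass ρ w / ρ)) Ω
        (events-total ρ K (short? ρ) Short.crosses short-shallow H)
        (≤-reflexive (∑-+ Z (λ w → ℤ.∣ E w ∣) (λ w → 4 * mass ρ w / ρ)))
        (*-cancelˡ-≤ ρ (begin
          ρ * ∑[ w < Z ] (4 * mass ρ w / ρ)     ≡⟨ sym (∑-* Z ρ (λ w → 4 * mass ρ w / ρ)) ⟩
          ∑[ w < Z ] (ρ * (4 * mass ρ w / ρ))   ≤⟨ ∑-mono Z (λ w _ → ≤-trans (≤-reflexive (*-comm ρ _)) (m/n*n≤m (4 * mass ρ w) ρ)) ⟩
          ∑[ w < Z ] (4 * mass ρ w)             ≡⟨ ∑-* Z 4 (mass ρ) ⟩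
          4 * ∑[ w < Z ] mass ρ w               ≤⟨ *-monoʳ-≤ 4 (∑-mass ρ) ⟩
          4 * (8 * ρ * Ω)                       ≡⟨ trans (cong (4 *_) (*-assoc 8 ρ Ω)) (sym (*-assoc 4 8 (ρ * Ω))) ⟩
          32 * (ρ * Ω)                          ≡⟨ trans (sym (*-assoc 32 ρ Ω)) (trans (cong (_* Ω) (*-comm 32 ρ)) (*-assoc ρ 32 Ω)) ⟩
          ρ * (32 * Ω)                          ∎))
      where
      open ≤-Reasoning
      K : ℕ → ℕ
      K w = ℤ.∣ E w ∣ + 4 * mass ρ w / ρ

    -- The constant is 2 · 256 · 8: two directions, the bound at each cell, and the 8 ρ windows that
    -- contain a given cell.
    comparable-total : ∀ {ρ} .{{_ : NonZero ρ}} {D ms} → Hist D ms → total (comparableEvents ρ) D ms ≤ 4096 * Ω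
    comparable-total {ρ} {D} {ms} H = *-cancelˡ-≤ ρ (begin
      ρ * total (comparableEvents ρ) D ms   ≡⟨ cong (ρ *_) (total-∑ Z (λ w D m → 𝟙 (comparable? true w ρ D m) + 𝟙 (comparable? false w ρ D m)) D ms) ⟩
      ρ * ∑[ w < Z ] total (λ D m → 𝟙 (comparable? true w ρ D m) + 𝟙 (comparable? false w ρ D m)) D ms ≡⟨ sym (∑-* Z ρ _) ⟩
      ∑[ w < Z ] (ρ * total (λ D m → 𝟙 (comparable? true w ρ D m) + 𝟙 (comparable? false w ρ D m)) D ms) ≤⟨ ∑-mono Z (λ w _ → cell w) ⟩
      ∑[ w < Z ] (512 * mass ρ w)               ≡⟨ ∑-* Z 512 (mass ρ) ⟩
      512 * ∑[ w < Z ] mass ρ w                 ≤⟨ *-monoʳ-≤ 512 (∑-mass ρ) ⟩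
      512 * (8 * ρ * Ω)                         ≡⟨ trans (cong (512 *_) (*-assoc 8 ρ Ω)) (sym (*-assoc 512 8 (ρ * Ω))) ⟩
      4096 * (ρ * Ω)                            ≡⟨ trans (sym (*-assoc 4096 ρ Ω)) (trans (cong (_* Ω) (*-comm 4096 ρ)) (*-assoc ρ 4096 Ω)) ⟩
      ρ * (4096 * Ω)                            ∎)
      where
      open ≤-Reasoning
      cell : ∀ w → ρ * total (λ D m → 𝟙 (comparable? true w ρ D m) + 𝟙 (comparable? false w ρ D m)) D ms ≤ 512 * mass ρ w
      cell w = begin
        ρ * total (λ D m → 𝟙 (comparable? true w ρ D m) + 𝟙 (comparable? false w ρ D m)) D ms
          ≡⟨ trans (cong (ρ *_) (total-+ (λ D m → 𝟙 (comparable? true w ρ D m)) (λ D m → 𝟙 (comparable? false w ρ D m)) D ms)) (*-comm ρ _) ⟩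
        (N true + N false) * ρ            ≡⟨ *-distribʳ-+ ρ (N true) (N false) ⟩
        N true * ρ + N false * ρ          ≤⟨ +-mono-≤ (comparable-count true w ρ H) (comparable-count false w ρ H) ⟩
        256 * mass ρ w + 256 * mass ρ w   ≡⟨ sym (*-distribʳ-+ (mass ρ w) 256 256) ⟩
        512 * mass ρ w                    ∎
        where
        N : Bool → ℕ
        N s = total (λ D m → 𝟙 (comparable? s w ρ D m)) D ms

    either-sign : ∀ {P Q R : Set} {m : Move} (p : Dec P) (q : Dec Q) (r : Dec R) s → (dir m ≡ true → P → Q) → (dir m ≡ false → P → R) →
                  dir m ≡ s → 𝟙 p ≤ 𝟙 q + 𝟙 r
    either-sign p q r true  f g e = m≤n⇒m≤n+o _ (𝟙-mono p q (f e))
    either-sign p q r false f g e = m≤n⇒m≤o+n (𝟙 q) (𝟙-mono p r (g e))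

    -- By `huge-shallow`, E is nonzero on every worsened cell, so at most Ω cells get worse and len
    -- < 4 Ω < ρ / 16. So a near move with a huge other side is automatically short, which is where
    -- the factor 64 comes from.
    huge-bound : ∀ {ρ} → 64 * Ω < ρ → ∀ {D m ms} → Hist D (m ∷ ms) → near Z E D m → ρ ≤ olen m → worse Z D m ≤ hugeEvents ρ D m
    huge-bound {ρ} big {D} {m} H (worsens , _ , blocks) long = ∑-mono Z (λ w _ → cell w)
      where
      short₁ : 16 * len m ≤ ρ
      short₁ = linear 4 (λ n v Ω ρ → 16 · n :< 4 :* v ∷ 64 · v :≤ Ω ∷ 1 · 64 :* Ω :< ρ ∷ [] ⊢ 16 :* n :≤ ρ) (len m) (worse Z D m) Ω ρ worsens
        (≤-trans (≤-reflexive (sym (*-identityˡ _))) (∑-markov Z (worse? D m) (λ z → ℤ.∣ E z ∣) 1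
          (λ z z<Z wrs → ≤-trans (s≤s z≤n) (huge-shallow big H long blocks wrs))))
        big
      cell : ∀ w → 𝟙 (worse? D m w) ≤ 𝟙 (huge? ρ true w D m) + 𝟙 (huge? ρ false w D m)
      cell w = either-sign {m = m} (worse? D m w) (huge? ρ true w D m) (huge? ρ false w D m) (dir m) (λ { refl p → huge (crossing refl p short₁ long) blocks })
                           (λ { refl p → huge (crossing refl p short₁ long) blocks }) refl

    short-bound : ∀ {ρ D m} → near Z E D m → 16 * len m ≤ ρ → ρ ≤ olen m → olen m < 2 * ρ → worse Z D m ≤ shortEvents ρ D m
    short-bound {ρ} {D} {m} (_ , _ , blocks) short₁ long olen< = ∑-mono Z (λ w _ →
      either-sign {m = m} (worse? D m w) (short? ρ true w D m) (short? ρ false w D m) (dir m)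
        (λ { refl p → short (crossing refl p short₁ long) blocks olen< })
        (λ { refl p → short (crossing refl p short₁ long) blocks olen< }) refl)

    -- The first ρ/128 cells of a path longer than ρ/16 count it as comparable.
    comparable-bound : ∀ {ρ D m ms} → Hist D (m ∷ ms) → near Z E D m → ρ < 16 * len m → olen m < 2 * ρ →
                       worse Z D m ≤ 256 * comparableEvents ρ D m
    comparable-bound {ρ} {D} {m} (cons wf₀ q≤Z _ _ _ _) (worsens , shorter , blocks) long olen< =
      linear 7 (λ v n o ρ c s e → 1 · v :≤ n ∷ 1 · n :≤ o ∷ 1 · o :< 2 :* ρ ∷ 2 · ρ :≤ 128 :* c ∷ 256 · c :≤ s ∷ 256 · s :≤ e ∷ [] ⊢ v :≤ 256 :* e)
        (worse Z D m) (len m) (olen m) ρ c (∑[ w < Z ] 𝟙 (start? w)) (comparableEvents ρ D m)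
        (≤-trans (∑-mono Z (λ w _ → 𝟙-mono (worse? D m w) (path? m w) proj₁)) (≤-reflexive (sym (path-count Z E wf₀ q≤Z))))
        shorter olen< c≥
        (count-path-≥ Z c start? wf₀ q≤Z c≤len (λ w p τ≤c → p , ≤-<-trans (*-monoʳ-≤ 128 τ≤c) c<))
        (∑-mono Z (λ w _ → either-sign {m = m} (start? w) (comparable? true w ρ D m) (comparable? false w ρ D m) (dir m)
          (λ { refl (p , st) → comparable refl p st long shorter olen< worsens blocks })
          (λ { refl (p , st) → comparable refl p st long shorter olen< worsens blocks }) refl))
      where
      c = (ρ + 127) / 128
      start? : ∀ w → Dec (Path m w × 128 * τ (r m) w < ρ + 128)
      start? w = path? m w ×-dec (128 * τ (r m) w <? ρ + 128)
      c*128 : c * 128 ≤ ρ + 127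
      c*128 = m/n*n≤m (ρ + 127) 128
      c< : 128 * c < ρ + 128
      c< = linear 2 (λ c ρ → 1 · 128 :* c :≤ ρ :+ # 127 ∷ [] ⊢ 128 :* c :< ρ :+ # 128) c ρ (≤-trans (≤-reflexive (*-comm 128 c)) c*128)
      c≥ : ρ ≤ 128 * c
      c≥ = linear 3 (λ ρ c t → 1 · ρ :+ # 127 :≤ t :+ 128 :* c ∷ 1 · t :≤ # 127 ∷ [] ⊢ ρ :≤ 128 :* c) ρ c ((ρ + 127) % 128)
        (≤-reflexive (trans (m≡m%n+[m/n]*n (ρ + 127) 128) (cong ((ρ + 127) % 128 +_) (*-comm c 128)))) (s≤s⁻¹ (m%n<n (ρ + 127) 128))
      c≤len : c ≤ len m
      c≤len = ≮⇒≥ (λ len<c → contradiction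
        (linear 3 (λ n c ρ → 128 · n :< c ∷ 1 · 128 :* c :< ρ :+ # 128 ∷ 1 · ρ :< 16 :* n ∷ [] ⊢ # 0 :< # 0) (len m) c ρ len<c c< long) (<-irrefl refl))

    module _ (n K top bot scales tiny : ℕ) (64Ω<2^top : 64 * Ω < 2 ^ top) (bot+scales : bot + scales ≡ top)
             (scales≤ : scales ≤ K) (n*tiny≤Ω : n * tiny ≤ Ω) (2^bot≤tiny : 0 < bot → 2 ^ bot ≤ tiny) where

      private
        classified : (ℕ → ℤ) → Move → ℕ
        classified D m = hugeEvents (2 ^ top) D m
                       + (∑[ j < scales ] shortEvents (2 ^ (bot + j)) D m + 256 * ∑[ j < scales ] comparableEvents (2 ^ (bot + j)) D m)

        worse≤olen : ∀ {D m ms} → Hist D (m ∷ ms) → near Z E D m → worse Z D m ≤ olen m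
        worse≤olen {D} {m} (cons wf₀ q≤Z _ _ _ _) (_ , shorter , _) =
          ≤-trans (∑-mono Z (λ w _ → 𝟙-mono (worse? D m w) (path? m w) proj₁)) (≤-trans (≤-reflexive (sym (path-count Z E wf₀ q≤Z))) shorter)

        -- The number c stands for the sum over all classes. The length of the other side, and then
        -- that of the path, select one class, and its summand alone bounds the worsened cells.
        classify-below : ∀ {D m ms} c → Hist D (m ∷ ms) → near Z E D m → tiny ≤ c → hugeEvents (2 ^ top) D m ≤ c →
                         (∀ j → j < scales → shortEvents (2 ^ (bot + j)) D m ≤ c) →
                         (∀ j → j < scales → 256 * comparableEvents (2 ^ (bot + j)) D m ≤ c) → worse Z D m ≤ c
        classify-below {D} {m} c H@(cons wf₀ _ _ _ _ _) near₁ tiny≤ huge≤ short≤ comparable≤ = by-olen (olen m <? 2 ^ bot) (2 ^ top ≤? olen m)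
          where
          by-len : ∀ j → j < scales → 2 ^ (bot + j) ≤ olen m → olen m < 2 * 2 ^ (bot + j) → Dec (16 * len m ≤ 2 ^ (bot + j)) → worse Z D m ≤ c
          by-len j j< lo hi (yes short₁) = ≤-trans (short-bound {2 ^ (bot + j)} {D} {m} near₁ short₁ lo hi) (short≤ j j<)
          by-len j j< lo hi (no long₁)   = ≤-trans (comparable-bound {2 ^ (bot + j)} {D} {m} H near₁ (≰⇒> long₁) hi) (comparable≤ j j<)

          -- For bot = 0 the threshold is 1, and no other side is shorter than that.
          bot>0 : olen m < 2 ^ bot → 0 < bot
          bot>0 olen< = n≢0⇒n>0 (λ e → contradiction (olen>0 wf₀) (≤⇒≯ (s≤s⁻¹ (subst (λ t → olen m < 2 ^ t) e olen<))))

          by-olen : Dec (olen m < 2 ^ bot) → Dec (2 ^ top ≤ olen m) → worse Z D m ≤ c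
          by-olen (yes olen<) _ = ≤-trans (≤-trans (worse≤olen H near₁) (<⇒≤ olen<)) (≤-trans (2^bot≤tiny (bot>0 olen<)) tiny≤)
          by-olen (no _) (yes long) = ≤-trans (huge-bound {2 ^ top} 64Ω<2^top {D} {m} H near₁ long) huge≤
          by-olen (no ≮) (no long)  =
            let j , j< , lo , hi = bracket bot scales (olen m) (≮⇒≥ ≮) (subst (λ t → olen m < 2 ^ t) (sym bot+scales) (≰⇒> long))
            in by-len j j< lo hi (16 * len m ≤? 2 ^ (bot + j))

        classify : ∀ {D m ms} → Hist D (m ∷ ms) → nearWorse Z E D m ≤ tiny + classified D m
        classify {D} {m} H = by-near (near? Z E D m)
          where
          h s c : ℕ
          h = hugeEvents (2 ^ top) D m
          s = ∑[ j < scales ] shortEvents (2 ^ (bot + j)) D m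
          c = ∑[ j < scales ] comparableEvents (2 ^ (bot + j)) D m

          below : ∀ t → near Z E D m → t ≡ tiny + (h + (s + 256 * c)) → worse Z D m ≤ t
          below t near₁ e = classify-below {D} {m} t H near₁
            (≤-trans (m≤m+n tiny (h + (s + 256 * c))) (≤-reflexive (sym e)))
            (≤-trans (m≤n⇒m≤o+n tiny (m≤m+n h (s + 256 * c))) (≤-reflexive (sym e)))
            (λ j j< → ≤-trans (m≤n⇒m≤o+n tiny (m≤n⇒m≤o+n h (m≤n⇒m≤n+o (256 * c) (∑-term scales (λ j → shortEvents (2 ^ (bot + j)) D m) j j<)))) (≤-reflexive (sym e)))
            (λ j j< → ≤-trans (m≤n⇒m≤o+n tiny (m≤n⇒m≤o+n h (m≤n⇒m≤o+n s
               (*-monoʳ-≤ 256 (∑-term scales (λ j → comparableEvents (2 ^ (bot + j)) D m) j j<))))) (≤-reflexive (sym e)))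

          by-near : ∀ (d : Dec (near Z E D m)) → 𝟙 d * worse Z D m ≤ tiny + classified D m
          by-near (no _)      = z≤n
          by-near (yes near₁) = ≤-trans (≤-reflexive (*-identityˡ (worse Z D m))) (below (tiny + classified D m) near₁ refl)

      module _ {D ms} (H : Hist D ms) where

        private
          sum : ((ℕ → ℤ) → Move → ℕ) → ℕ
          sum c = total c D ms

          C : ℕ → (ℕ → ℤ) → Move → ℕ
          C j = closeCrossings (2 ^ (bot + j))

          sum-const : ∀ k D ms → total (λ _ _ → k) D ms ≡ length ms * k
          sum-const k D []       = refl
          sum-const k D (m ∷ ms) = cong (k +_) (sum-const k (shift m D) ms)

          ∑-const : ∀ k n → ∑[ j < n ] k ≡ n * k
          ∑-const k zero    = refl
          ∑-const k (suc n) = cong (k +_) (∑-const k n)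

          -- A walk contributes at most ρ / 16 at each scale ρ not above its length, and these
          -- powers of two sum to at most twice the length. The top scale is the term j = scales, so
          -- one sum over suc scales terms covers everything.
          crossings : 8 * (sum (closeCrossings (2 ^ top)) + ∑[ j < scales ] sum (C j)) ≤ sum (pathLength)
          crossings = *-cancelˡ-≤ 2 (begin
            2 * (8 * (sum (closeCrossings (2 ^ top)) + ∑[ j < scales ] sum (C j)))  ≡⟨ sym (*-assoc 2 8 (sum (closeCrossings (2 ^ top)) + ∑[ j < scales ] sum (C j))) ⟩
            16 * (sum (closeCrossings (2 ^ top)) + ∑[ j < scales ] sum (C j))       ≡⟨ cong (λ t → 16 * (sum (closeCrossings (2 ^ t)) + ∑[ j < scales ] sum (C j))) (sym bot+scales) ⟩
            16 * ∑[ j < suc scales ] sum (C j)                                      ≡⟨ cong (16 *_) (sym (total-∑ (suc scales) C D ms)) ⟩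
            16 * sum (λ D m → ∑[ j < suc scales ] C j D m)                          ≡⟨ sym (total-* 16 _ D ms) ⟩
            sum (λ D m → 16 * ∑[ j < suc scales ] C j D m)                          ≤⟨ total-mono Z E (λ {D} {m} _ → perMove D m) H ⟩
            sum (λ D m → 2 * pathLength D m)                                       ≡⟨ total-* 2 (pathLength) D ms ⟩
            2 * sum (pathLength)                                                   ∎)
            where
            open ≤-Reasoning
            perMove : ∀ D m → 16 * ∑[ j < suc scales ] C j D m ≤ 2 * len m
            perMove D m = begin
              16 * ∑[ j < suc scales ] C j D m                                 ≡⟨ sym (∑-* (suc scales) 16 (λ j → C j D m)) ⟩
              ∑[ j < suc scales ] (16 * C j D m)                               ≤⟨ ∑-mono (suc scales) (λ j _ → closeCrossings-bound (2 ^ (bot + j)) D m) ⟩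
              ∑[ j < suc scales ] (𝟙 (2 ^ (bot + j) ≤? len m) * 2 ^ (bot + j)) ≤⟨ geometric bot (suc scales) (len m) ⟩
              2 * len m                                                        ∎

          shorts comparables : ℕ
          shorts = ∑[ j < scales ] sum (shortEvents (2 ^ (bot + j)))
          comparables = ∑[ j < scales ] sum (comparableEvents (2 ^ (bot + j)))

          short-sum : shorts ≤ ∑[ j < scales ] sum (C j) + 66 * (K * Ω)
          short-sum = begin
            shorts                                                          ≤⟨ ∑-mono scales (λ j _ → short-total {2 ^ (bot + j)} {{m^n≢0 2 (bot + j)}} H) ⟩
            ∑[ j < scales ] (sum (C j) + 66 * Ω)                       ≡⟨ ∑-+ scales (λ j → sum (C j)) (λ _ → 66 * Ω) ⟩
            ∑[ j < scales ] sum (C j) + ∑[ j < scales ] (66 * Ω)       ≡⟨ cong (∑[ j < scales ] sum (C j) +_) (∑-* scales 66 (λ _ → Ω)) ⟩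
            ∑[ j < scales ] sum (C j) + 66 * ∑[ j < scales ] Ω         ≡⟨ cong (λ t → ∑[ j < scales ] sum (C j) + 66 * t) (∑-const Ω scales) ⟩
            ∑[ j < scales ] sum (C j) + 66 * (scales * Ω)              ≤⟨ +-monoʳ-≤ (∑[ j < scales ] sum (C j)) (*-monoʳ-≤ 66 (*-monoˡ-≤ Ω scales≤)) ⟩
            ∑[ j < scales ] sum (C j) + 66 * (K * Ω)             ∎
            where open ≤-Reasoning

          comparable-sum : comparables ≤ 4096 * (K * Ω)
          comparable-sum = begin
            comparables                                    ≤⟨ ∑-mono scales (λ j _ → comparable-total {2 ^ (bot + j)} {{m^n≢0 2 (bot + j)}} H) ⟩
            ∑[ j < scales ] (4096 * Ω)           ≡⟨ ∑-* scales 4096 (λ _ → Ω) ⟩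
            4096 * ∑[ j < scales ] Ω             ≡⟨ cong (4096 *_) (∑-const Ω scales) ⟩
            4096 * (scales * Ω)                  ≤⟨ *-monoʳ-≤ 4096 (*-monoˡ-≤ Ω scales≤) ⟩
            4096 * (K * Ω)                 ∎
            where open ≤-Reasoning

          near-sum : sum (nearWorse Z E) ≤ length ms * tiny + (sum (hugeEvents (2 ^ top)) + (shorts + 256 * comparables))
          near-sum = begin
            sum (nearWorse Z E)                            ≤⟨ total-mono Z E classify H ⟩
            sum (λ D m → tiny + classified D m)            ≡⟨ total-+ (λ _ _ → tiny) classified D ms ⟩
            sum (λ _ _ → tiny) + sum classified            ≡⟨ cong₂ _+_ (sum-const tiny D ms) (trans (total-+ (hugeEvents (2 ^ top)) _ D ms)
                                                               (cong (sum (hugeEvents (2 ^ top)) +_) (trans (total-+ _ _ D ms)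
                                                                 (cong₂ _+_ (total-∑ scales (λ j → shortEvents (2 ^ (bot + j))) D ms)
                                                                   (trans (total-* 256 _ D ms) (cong (256 *_) (total-∑ scales (λ j → comparableEvents (2 ^ (bot + j))) D ms))))))) ⟩
            length ms * tiny + (sum (hugeEvents (2 ^ top)) + (shorts + 256 * comparables)) ∎
            where open ≤-Reasoning

        huge-sum : sum (hugeEvents (2 ^ top)) ≤ sum (closeCrossings (2 ^ top)) + 2 * Ω
        huge-sum = huge-total {2 ^ top} {D} {ms} 64Ω<2^top H

        module _ (D≡0 : ∀ z → D z ≡ 0ℤ) (ms≤n : length ms ≤ n) where

          length-sum : sum pathLength ≤ 4 * sum (nearWorse Z E)
          length-sum = total-length Z E {D} {ms} H D≡0

          tiny-sum : length ms * tiny ≤ Ω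
          tiny-sum = ≤-trans (*-monoˡ-≤ tiny ms≤n) n*tiny≤Ω

          history-bound-at : sum pathLength ≤ logBound Ω (K * Ω)
          history-bound-at = logBound-sound (sum pathLength) (sum (nearWorse Z E)) (length ms * tiny) (sum (hugeEvents (2 ^ top))) shorts comparables
            (sum (closeCrossings (2 ^ top))) (∑[ j < scales ] sum (C j)) Ω (K * Ω)
            length-sum near-sum tiny-sum huge-sum short-sum comparable-sum crossings

    -- The scales run from 2 ^ (top - K) to 2 ^ top. As 2 ^ top ≤ 128 Ω and 128 n ≤ 2 ^ K, a move
    -- below the lowest scale worsens at most Ω / n cells, so all of them together cost at most Ω.
    history-bound : ∀ n K → 128 * n ≤ 2 ^ K → ∀ {D ms} → Hist D ms → (∀ z → D z ≡ 0ℤ) → length ms ≤ n →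
                    total pathLength D ms ≤ logBound Ω (K * Ω)
    history-bound n K 128n≤2^K {D} {ms} H = from-top (top-scale Ω)
      where
      from-top : (∃ λ t → 64 * Ω < 2 ^ t × (t ≡ 0 ⊎ 2 ^ t ≤ 128 * Ω)) → (∀ z → D z ≡ 0ℤ) → length ms ≤ n →
                 total pathLength D ms ≤ logBound Ω (K * Ω)
      from-top (top , 64Ω< , top-small) = history-bound-at n K top bot (top ∸ bot) tiny 64Ω< (m+[n∸m]≡n (m∸n≤m top K))
          (m≤n+o⇒m∸n≤o top bot (subst (top ≤_) (+-comm K bot) (m≤n+m∸n top K)))
          (bound (0 <? bot) top-small)
          (λ 0<bot → ≤-reflexive (sym (trans (cong (_* 2 ^ bot) (𝟙-yes (0 <? bot) 0<bot)) (*-identityˡ (2 ^ bot)))))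
          {D} {ms} H
        where
        open ≤-Reasoning
        bot tiny : ℕ
        bot  = top ∸ K
        -- The indicator removes the contribution when all scales down to 1 are treated; then 2 ^
        -- bot = 1 need not be at most Ω / n.
        tiny = 𝟙 (0 <? bot) * 2 ^ bot

        K≤top : 0 < bot → K ≤ top
        K≤top p = ≮⇒≥ (λ top< → contradiction p (≤⇒≯ (≤-reflexive (m≤n⇒m∸n≡0 (<⇒≤ top<)))))

        bound : ∀ (d : Dec (0 < bot)) → (top ≡ 0 ⊎ 2 ^ top ≤ 128 * Ω) → n * (𝟙 d * 2 ^ bot) ≤ Ω
        bound (no _)  _             = ≤-trans (≤-reflexive (*-zeroʳ n)) z≤n
        bound (yes p) (inj₁ top≡0)  = contradiction p (≤⇒≯ (≤-trans (m∸n≤m top K) (≤-reflexive top≡0)))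
        bound (yes p) (inj₂ 2^top≤) = *-cancelˡ-≤ 128 (begin
          128 * (n * (1 * 2 ^ bot))       ≡⟨ cong (λ t → 128 * (n * t)) (*-identityˡ (2 ^ bot)) ⟩
          128 * (n * 2 ^ bot)             ≡⟨ sym (*-assoc 128 n (2 ^ bot)) ⟩
          128 * n * 2 ^ bot               ≤⟨ *-monoˡ-≤ (2 ^ bot) 128n≤2^K ⟩
          2 ^ K * 2 ^ bot                 ≡⟨ sym (^-distribˡ-+-* 2 K bot) ⟩
          2 ^ (K + bot)                   ≡⟨ cong (2 ^_) (m+[n∸m]≡n (K≤top p)) ⟩
          2 ^ top                         ≤⟨ 2^top≤ ⟩
          128 * Ω                         ∎)

  -- The greedy rule

  -- Locations carry numbers of free servers; the searches fall back to 0 and to the end of the range.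
  Free : Set
  Free = ℕ → ℕ

  searchDown : Free → ℕ → ℕ
  searchDown f zero    = 0
  searchDown f (suc k) with f k ≟ 0
  ... | yes _ = searchDown f k
  ... | no _  = k

  searchUp : Free → ℕ → ℕ → ℕ
  searchUp f k zero    = k
  searchUp f k (suc c) with f k ≟ 0
  ... | yes _ = searchUp f (suc k) c
  ... | no _  = k

  searchDown-< : ∀ f {r} → 0 < r → searchDown f r < r
  searchDown-< f {suc k} _ with f k ≟ 0
  ... | no _ = ≤-refl
  ... | yes _ with k
  ...   | zero   = s≤s z≤n
  ...   | suc k′ = m<n⇒m<1+n (searchDown-< f (s≤s z≤n))

  searchDown-empty : ∀ f r {k} → searchDown f r < k → k < r → f k ≡ 0
  searchDown-empty f (suc r) {k} d<k k<1+r with f r ≟ 0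
  ... | no _ = contradiction d<k (≤⇒≯ (s≤s⁻¹ k<1+r))
  ... | yes fr≡0 with k ≟ r
  ...   | yes refl = fr≡0
  ...   | no k≢r   = searchDown-empty f r d<k (≤∧≢⇒< (s≤s⁻¹ k<1+r) k≢r)

  searchDown-found : ∀ f r → searchDown f r ≡ 0 ⊎ f (searchDown f r) ≢ 0
  searchDown-found f zero = inj₁ refl
  searchDown-found f (suc r) with f r ≟ 0
  ... | yes _ = searchDown-found f r
  ... | no fr≢0 = inj₂ fr≢0

  searchUp-≥ : ∀ f k c → k ≤ searchUp f k c
  searchUp-≥ f k zero = ≤-refl
  searchUp-≥ f k (suc c) with f k ≟ 0
  ... | yes _ = ≤-trans (n≤1+n k) (searchUp-≥ f (suc k) c)
  ... | no _  = ≤-refl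

  searchUp-≤ : ∀ f k c → searchUp f k c ≤ k + c
  searchUp-≤ f k zero = m≤m+n k 0
  searchUp-≤ f k (suc c) with f k ≟ 0
  ... | yes _ = ≤-trans (searchUp-≤ f (suc k) c) (≤-reflexive (sym (+-suc k c)))
  ... | no _  = m≤m+n k (suc c)

  searchUp-empty : ∀ f k c {j} → k ≤ j → j < searchUp f k c → f j ≡ 0
  searchUp-empty f k zero    k≤j j< = contradiction k≤j (<⇒≱ j<)
  searchUp-empty f k (suc c) {j} k≤j j< with f k ≟ 0
  ... | no _ = contradiction k≤j (<⇒≱ j<)
  ... | yes fk≡0 with k ≟ j
  ...   | yes refl = fk≡0
  ...   | no k≢j   = searchUp-empty f (suc k) c (≤∧≢⇒< k≤j k≢j) j<

  searchUp-found : ∀ f k c → searchUp f k c ≡ k + c ⊎ f (searchUp f k c) ≢ 0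
  searchUp-found f k zero = inj₁ (sym (+-identityʳ k))
  searchUp-found f k (suc c) with f k ≟ 0
  ... | no fk≢0 = inj₂ fk≢0
  ... | yes _ with searchUp-found f (suc k) c
  ...   | inj₁ e = inj₁ (trans e (sym (+-suc k c)))
  ...   | inj₂ h = inj₂ h

  take : Free → ℕ → Free
  take f t k with k ≟ t
  ... | yes _ = pred (f k)
  ... | no _  = f k

  take-≤ : ∀ f t k → take f t k ≤ f k
  take-≤ f t k with k ≟ t
  ... | yes _ = pred[n]≤n
  ... | no _  = ≤-refl

  upTo : Free → ℕ → ℕ
  upTo f z = ∑ (suc z) f

  ∑-take : ∀ n f t → f t ≢ 0 → ∑ n (take f t) + 𝟙 (t <? n) ≡ ∑ n f
  ∑-take zero    f t h = 𝟙-no (t <? 0) (λ ())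
  ∑-take (suc n) f t h with n ≟ t
  ... | yes refl = begin
    pred (f n) + ∑ n (take f n) + 𝟙 (n <? suc n)  ≡⟨ cong (pred (f n) + ∑ n (take f n) +_) (trans (𝟙-yes (n <? suc n) ≤-refl) (cong suc (sym (𝟙-no (n <? n) (<-irrefl refl))))) ⟩
    pred (f n) + ∑ n (take f n) + suc (𝟙 (n <? n)) ≡⟨ +-suc _ _ ⟩
    suc (pred (f n)) + ∑ n (take f n) + 𝟙 (n <? n) ≡⟨ +-assoc (suc (pred (f n))) _ _ ⟩
    suc (pred (f n)) + (∑ n (take f n) + 𝟙 (n <? n)) ≡⟨ cong₂ _+_ (suc-pred (f n) {{≢-nonZero h}}) (∑-take n f n h) ⟩
    f n + ∑ n f                                     ∎
    where open ≡-Reasoning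
  ... | no n≢t = begin
    f n + ∑ n (take f t) + 𝟙 (t <? suc n)  ≡⟨ cong (f n + ∑ n (take f t) +_) (𝟙-cong (t <? suc n) (t <? n) (λ p → ≤∧≢⇒< (s≤s⁻¹ p) (n≢t ∘ sym)) m<n⇒m<1+n) ⟩
    f n + ∑ n (take f t) + 𝟙 (t <? n)      ≡⟨ +-assoc (f n) _ _ ⟩
    f n + (∑ n (take f t) + 𝟙 (t <? n))    ≡⟨ cong (f n +_) (∑-take n f t h) ⟩
    f n + ∑ n f                             ∎
    where open ≡-Reasoning

  upTo-take : ∀ f t z → f t ≢ 0 → upTo (take f t) z + 𝟙 (t ≤? z) ≡ upTo f z
  upTo-take f t z h = trans (cong (upTo (take f t) z +_) (𝟙-cong (t ≤? z) (t <? suc z) s≤s s≤s⁻¹)) (∑-take (suc z) f t h)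

  upTo-empty : ∀ f {z z′} → z ≤ z′ → (∀ k → z < k → k ≤ z′ → f k ≡ 0) → upTo f z′ ≡ upTo f z
  upTo-empty f {z} {zero}   z≤n h = refl
  upTo-empty f {z} {suc z′} z≤z′ h with z ≟ suc z′
  ... | yes refl = refl
  ... | no z≢ = trans (cong (_+ upTo f z′) (h (suc z′) (≤∧≢⇒< z≤z′ z≢) ≤-refl))
                      (upTo-empty f (s≤s⁻¹ (≤∧≢⇒< z≤z′ z≢)) (λ k a b → h k a (m≤n⇒m≤1+n b)))

  requestsUpTo : List ℕ → ℕ → ℕ
  requestsUpTo []       z = 0
  requestsUpTo (r ∷ rs) z = 𝟙 (r ≤? z) + requestsUpTo rs z

  target : Move → ℕ
  target m = if dir m then q m else l m

  rule? : ∀ Z D m → Dec (Rule Z D m)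
  rule? Z D m = (4 * worse Z D m ≤? len m) ⊎-dec ((len m ≤? olen m) ×-dec (olen m ≤? 4 * blocked Z D m))

  -- Reversing the direction exchanges the two sides and changes the sign, so the condition on D is
  -- the same.
  worse≡blocked : ∀ Z D l r q d → worse Z D (move l r q (not d)) ≡ blocked Z D (move l r q d)
  worse≡blocked Z D l r q true  = ∑-cong Z (λ z _ → 𝟙-cong (worse? D (move l r q false) z) (blocked? D (move l r q true) z)
    (λ { (p , h) → p , subst (0ℤ ℤ.≤_) (ℤₚ.neg-involutive (D z)) (ℤₚ.neg-mono-≤ h) })
    (λ { (p , h) → p , ℤₚ.neg-mono-≤ h }))
  worse≡blocked Z D l r q false = ∑-cong Z (λ z _ → 𝟙-cong (worse? D (move l r q true) z) (blocked? D (move l r q false) z)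
    (λ { (p , h) → p , ℤₚ.neg-mono-≤ h })
    (λ { (p , h) → p , subst (ℤ._≤ 0ℤ) (ℤₚ.neg-involutive (D z)) (ℤₚ.neg-mono-≤ h) }))

  -- If the walk to the nearer side fails the second alternative, less than a quarter of the farther
  -- side is blocked. These blocked cells are the ones that the walk to the farther side would
  -- worsen, so that walk satisfies the first alternative.
  rule-either : ∀ Z D l r q → Rule Z D (move l r q true) ⊎ Rule Z D (move l r q false)
  rule-either Z D l r q with q ∸ r ≤? r ∸ l
  ... | yes near₁ with r ∸ l ≤? 4 * blocked Z D (move l r q true)
  ...   | yes b = inj₁ (inj₂ (near₁ , b))
  ...   | no ¬b = inj₂ (inj₁ (≤-trans (≤-reflexive (cong (4 *_) (worse≡blocked Z D l r q true))) (<⇒≤ (≰⇒> ¬b))))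
  rule-either Z D l r q | no far with q ∸ r ≤? 4 * blocked Z D (move l r q false)
  ...   | yes b = inj₂ (inj₂ (<⇒≤ (≰⇒> far) , b))
  ...   | no ¬b = inj₁ (inj₁ (≤-trans (≤-reflexive (cong (4 *_) (worse≡blocked Z D l r q false))) (<⇒≤ (≰⇒> ¬b))))

  module Greedy (Z : ℕ) where

    moveTo : Free → ℕ → Bool → Move
    moveTo f r d = move (searchDown f r) r (searchUp f (suc r) (Z ∸ suc r)) d

    side : ∀ {P : Set} → Dec P → Bool
    side (yes _) = true
    side (no _)  = false

    decide : Free → (ℕ → ℤ) → ℕ → Move
    decide f D r = moveTo f r (side (rule? Z D (moveTo f r true)))

    decide-rule : ∀ f D r → Rule Z D (decide f D r)
    decide-rule f D r = obeys (rule? Z D (moveTo f r true)) (rule-either Z D _ _ _)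
      where
      obeys : ∀ (d : Dec (Rule Z D (moveTo f r true))) → Rule Z D (moveTo f r true) ⊎ Rule Z D (moveTo f r false) →
              Rule Z D (moveTo f r (side d))
      obeys (yes p) _        = p
      obeys (no ¬p) (inj₁ p) = contradiction p ¬p
      obeys (no ¬p) (inj₂ p) = p

    location : Free → (ℕ → ℤ) → ℕ → ℕ
    location f D r with f r ≟ 0
    ... | yes _ = target (decide f D r)
    ... | no _  = r

    imbalance : Free → (ℕ → ℤ) → ℕ → ℕ → ℤ
    imbalance f D r with f r ≟ 0
    ... | yes _ = shift (decide f D r) D
    ... | no _  = D

    moves : Free → (ℕ → ℤ) → List ℕ → List Move
    moves f D []       = []
    moves f D (r ∷ rs) with f r ≟ 0
    ... | yes _ = decide f D r ∷ moves (take f (target (decide f D r))) (shift (decide f D r) D) rs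
    ... | no _  = moves (take f r) D rs

    cost : Free → (ℕ → ℤ) → List ℕ → ℕ
    cost f D []       = 0
    cost f D (r ∷ rs) = ∣ r - location f D r ∣ + cost (take f (location f D r)) (imbalance f D r) rs

    FreeEnds : Free → Move → Set
    FreeEnds f m = (l m ≡ 0 ⊎ f (l m) ≢ 0) × (q m ≡ Z ⊎ f (q m) ≢ 0)

  -- The locations lie in the middle part of a range of three parts, the outer two longer than it,
  -- so that the ends of the range act as free locations that are never chosen.
  module Analysis (X W : ℕ) (W<X : W < X) (E : ℕ → ℤ)
                  (E-low : ∀ z → z < X → E z ≡ 0ℤ) (E-high : ∀ z → X + W ≤ z → E z ≡ 0ℤ) where

    Z : ℕ
    Z = X + W + X

    open Greedy Z

    InRange : ℕ → Set
    InRange k = X ≤ k × k ≤ X + W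

    -- In `balance` both sides equal the number of all servers minus the number of requests already
    -- seen, at locations ≤ z: D is used minus seen, E is all servers minus all requests.
    record Inv (f : Free) (D : ℕ → ℤ) (rs : List ℕ) : Set where
      field
        balance   : ∀ z → D z ℤ.+ pos (upTo f z) ≡ E z ℤ.+ pos (requestsUpTo rs z)
        supported : ∀ k → f k ≢ 0 → InRange k
        requests  : All InRange rs
        enough    : ∑ Z f ≡ length rs

    range<Z : ∀ {k} → InRange k → k < Z
    range<Z {k} (_ , k≤) = linear 3 (λ k x w → 1 · k :≤ x :+ w ∷ 1 · w :< x ∷ [] ⊢ k :< x :+ w :+ x) k X W k≤ W<X

    module _ {f D r rs} (I : Inv f D (r ∷ rs)) where

      open Inv I

      r-range : InRange r
      r-range = All.head requests

      r>0 : 0 < r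
      r>0 = ≤-trans (≤-<-trans z≤n W<X) (proj₁ r-range)

      suc-r+ : suc r + (Z ∸ suc r) ≡ Z
      suc-r+ = m+[n∸m]≡n (range<Z r-range)

      f-low : ∀ k → k < X → f k ≡ 0
      f-low k k<X with f k ≟ 0
      ... | yes e = e
      ... | no h  = contradiction (proj₁ (supported k h)) (<⇒≱ k<X)

      f-high : ∀ k → X + W < k → f k ≡ 0
      f-high k k> with f k ≟ 0
      ... | yes e = e
      ... | no h  = contradiction (proj₂ (supported k h)) (<⇒≱ k>)

      requestsUpTo-low : ∀ {rs} → All InRange rs → ∀ z → z < X → requestsUpTo rs z ≡ 0
      requestsUpTo-low []       z z<X = refl
      requestsUpTo-low (p ∷ ps) z z<X = cong₂ _+_ (𝟙-no (_ ≤? z) (λ r≤z → contradiction (≤-trans (proj₁ p) r≤z) (<⇒≱ z<X))) (requestsUpTo-low ps z z<X)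

      requestsUpTo-high : ∀ {rs} → All InRange rs → ∀ z → X + W ≤ z → requestsUpTo rs z ≡ length rs
      requestsUpTo-high []       z h = refl
      requestsUpTo-high (p ∷ ps) z h = cong₂ _+_ (𝟙-yes (_ ≤? z) (≤-trans (proj₂ p) h)) (requestsUpTo-high ps z h)

      upTo-low : ∀ z → z < X → upTo f z ≡ 0
      upTo-low zero    z<X = cong (_+ 0) (f-low 0 z<X)
      upTo-low (suc z) z<X = cong₂ _+_ (f-low (suc z) z<X) (upTo-low z (<-trans ≤-refl z<X))

      upTo-high : ∀ z → X + W ≤ z → z < Z → upTo f z ≡ length (r ∷ rs)
      upTo-high z h z<Z = trans (trans (upTo-empty f h (λ k a _ → f-high k a)) (sym (upTo-empty f (≤-trans h (s≤s⁻¹ (≤-trans z<Z (m≤n+m Z 1)))) (λ k a _ → f-high k a))))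
                                (trans (cong (_+ ∑ Z f) (f-high Z (range<Z (m≤m+n X W , ≤-refl)))) enough)

      -- Below the middle part nothing is counted. Above it everything is, and by `enough` there are
      -- as many free servers as remaining requests.
      D-zero : ∀ z → z < Z → z < X ⊎ X + W ≤ z → D z ≡ 0ℤ
      D-zero z z<Z side = ℤ-Group.∙-cancelʳ (pos (upTo f z)) (D z) 0ℤ (trans (balance z) (cong₂ (λ a b → a ℤ.+ pos b) (E≡0 side) (counts side)))
        where
        E≡0 : z < X ⊎ X + W ≤ z → E z ≡ 0ℤ
        E≡0 (inj₁ h) = E-low z h
        E≡0 (inj₂ h) = E-high z h
        counts : z < X ⊎ X + W ≤ z → requestsUpTo (r ∷ rs) z ≡ upTo f z
        counts (inj₁ h) = trans (requestsUpTo-low requests z h) (sym (upTo-low z h))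
        counts (inj₂ h) = trans (requestsUpTo-high requests z h) (sym (upTo-high z h z<Z))

      some-free : f r ≡ 0 → ¬ (searchDown f r ≡ 0 × searchUp f (suc r) (Z ∸ suc r) ≡ Z)
      some-free fr≡0 (d≡0 , u≡Z) = contradiction (trans (sym enough) (trans (∑-cong Z (λ k k<Z → empty k k<Z)) (∑-0 Z))) (λ ())
        where
        empty : ∀ k → k < Z → f k ≡ 0
        empty k k<Z with <-cmp k r
        ... | tri≈ _ refl _ = fr≡0
        ... | tri> _ _ r<k  = searchUp-empty f (suc r) (Z ∸ suc r) r<k (subst (k <_) (sym u≡Z) k<Z)
        ... | tri< k<r _ _ with k ≟ 0
        ...   | yes refl = f-low 0 (≤-<-trans z≤n W<X)
        ...   | no k≢0   = searchDown-empty f r (subst (_< k) (sym d≡0) (n≢0⇒n>0 k≢0)) k<r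

      -- With no free server to the left, the left side reaches into the outer part, where D = 0.
      right-if-none-left : searchDown f r ≡ 0 → searchUp f (suc r) (Z ∸ suc r) ≢ Z → Rule Z D (moveTo f r true)
      right-if-none-left d≡0 u≢Z with searchUp-found f (suc r) (Z ∸ suc r)
      ... | inj₁ u≡ = contradiction (trans u≡ suc-r+) u≢Z
      ... | inj₂ fu≢0 = inj₂ (near₁ , blocks)
        where
        u = searchUp f (suc r) (Z ∸ suc r)
        near₁ : u ∸ r ≤ r ∸ searchDown f r
        near₁ rewrite d≡0 = m≤n+o⇒m∸n≤o u r (linear 4 (λ u r x w → 1 · u :≤ x :+ w ∷ 1 · w :≤ x ∷ 2 · x :≤ r ∷ [] ⊢ u :≤ r :+ r) u r X W
          (proj₂ (supported u fu≢0)) (<⇒≤ W<X) (proj₁ r-range))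
        blocks : r ∸ searchDown f r ≤ 4 * blocked Z D (moveTo f r true)
        blocks = linear 4 (λ t x w b → 1 · t :≤ x :+ w ∷ 1 · w :≤ x ∷ 4 · x :≤ b ∷ [] ⊢ t :≤ 4 :* b) (r ∸ searchDown f r) X W (blocked Z D (moveTo f r true))
          (≤-trans (m∸n≤m r (searchDown f r)) (proj₂ r-range)) (<⇒≤ W<X)
          (∑-count-≥ Z (blocked? D (moveTo f r true)) 0 X (≤-trans (m≤m+n X W) (m≤m+n (X + W) X))
            (λ z _ z<X → (subst (_≤ z) (sym d≡0) z≤n , <-≤-trans z<X (proj₁ r-range)) ,
                         subst (0ℤ ℤ.≤_) (sym (D-zero z (range<Z′ z<X) (inj₁ z<X))) ℤₚ.≤-refl))
          where
          range<Z′ : ∀ {z} → z < X → z < Z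
          range<Z′ z<X = <-≤-trans z<X (≤-trans (m≤m+n X W) (m≤m+n (X + W) X))

      -- A walk to the right end would worsen the X cells of the outer part, where D = 0, although
      -- its length is at most W + X < 2 X. Nor is the right end the nearer one: it is at distance
      -- at least X, the free server on the left at distance at most W.
      left-if-none-right : searchUp f (suc r) (Z ∸ suc r) ≡ Z → searchDown f r ≢ 0 → ¬ Rule Z D (moveTo f r true)
      left-if-none-right u≡Z d≢0 rule with searchDown-found f r
      ... | inj₁ d≡0 = contradiction d≡0 d≢0
      ... | inj₂ fd≢0 = refute rule
        where
        d = searchDown f r
        u = searchUp f (suc r) (Z ∸ suc r)
        refute : ¬ Rule Z D (moveTo f r true)
        refute (inj₁ fav) = contradiction
          (linear 6 (λ w b u r x t → 4 · x :≤ b ∷ 1 · 4 :* b :≤ t ∷ 1 · t :+ r :≤ u ∷ 1 · u :≤ x :+ w :+ x ∷ 1 · w :< x ∷ 1 · x :≤ r ∷ [] ⊢ # 0 :< # 0)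
            W (worse Z D (moveTo f r true)) u r X (u ∸ r)
            (≤-trans (≤-reflexive (sym (m+n∸m≡n (X + W) X))) (∑-count-≥ Z (worse? D (moveTo f r true)) (X + W) Z ≤-refl
              (λ z lo hi → (≤-trans (proj₂ r-range) lo , subst (z <_) (sym u≡Z) hi) , subst (ℤ._≤ 0ℤ) (sym (D-zero z hi (inj₂ lo))) ℤₚ.≤-refl)))
            fav (≤-reflexive (m∸n+n≡m (≤-trans (n≤1+n r) (searchUp-≥ f (suc r) (Z ∸ suc r))))) (≤-reflexive u≡Z) W<X (proj₁ r-range))
          (<-irrefl refl)
        refute (inj₂ (near₁ , _)) = contradiction
          (linear 7 (λ u r d x w a b → 1 · a :≤ b ∷ 1 · u :≤ a :+ r ∷ 1 · b :+ d :≤ r ∷ 1 · x :+ w :+ x :≤ u ∷ 2 · r :≤ x :+ w ∷ 1 · w :< x ∷ 1 · x :≤ d ∷ [] ⊢ # 0 :< # 0)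
            u r d X W (u ∸ r) (r ∸ d) near₁
            (≤-trans (m≤n+m∸n u r) (≤-reflexive (+-comm r (u ∸ r))))
            (≤-reflexive (m∸n+n≡m (<⇒≤ (searchDown-< f r>0)))) (≤-reflexive (sym u≡Z)) (proj₂ r-range) W<X (proj₁ (supported d fd≢0)))
          (<-irrefl refl)

      right-free : f r ≡ 0 → Rule Z D (moveTo f r true) → f (searchUp f (suc r) (Z ∸ suc r)) ≢ 0
      right-free fr≡0 rule with searchUp-found f (suc r) (Z ∸ suc r)
      ... | inj₂ h  = h
      ... | inj₁ u≡ = λ _ → left-if-none-right (trans u≡ suc-r+) (λ d≡0 → some-free fr≡0 (d≡0 , trans u≡ suc-r+)) rule

      left-free : f r ≡ 0 → ¬ Rule Z D (moveTo f r true) → f (searchDown f r) ≢ 0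
      left-free fr≡0 ¬rule with searchDown-found f r
      ... | inj₂ h   = h
      ... | inj₁ d≡0 = λ _ → ¬rule (right-if-none-left d≡0 (λ u≡Z → some-free fr≡0 (d≡0 , u≡Z)))

      decide-free : f r ≡ 0 → f (target (decide f D r)) ≢ 0
      decide-free fr≡0 = free (rule? Z D (moveTo f r true))
        where
        free : ∀ (d : Dec (Rule Z D (moveTo f r true))) → f (target (moveTo f r (side d))) ≢ 0
        free (yes p) = right-free fr≡0 p
        free (no ¬p) = left-free fr≡0 ¬p

    shift-balance : ∀ {m} → Wf m → ∀ D z → shift m D z ℤ.+ pos (𝟙 (r m ≤? z)) ≡ D z ℤ.+ pos (𝟙 (target m ≤? z))
    shift-balance {m@(move l r q true)} wf₀ D z with path? m z
    ... | yes (r≤z , z<q) rewrite 𝟙-yes (r ≤? z) r≤z | 𝟙-no (q ≤? z) (<⇒≱ z<q) = pred+1 (D z)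
      where
      pred+1 : ∀ a → (ℤ.-1ℤ ℤ.+ a) ℤ.+ ℤ.1ℤ ≡ a ℤ.+ 0ℤ
      pred+1 = ℤ-Solver.solve-∀
    ... | no ¬p = cong (λ t → D z ℤ.+ pos t) (𝟙-cong (r ≤? z) (q ≤? z) (λ r≤z → ≮⇒≥ (λ z<q → ¬p (r≤z , z<q))) (≤-trans (<⇒≤ (r<q wf₀))))
    shift-balance {m@(move l r q false)} wf₀ D z with path? m z
    ... | yes (l≤z , z<r) rewrite 𝟙-yes (l ≤? z) l≤z | 𝟙-no (r ≤? z) (<⇒≱ z<r) = suc+0 (D z)
      where
      suc+0 : ∀ a → (ℤ.1ℤ ℤ.+ a) ℤ.+ 0ℤ ≡ a ℤ.+ ℤ.1ℤ
      suc+0 = ℤ-Solver.solve-∀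
    ... | no ¬p = cong (λ t → D z ℤ.+ pos t) (𝟙-cong (r ≤? z) (l ≤? z) (≤-trans (<⇒≤ (l<r wf₀))) (λ l≤z → ≮⇒≥ (λ z<r → ¬p (l≤z , z<r))))

    serve-inv : ∀ {f D D′ r rs t} → Inv f D (r ∷ rs) → f t ≢ 0 →
                (∀ z → D′ z ℤ.+ pos (𝟙 (r ≤? z)) ≡ D z ℤ.+ pos (𝟙 (t ≤? z))) → Inv (take f t) D′ rs
    serve-inv {f} {D} {D′} {r} {rs} {t} I ft≢0 h = record
      { balance   = λ z → ℤ-Group.∙-cancelʳ (pos (𝟙 (r ≤? z))) _ _ (begin
          (D′ z ℤ.+ pos (upTo (take f t) z)) ℤ.+ pos (𝟙 (r ≤? z))     ≡⟨ swap (D′ z) (pos (upTo (take f t) z)) (pos (𝟙 (r ≤? z))) ⟩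
          (D′ z ℤ.+ pos (𝟙 (r ≤? z))) ℤ.+ pos (upTo (take f t) z)     ≡⟨ cong (ℤ._+ pos (upTo (take f t) z)) (h z) ⟩
          (D z ℤ.+ pos (𝟙 (t ≤? z))) ℤ.+ pos (upTo (take f t) z)      ≡⟨ swap′ (D z) (pos (𝟙 (t ≤? z))) (pos (upTo (take f t) z)) ⟩
          D z ℤ.+ pos (upTo (take f t) z + 𝟙 (t ≤? z))                ≡⟨ cong (λ c → D z ℤ.+ pos c) (upTo-take f t z ft≢0) ⟩
          D z ℤ.+ pos (upTo f z)                                      ≡⟨ balance z ⟩
          E z ℤ.+ pos (𝟙 (r ≤? z) + requestsUpTo rs z)                ≡⟨ swap″ (E z) (pos (𝟙 (r ≤? z))) (pos (requestsUpTo rs z)) ⟩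
          (E z ℤ.+ pos (requestsUpTo rs z)) ℤ.+ pos (𝟙 (r ≤? z))      ∎)
      ; supported = λ k h → supported k (λ fk≡0 → h (n≤0⇒n≡0 (subst (take f t k ≤_) fk≡0 (take-≤ f t k))))
      ; requests  = All.tail requests
      ; enough    = suc-injective (begin
          suc (∑ Z (take f t))                 ≡⟨ +-comm 1 _ ⟩
          ∑ Z (take f t) + 1                   ≡⟨ cong (∑ Z (take f t) +_) (sym (𝟙-yes (t <? Z) (range<Z (supported t ft≢0)))) ⟩
          ∑ Z (take f t) + 𝟙 (t <? Z)          ≡⟨ ∑-take Z f t ft≢0 ⟩
          ∑ Z f                                ≡⟨ enough ⟩
          suc (length rs)                      ∎)
      }
      where
      open Inv I
      open ≡-Reasoning
      swap : ∀ a b c → (a ℤ.+ b) ℤ.+ c ≡ (a ℤ.+ c) ℤ.+ b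
      swap = ℤ-Solver.solve-∀
      swap′ : ∀ a b c → (a ℤ.+ b) ℤ.+ c ≡ a ℤ.+ (c ℤ.+ b)
      swap′ = ℤ-Solver.solve-∀
      swap″ : ∀ a b c → a ℤ.+ (b ℤ.+ c) ≡ (a ℤ.+ c) ℤ.+ b
      swap″ = ℤ-Solver.solve-∀

    moveTo-wf : ∀ {f D r rs} → Inv f D (r ∷ rs) → ∀ d → Wf (moveTo f r d)
    moveTo-wf {f} {D} {r} I d = wf (searchDown-< f (r>0 I)) (searchUp-≥ f (suc r) (Z ∸ suc r))

    location-free : ∀ {f D r rs} → Inv f D (r ∷ rs) → f (location f D r) ≢ 0
    location-free {f} {D} {r} I with f r ≟ 0
    ... | yes fr≡0 = decide-free I fr≡0
    ... | no fr≢0  = fr≢0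

    location-balance : ∀ {f D r rs} → Inv f D (r ∷ rs) → ∀ z →
                       imbalance f D r z ℤ.+ pos (𝟙 (r ≤? z)) ≡ D z ℤ.+ pos (𝟙 (location f D r ≤? z))
    location-balance {f} {D} {r} I z with f r ≟ 0
    ... | yes _ = shift-balance (moveTo-wf I _) D z
    ... | no _  = refl

    location-inv : ∀ {f D r rs} → Inv f D (r ∷ rs) → Inv (take f (location f D r)) (imbalance f D r) rs
    location-inv I = serve-inv I (location-free I) (location-balance I)

    FreeEnds-mono : ∀ {f f′} → (∀ k → f′ k ≤ f k) → ∀ {m} → FreeEnds f′ m → FreeEnds f m
    FreeEnds-mono {f} {f′} f′≤f (a , b) = weaken a , weaken b
      where
      weaken : ∀ {k c} → k ≡ c ⊎ f′ k ≢ 0 → k ≡ c ⊎ f k ≢ 0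
      weaken (inj₁ e) = inj₁ e
      weaken {k} (inj₂ h) = inj₂ (λ e → h (n≤0⇒n≡0 (subst (f′ k ≤_) e (f′≤f k))))

    moves-ends : ∀ rs {f D} → Inv f D rs → All (FreeEnds f) (moves f D rs)
    moves-ends [] I = []
    moves-ends (r ∷ rs) {f} {D} I with f r ≟ 0
    ... | yes fr≡0 = (searchDown-found f r , subst (λ t → searchUp f (suc r) (Z ∸ suc r) ≡ t ⊎ f (searchUp f (suc r) (Z ∸ suc r)) ≢ 0) (suc-r+ I) (searchUp-found f (suc r) (Z ∸ suc r)))
                     ∷ All.map (λ {m} → FreeEnds-mono (take-≤ f (target (decide f D r))) {m}) (moves-ends rs (serve-inv I (decide-free I fr≡0) (shift-balance (moveTo-wf I _) D)))
    ... | no fr≢0  = All.map (λ {m} → FreeEnds-mono (take-≤ f r) {m}) (moves-ends rs (serve-inv I fr≢0 (λ z → refl)))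

    ends-after : ∀ {f D r rs} → Inv f D (r ∷ rs) → f r ≡ 0 → ∀ d {m′} → FreeEnds f m′ → After (moveTo f r d) m′
    ends-after {f} {D} {r} I fr≡0 d {m′} (a , b) = outside a , outside′ b
      where
      dn = searchDown f r
      up = searchUp f (suc r) (Z ∸ suc r)
      empty : ∀ k → dn < k → k < up → f k ≡ 0
      empty k dn<k k<up with <-cmp k r
      ... | tri< k<r _ _  = searchDown-empty f r dn<k k<r
      ... | tri≈ _ refl _ = fr≡0
      ... | tri> _ _ r<k  = searchUp-empty f (suc r) (Z ∸ suc r) r<k k<up
      split : ∀ k → f k ≢ 0 → k ≤ dn ⊎ up ≤ k
      split k fk≢0 with k ≤? dn | up ≤? k
      ... | yes p | _     = inj₁ p
      ... | no _  | yes p = inj₂ p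
      ... | no p  | no q  = contradiction (empty k (≰⇒> p) (≰⇒> q)) fk≢0
      outside : ∀ {k} → k ≡ 0 ⊎ f k ≢ 0 → k ≤ dn ⊎ up ≤ k
      outside (inj₁ refl) = inj₁ z≤n
      outside {k} (inj₂ h) = split k h
      outside′ : ∀ {k} → k ≡ Z ⊎ f k ≢ 0 → k ≤ dn ⊎ up ≤ k
      outside′ (inj₁ refl) = inj₂ (≤-trans (searchUp-≤ f (suc r) (Z ∸ suc r)) (≤-reflexive (suc-r+ I)))
      outside′ {k} (inj₂ h) = split k h

    -- This is only an inequality because a request served in place leaves no move.
    moves-between : ∀ rs f D {z z′} → z ≤ z′ → requestsUpTo rs z + requestsBetween (moves f D rs) z z′ ≤ requestsUpTo rs z′
    moves-between [] f D z≤z′ = z≤n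
    moves-between (r ∷ rs) f D {z} {z′} z≤z′ with f r ≟ 0
    ... | yes _ = linear 6 (λ a b c u v w → 1 · a :+ b :≤ c ∷ 1 · u :+ v :≤ w ∷ [] ⊢ (a :+ u) :+ (b :+ v) :≤ c :+ w)
        (𝟙 (r ≤? z)) (𝟙 (between? z z′ r)) (𝟙 (r ≤? z′)) (requestsUpTo rs z) _ (requestsUpTo rs z′)
        (one (r ≤? z) (between? z z′ r) (r ≤? z′)) (moves-between rs _ _ z≤z′)
      where
      one : ∀ (d : Dec (r ≤ z)) (e : Dec (Between z z′ r)) (g : Dec (r ≤ z′)) → 𝟙 d + 𝟙 e ≤ 𝟙 g
      one (yes p) (yes (q , _)) g = contradiction p (<⇒≱ q)
      one (yes p) (no _) g = ≤-reflexive (sym (𝟙-yes g (≤-trans p z≤z′)))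
      one (no _) e g = 𝟙-mono e g proj₂
    ... | no _ = linear 5 (λ a c u v w → 1 · a :≤ c ∷ 1 · u :+ v :≤ w ∷ [] ⊢ (a :+ u) :+ v :≤ c :+ w)
        (𝟙 (r ≤? z)) (𝟙 (r ≤? z′)) (requestsUpTo rs z) _ (requestsUpTo rs z′)
        (𝟙-mono (r ≤? z) (r ≤? z′) (λ p → ≤-trans p z≤z′)) (moves-between rs _ _ z≤z′)

    balance-mono : ∀ {d d′ e e′ c N u u′} → d ℤ.+ pos c ≡ e ℤ.+ pos u → d′ ℤ.+ pos c ≡ e′ ℤ.+ pos u′ → u + N ≤ u′ →
                   (d ℤ.- e) ℤ.+ pos N ℤ.≤ d′ ℤ.- e′
    balance-mono {d} {d′} {e} {e′} {c} {N} {u} {u′} p p′ h = begin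
      (d ℤ.- e) ℤ.+ pos N                    ≡⟨ cong (ℤ._+ pos N) (difference {d} {e} p) ⟩
      (pos u ℤ.- pos c) ℤ.+ pos N            ≡⟨ swap (pos u) (ℤ.- pos c) (pos N) ⟩
      (pos u ℤ.+ pos N) ℤ.- pos c            ≤⟨ ℤₚ.+-monoˡ-≤ (ℤ.- pos c) (ℤ.+≤+ h) ⟩
      pos u′ ℤ.- pos c                       ≡⟨ sym (difference {d′} {e′} p′) ⟩
      d′ ℤ.- e′                              ∎
      where
      open ℤₚ.≤-Reasoning
      swap : ∀ a b n → (a ℤ.+ b) ℤ.+ n ≡ (a ℤ.+ n) ℤ.+ b
      swap = ℤ-Solver.solve-∀
      expand : ∀ d e c → d ℤ.- e ≡ (d ℤ.+ c) ℤ.- (e ℤ.+ c)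
      expand = ℤ-Solver.solve-∀
      collapse : ∀ e u c → (e ℤ.+ u) ℤ.- (e ℤ.+ c) ≡ u ℤ.- c
      collapse = ℤ-Solver.solve-∀
      difference : ∀ {d e u} → d ℤ.+ pos c ≡ e ℤ.+ pos u → d ℤ.- e ≡ pos u ℤ.- pos c
      difference {d} {e} {u} p = trans (expand d e (pos c)) (trans (cong (ℤ._- (e ℤ.+ pos c)) p) (collapse e (pos u) (pos c)))

    history : ∀ rs {f D} → Inv f D rs → History Z E D (moves f D rs)
    history [] I = []
    history (r ∷ rs) {f} {D} I = go (f r ≟ 0) refl
      where
      open Inv I
      m = decide f D r
      go : ∀ d → d ≡ (f r ≟ 0) → History Z E D (moves f D (r ∷ rs))
      go d e with f r ≟ 0 | moves-between (r ∷ rs) f D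
      ... | no fr≢0  | _ = history rs (serve-inv I fr≢0 (λ z → refl))
      ... | yes fr≡0 | between = cons (moveTo-wf I _) (≤-trans (searchUp-≤ f (suc r) (Z ∸ suc r)) (≤-reflexive (suc-r+ I))) (decide-rule f D r)
          -- Between the two ends no server is free, so `upTo f` takes the same value at z and z′,
          -- and the balance equations turn the growth of D - E into a number of remaining requests.
          (λ z z′ dn≤z z≤z′ z′<up → balance-mono {D z} {D z′} {E z} {E z′} (balance z)
            (trans (cong (λ c → D z′ ℤ.+ pos c) (sym (upTo-empty f z≤z′ (λ k z<k k≤z′ → empty k (≤-<-trans dn≤z z<k) (≤-<-trans k≤z′ z′<up))))) (balance z′))
            (between z≤z′))
          (All.map (λ {m′} fe → ends-after I fr≡0 (dir m) {m′} (FreeEnds-mono (take-≤ f (target m)) {m′} fe)) (moves-ends rs I′))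
          (history rs I′)
        where
        I′ = serve-inv I (decide-free I fr≡0) (shift-balance (moveTo-wf I _) D)
        empty : ∀ k → searchDown f r < k → k < searchUp f (suc r) (Z ∸ suc r) → f k ≡ 0
        empty k dn<k k<up with <-cmp k r
        ... | tri< k<r _ _  = searchDown-empty f r dn<k k<r
        ... | tri≈ _ refl _ = fr≡0
        ... | tri> _ _ r<k  = searchUp-empty f (suc r) (Z ∸ suc r) r<k k<up

    cost-length : ∀ rs {f D} → Inv f D rs → cost f D rs ≡ total pathLength D (moves f D rs)
    cost-length [] I = refl
    cost-length (r ∷ rs) {f} {D} I with f r ≟ 0
    ... | no fr≢0 = trans (cong (_+ cost (take f r) D rs) (∣n-n∣≡0 r)) (cost-length rs (serve-inv I fr≢0 (λ z → refl)))
    ... | yes fr≡0 = cong₂ _+_ (len-target {decide f D r} (moveTo-wf I _)) (cost-length rs (serve-inv I (decide-free I fr≡0) (shift-balance (moveTo-wf I _) D)))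
      where
      len-target : ∀ {m} → Wf m → ∣ Move.r m - target m ∣ ≡ len m
      len-target {move l r q true}  w = m≤n⇒∣m-n∣≡n∸m (<⇒≤ (r<q w))
      len-target {move l r q false} w = m≤n⇒∣n-m∣≡n∸m (<⇒≤ (l<r w))

    moves-length : ∀ rs f D → length (moves f D rs) ≤ length rs
    moves-length [] f D = z≤n
    moves-length (r ∷ rs) f D with f r ≟ 0
    ... | yes _ = s≤s (moves-length rs _ _)
    ... | no _  = m≤n⇒m≤1+n (moves-length rs _ _)

  -- Following a target configuration

  -- A multiset of locations is given by its counting function z ↦ number of points ≤ z;
  -- the cost of an optimal matching of two multisets is the ℓ¹ distance of their counting functions.
  Count : Set
  Count = ℕ → ℕ

  add : ℕ → Count → Count
  add r U z = U z + 𝟙 (r ≤? z)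

  module _ (Z : ℕ) where

    gap : Count → Count → ℕ
    gap U V = ∑[ z < Z ] ∣ U z - V z ∣

    gap-triangle : ∀ U V W → gap U W ≤ gap U V + gap V W
    gap-triangle U V W = ≤-trans (∑-mono Z (λ z _ → ∣-∣-triangle (U z) (V z) (W z)))
                                 (≤-reflexive (∑-+ Z (λ z → ∣ U z - V z ∣) (λ z → ∣ V z - W z ∣)))

    gap-sym : ∀ U V → gap U V ≡ gap V U
    gap-sym U V = ∑-cong Z (λ z _ → ∣-∣-comm (U z) (V z))

    gap-add : ∀ r U V → gap (add r U) (add r V) ≡ gap U V
    gap-add r U V = ∑-cong Z (λ z _ → trans (cong₂ ∣_-_∣ (+-comm (U z) _) (+-comm (V z) _)) (∣m+n-m+o∣≡∣n-o∣ (𝟙 (r ≤? z)) (U z) (V z)))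

    point-gap : ∀ r t → ∑[ z < Z ] ∣ 𝟙 (r ≤? z) - 𝟙 (t ≤? z) ∣ ≤ ∣ r - t ∣
    point-gap r t with ≤-total r t
    ... | inj₁ r≤t = ≤-trans (∑-mono Z (λ z _ → cell r≤t z)) (≤-trans (∑-count-≤ Z (λ z → (r ≤? z) ×-dec (z <? t)) r t (λ z p → p)) (≤-reflexive (sym (m≤n⇒∣m-n∣≡n∸m r≤t))))
      where
      cell : ∀ {r t} → r ≤ t → ∀ z → ∣ 𝟙 (r ≤? z) - 𝟙 (t ≤? z) ∣ ≤ 𝟙 ((r ≤? z) ×-dec (z <? t))
      cell {r} {t} r≤t z = go (r ≤? z) (t ≤? z) (z <? t)
        where
        go : ∀ (a : Dec (r ≤ z)) (b : Dec (t ≤ z)) (c : Dec (z < t)) → ∣ 𝟙 a - 𝟙 b ∣ ≤ 𝟙 (a ×-dec c)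
        go (yes _) (yes _) c = z≤n
        go (no _) (no _) c = z≤n
        go (no p) (yes q) c = contradiction (≤-trans r≤t q) p
        go (yes _) (no q) (yes _) = ≤-refl
        go (yes _) (no q) (no c) = contradiction (≰⇒> q) c
    ... | inj₂ t≤r = ≤-trans (∑-mono Z (λ z _ → cell t≤r z)) (≤-trans (∑-count-≤ Z (λ z → (t ≤? z) ×-dec (z <? r)) t r (λ z p → p)) (≤-reflexive (sym (m≤n⇒∣n-m∣≡n∸m t≤r))))
      where
      cell : ∀ {r t} → t ≤ r → ∀ z → ∣ 𝟙 (r ≤? z) - 𝟙 (t ≤? z) ∣ ≤ 𝟙 ((t ≤? z) ×-dec (z <? r))
      cell {r} {t} t≤r z = go (t ≤? z) (r ≤? z) (z <? r)
        where
        go : ∀ (a : Dec (t ≤ z)) (b : Dec (r ≤ z)) (c : Dec (z < r)) → ∣ 𝟙 b - 𝟙 a ∣ ≤ 𝟙 (a ×-dec c)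
        go (yes _) (yes _) c = z≤n
        go (no _) (no _) c = z≤n
        go (no p) (yes q) c = contradiction (≤-trans t≤r q) p
        go (yes _) (no q) (yes _) = ≤-refl
        go (yes _) (no q) (no c) = contradiction (≰⇒> q) c

    gap-move : ∀ r t U → gap (add r U) (add t U) ≤ ∣ r - t ∣
    gap-move r t U = ≤-trans (≤-reflexive (∑-cong Z (λ z _ → ∣m+n-m+o∣≡∣n-o∣ (U z) (𝟙 (r ≤? z)) (𝟙 (t ≤? z))))) (point-gap r t)

    gap-serve : ∀ r t U V → gap (add t U) (add r V) ≤ gap U V + ∣ r - t ∣
    gap-serve r t U V = linear 5 (λ a b c d e → 1 · a :≤ b :+ c ∷ 1 · b :≤ d ∷ 1 · c :≤ e ∷ [] ⊢ a :≤ e :+ d)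
      (gap (add t U) (add r V)) (gap (add t U) (add r U)) (gap (add r U) (add r V)) ∣ r - t ∣ (gap U V)
      (gap-triangle (add t U) (add r U) (add r V)) (≤-trans (≤-reflexive (gap-sym (add t U) (add r U))) (gap-move r t U)) (≤-reflexive (gap-add r U V))

    -- Serve r so that the configuration gets closer to Q by the whole distance travelled.
    place : Free → Count → Count → ℕ → ℕ
    place f A Q r with f r ≟ 0 | Q r ≤? A r
    ... | no _  | _     = r
    ... | yes _ | yes _ = searchUp f (suc r) (Z ∸ suc r)
    ... | yes _ | no _  = searchDown f r

    module _ {C Q A : Count} {f : Free} {r top : ℕ}
             (A+f : ∀ z → A z + upTo f z ≡ C z)
             (capacity : ∀ {z z′} → z ≤ z′ → Q z′ + C z ≤ Q z + C z′)
             (Q-zero : Q 0 ≡ 0) (top-size : Q top ≡ suc (A top))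
             (r>0 : 0 < r) (r≤top : r ≤ top) (top<Z : top < Z) where

      private
        up = searchUp f (suc r) (Z ∸ suc r)
        down = searchDown f r

        -- Without free servers on the way, A grows as fast as C, and Q, being part of C, no faster.
        -- So Q - A does not increase: a surplus of A persists to the right, a deficit to the left,
        -- until the next free location.
        advance : ∀ {z z′} → z ≤ z′ → (∀ k → z < k → k ≤ z′ → f k ≡ 0) → Q z′ + A z ≤ Q z + A z′
        advance {z} {z′} z≤z′ empty = linear 8 (λ qz qz′ az az′ cz cz′ fz x → 1 · qz′ :+ cz :≤ qz :+ cz′ ∷ 1 · az :+ fz :≤ cz ∷ 1 · cz′ :≤ az′ :+ fz ∷ [] ⊢ qz′ :+ az :≤ qz :+ az′)
          (Q z) (Q z′) (A z) (A z′) (C z) (C z′) (upTo f z) 0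
          (capacity z≤z′) (≤-reflexive (A+f z)) (≤-reflexive (trans (sym (A+f z′)) (cong (A z′ +_) (upTo-empty f z≤z′ empty))))

        surplus : Q r ≤ A r → ∀ z → r ≤ z → z < up → Q z ≤ A z
        surplus Qr≤Ar z r≤z z<up = linear 4 (λ qr ar qz az → 1 · qz :+ ar :≤ qr :+ az ∷ 1 · qr :≤ ar ∷ [] ⊢ qz :≤ az) (Q r) (A r) (Q z) (A z)
          (advance r≤z (λ k r<k k≤z → searchUp-empty f (suc r) (Z ∸ suc r) r<k (≤-<-trans k≤z z<up))) Qr≤Ar

        deficit : f r ≡ 0 → A r < Q r → ∀ z → down ≤ z → z < r → A z < Q z
        deficit fr≡0 Ar<Qr z d≤z z<r = linear 4 (λ qr ar qz az → 1 · qr :+ az :≤ qz :+ ar ∷ 1 · ar :< qr ∷ [] ⊢ az :< qz) (Q r) (A r) (Q z) (A z)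
          (advance (<⇒≤ z<r) empty) Ar<Qr
          where
          empty : ∀ k → z < k → k ≤ r → f k ≡ 0
          empty k z<k k≤r with k ≟ r
          ... | yes refl = fr≡0
          ... | no k≢r   = searchDown-empty f r (≤-<-trans d≤z z<k) (≤∧≢⇒< k≤r k≢r)

        suc-r+ : suc r + (Z ∸ suc r) ≡ Z
        suc-r+ = m+[n∸m]≡n (≤-<-trans r≤top top<Z)

      -- A surplus cannot persist up to `top`, where Q has one point more than A, and a deficit
      -- cannot persist down to 0, where Q is 0.
      place-free : f (place f A Q r) ≢ 0
      place-free with f r ≟ 0 | Q r ≤? A r
      ... | no fr≢0 | _ = fr≢0
      ... | yes fr≡0 | yes Qr≤Ar with searchUp-found f (suc r) (Z ∸ suc r)
      ...   | inj₂ h  = h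
      ...   | inj₁ u≡ = contradiction (surplus Qr≤Ar top r≤top (subst (top <_) (sym (trans u≡ suc-r+)) top<Z)) (<⇒≱ (≤-reflexive (sym top-size)))
      place-free | yes fr≡0 | no Qr≰Ar with searchDown-found f r
      ...   | inj₂ h  = h
      ...   | inj₁ d≡ = contradiction (subst (A 0 <_) Q-zero (deficit fr≡0 (≰⇒> Qr≰Ar) 0 (≤-reflexive d≡) r>0)) (λ ())

      -- On every cell passed, moving the new point from r to its server changes the count by one in
      -- the direction of Q, because the surplus or the deficit lasts all the way.
      place-gap : ∣ r - place f A Q r ∣ + gap (add (place f A Q r) A) Q ≤ gap (add r A) Q
      place-gap with f r ≟ 0 | Q r ≤? A r
      ... | no fr≢0 | _ = ≤-reflexive (cong (_+ gap (add r A) Q) (∣n-n∣≡0 r))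
      ... | yes fr≡0 | yes Qr≤Ar = ≤-trans (+-monoˡ-≤ (gap (add up A) Q) distance) (≤-trans (≤-reflexive (sym (∑-+ Z (λ z → 𝟙 (moved? z)) _))) (∑-mono Z (λ z _ → cell z (r ≤? z) (up ≤? z) (z <? up))))
        where
        moved? : ∀ z → Dec (r ≤ z × z < up)
        moved? z = (r ≤? z) ×-dec (z <? up)
        r≤up : r ≤ up
        r≤up = ≤-trans (n≤1+n r) (searchUp-≥ f (suc r) (Z ∸ suc r))
        distance : ∣ r - up ∣ ≤ ∑[ z < Z ] 𝟙 (moved? z)
        distance = ≤-trans (≤-reflexive (m≤n⇒∣m-n∣≡n∸m r≤up))
          (∑-count-≥ Z moved? r up (≤-trans (searchUp-≤ f (suc r) (Z ∸ suc r)) (≤-reflexive suc-r+)) (λ z → _,_))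
        cell : ∀ z (a : Dec (r ≤ z)) (b : Dec (up ≤ z)) (c : Dec (z < up)) →
               𝟙 (a ×-dec c) + ∣ A z + 𝟙 b - Q z ∣ ≤ ∣ A z + 𝟙 a - Q z ∣
        cell z (yes r≤z) (yes u≤z) (yes z<u) = contradiction u≤z (<⇒≱ z<u)
        cell z (yes r≤z) (yes u≤z) (no _)    = ≤-refl
        cell z (yes r≤z) (no u≰z)  (no c)    = contradiction (≰⇒> u≰z) c
        cell z (no r≰z)  (yes u≤z) c         = contradiction (≤-trans r≤up u≤z) r≰z
        cell z (no r≰z)  (no u≰z)  c         = ≤-refl
        cell z (yes r≤z) (no u≰z)  (yes z<u) = ≤-reflexive (begin
          suc ∣ A z + 0 - Q z ∣   ≡⟨ cong (λ t → suc ∣ t - Q z ∣) (+-identityʳ (A z)) ⟩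
          suc ∣ A z - Q z ∣       ≡⟨ cong suc (m≤n⇒∣n-m∣≡n∸m (surplus Qr≤Ar z r≤z z<u)) ⟩
          suc (A z ∸ Q z)         ≡⟨ sym (+-∸-assoc 1 (surplus Qr≤Ar z r≤z z<u)) ⟩
          suc (A z) ∸ Q z         ≡⟨ sym (m≤n⇒∣n-m∣≡n∸m (m≤n⇒m≤1+n (surplus Qr≤Ar z r≤z z<u))) ⟩
          ∣ suc (A z) - Q z ∣     ≡⟨ cong (∣_- Q z ∣) (+-comm 1 (A z)) ⟩
          ∣ A z + 1 - Q z ∣       ∎)
          where open ≡-Reasoning
      ... | yes fr≡0 | no Qr≰Ar = ≤-trans (+-monoˡ-≤ (gap (add down A) Q) distance) (≤-trans (≤-reflexive (sym (∑-+ Z (λ z → 𝟙 (moved? z)) _))) (∑-mono Z (λ z _ → cell z (down ≤? z) (r ≤? z) (z <? r))))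
        where
        moved? : ∀ z → Dec (down ≤ z × z < r)
        moved? z = (down ≤? z) ×-dec (z <? r)
        down≤r : down ≤ r
        down≤r = <⇒≤ (searchDown-< f r>0)
        distance : ∣ r - down ∣ ≤ ∑[ z < Z ] 𝟙 (moved? z)
        distance = ≤-trans (≤-reflexive (m≤n⇒∣n-m∣≡n∸m down≤r))
          (∑-count-≥ Z moved? down r (<⇒≤ (≤-<-trans r≤top top<Z)) (λ z → _,_))
        cell : ∀ z (a : Dec (down ≤ z)) (b : Dec (r ≤ z)) (c : Dec (z < r)) →
               𝟙 (a ×-dec c) + ∣ A z + 𝟙 a - Q z ∣ ≤ ∣ A z + 𝟙 b - Q z ∣
        cell z (yes d≤z) (yes r≤z) (yes z<r) = contradiction r≤z (<⇒≱ z<r)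
        cell z (yes d≤z) (yes r≤z) (no _)    = ≤-refl
        cell z (yes d≤z) (no r≰z)  (no c)    = contradiction (≰⇒> r≰z) c
        cell z (no d≰z)  (yes r≤z) c         = contradiction (≤-trans down≤r r≤z) d≰z
        cell z (no d≰z)  (no r≰z)  c         = ≤-refl
        cell z (yes d≤z) (no r≰z)  (yes z<r) = ≤-reflexive (begin
          suc ∣ A z + 1 - Q z ∣   ≡⟨ cong (λ t → suc ∣ t - Q z ∣) (+-comm (A z) 1) ⟩
          suc ∣ suc (A z) - Q z ∣ ≡⟨ cong suc (m≤n⇒∣m-n∣≡n∸m below) ⟩
          suc (Q z ∸ suc (A z))   ≡⟨ sym (+-∸-assoc 1 below) ⟩
          Q z ∸ A z               ≡⟨ sym (m≤n⇒∣m-n∣≡n∸m (<⇒≤ below)) ⟩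
          ∣ A z - Q z ∣           ≡⟨ cong (∣_- Q z ∣) (sym (+-identityʳ (A z))) ⟩
          ∣ A z + 0 - Q z ∣       ∎)
          where
          open ≡-Reasoning
          below : A z < Q z
          below = deficit fr≡0 (≰⇒> Qr≰Ar) z d≤z z<r

  -- Follow one of two target configurations, switching when its cost exceeds four times the other's.
  -- Below, false stands for the predictions and true for the greedy rule.
  record Follow : Set where
    field
      free     : Free
      used     : Count
      cost     : Bool → ℕ
      targetOf : Bool → Count
      leader   : Bool

  nextLeader : (Bool → ℕ) → Bool → Bool
  nextLeader c a with c a ≤? 4 * c (not a)
  ... | yes _ = a
  ... | no _  = not a

  nextLeader-spec : ∀ c l → let a = nextLeader c l in (a ≡ l × c l ≤ 4 * c (not l)) ⊎ (a ≡ not l × 4 * c (not l) < c l)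
  nextLeader-spec c l with c l ≤? 4 * c (not l)
  ... | yes small = inj₁ (refl , small)
  ... | no big    = inj₂ (refl , ≰⇒> big)

  module _ (Z : ℕ) where

    follow : Follow → (Bool → Count) → Bool → ℕ → ℕ
    follow S Q a r = place Z (Follow.free S) (Follow.used S) (Q a) r

    followed : Follow → (Bool → ℕ) → (Bool → Count) → Bool → ℕ → Follow
    followed S c Q a r = record
      { free = take (Follow.free S) t ; used = add t (Follow.used S) ; cost = c ; targetOf = Q ; leader = a }
      where t = follow S Q a r

    -- v is the cost of the leader at the last switch.
    record Tracks (T : ℕ) (R : Count) (S : Follow) : Set where
      open Follow S
      field
        v           : ℕ
        v≤leader    : v ≤ cost leader
        4v≤other    : 4 * v ≤ cost (not leader)
        leader≤     : cost leader ≤ 4 * cost (not leader)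
        potential   : T + gap Z used (targetOf leader) ≤ cost leader + 16 * v
        served      : gap Z used R ≤ T
        targets     : ∀ a → gap Z (targetOf a) R ≤ cost a

      -- The potential and v ≤ cost leader give 17, and the leader costs at most four times as much
      -- as the other: 68 = 4 · 17.
      total≤ : ∀ a → T ≤ 68 * cost a
      total≤ a = go leader a (linear 4 (λ T g c v → 1 · T :+ g :≤ c :+ 16 :* v ∷ 16 · v :≤ c ∷ [] ⊢ T :≤ 17 :* c) T (gap Z used (targetOf leader)) (cost leader) v potential v≤leader) leader≤
        where
        go : ∀ l a → T ≤ 17 * cost l → cost l ≤ 4 * cost (not l) → T ≤ 68 * cost a
        go true  true  h k = linear 2 (λ T c → 1 · T :≤ 17 :* c ∷ [] ⊢ T :≤ 68 :* c) T (cost true) h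
        go true  false h k = linear 3 (λ T c d → 1 · T :≤ 17 :* c ∷ 17 · c :≤ 4 :* d ∷ [] ⊢ T :≤ 68 :* d) T (cost true) (cost false) h k
        go false true  h k = linear 3 (λ T c d → 1 · T :≤ 17 :* c ∷ 17 · c :≤ 4 :* d ∷ [] ⊢ T :≤ 68 :* d) T (cost false) (cost true) h k
        go false false h k = linear 2 (λ T c → 1 · T :≤ 17 :* c ∷ [] ⊢ T :≤ 68 :* c) T (cost false) h

    module _ {T : ℕ} {R : Count} {S : Follow} (ok : Tracks T R S) {c : Bool → ℕ} {Q : Bool → Count} {r : ℕ} where

      open Follow S
      open Tracks ok

      private
        grows : (∀ a → gap Z (add r (targetOf a)) (Q a) + cost a ≤ c a) → ∀ a → cost a ≤ c a
        grows advance a = m+n≤o⇒n≤o _ (advance a)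
        targets′ : (∀ a → gap Z (add r (targetOf a)) (Q a) + cost a ≤ c a) → ∀ a → gap Z (Q a) (add r R) ≤ c a
        targets′ advance a = linear 6 (λ g b k e cl cl′ → 1 · g :≤ b :+ k ∷ 1 · b :+ cl :≤ cl′ ∷ 1 · k :≤ e ∷ 1 · e :≤ cl ∷ [] ⊢ g :≤ cl′)
          (gap Z (Q a) (add r R)) (gap Z (add r (targetOf a)) (Q a)) (gap Z (add r (targetOf a)) (add r R)) (gap Z (targetOf a) R) (cost a) (c a)
          (≤-trans (gap-triangle Z (Q a) (add r (targetOf a)) (add r R)) (≤-reflexive (cong (_+ gap Z (add r (targetOf a)) (add r R)) (gap-sym Z (Q a) (add r (targetOf a))))))
          (advance a) (≤-reflexive (gap-add Z r (targetOf a) R)) (targets a)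

      -- Without a switch, the distance travelled is paid by the gap to the target, which grows by
      -- at most what the target itself pays in this round. At a switch, the gap to the new target
      -- is at most T plus the cost of the new target, since both configurations can be compared
      -- with the requests R.
      tracks-followed : (∀ a → gap Z (add r (targetOf a)) (Q a) + cost a ≤ c a) →
                        ∀ {a} → (a ≡ leader × c leader ≤ 4 * c (not leader)) ⊎ (a ≡ not leader × 4 * c (not leader) < c leader) →
                        ∣ r - follow S Q a r ∣ + gap Z (add (follow S Q a r) used) (Q a) ≤ gap Z (add r used) (Q a) →
                        Tracks (T + ∣ r - follow S Q a r ∣) (add r R) (followed S c Q a r)
      tracks-followed advance (inj₁ (refl , small)) placed = record
        { v = v
        ; v≤leader = ≤-trans v≤leader (grows advance leader)
        ; 4v≤other = ≤-trans 4v≤other (grows advance (not leader))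
        ; leader≤ = small
        ; potential = linear 10 (λ T d g′ h b k g cl cl′ v → 1 · d :+ g′ :≤ h ∷ 1 · h :≤ b :+ k ∷ 1 · k :+ cl :≤ cl′ ∷ 1 · T :+ g :≤ cl :+ 16 :* v ∷ 1 · b :≤ g ∷ [] ⊢ (T :+ d) :+ g′ :≤ cl′ :+ 16 :* v)
            T ∣ r - t₀ ∣ (gap Z (add t₀ used) (Q leader)) (gap Z (add r used) (Q leader)) (gap Z (add r used) (add r (targetOf leader))) (gap Z (add r (targetOf leader)) (Q leader))
            (gap Z used (targetOf leader)) (cost leader) (c leader) v
            placed (gap-triangle Z (add r used) (add r (targetOf leader)) (Q leader)) (advance leader) potential (≤-reflexive (gap-add Z r used (targetOf leader)))
        ; served = ≤-trans (gap-serve Z r t₀ used R) (+-monoˡ-≤ ∣ r - t₀ ∣ served)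
        ; targets = targets′ advance
        }
        where
        t₀ = place Z free used (Q leader) r
      tracks-followed advance (inj₂ (refl , big)) placed = record
        { v = c (not leader)
        ; v≤leader = ≤-refl
        ; 4v≤other = subst (λ a → 4 * c (not leader) ≤ c a) (sym (Boolₚ.not-involutive leader)) (<⇒≤ big)
        ; leader≤ = subst (λ a → c (not leader) ≤ 4 * c a) (sym (Boolₚ.not-involutive leader))
            (linear 2 (λ n l → 1 · 4 :* n :< l ∷ [] ⊢ n :≤ 4 :* l) (c (not leader)) (c leader) big)
        -- Besides its own cost, the new leader has to cover 2 T: once for the past and once for the
        -- gap. By the old invariants 2 T ≤ 2 cl + 32 v ≤ 8 co + 8 co, which is where 16 comes from.
        ; potential = linear 12 (λ T d g′ h b k b₀ cl co v cn g → 1 · d :+ g′ :≤ h ∷ 1 · h :≤ b :+ k ∷ 1 · b :≤ b₀ ∷ 1 · b₀ :≤ T ∷ 1 · k :≤ cn ∷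
              2 · T :+ g :≤ cl :+ 16 :* v ∷ 2 · cl :≤ 4 :* co ∷ 8 · 4 :* v :≤ co ∷ 16 · co :≤ cn ∷ [] ⊢ (T :+ d) :+ g′ :≤ cn :+ 16 :* cn)
            T ∣ r - t₀ ∣ (gap Z (add t₀ used) (Q (not leader))) (gap Z (add r used) (Q (not leader))) (gap Z (add r used) (add r R)) (gap Z (add r R) (Q (not leader)))
            (gap Z used R) (cost leader) (cost (not leader)) v (c (not leader)) (gap Z used (targetOf leader))
            placed (gap-triangle Z (add r used) (add r R) (Q (not leader))) (≤-reflexive (gap-add Z r used R)) served
            (≤-trans (≤-reflexive (gap-sym Z (add r R) (Q (not leader)))) (targets′ advance (not leader)))
            potential leader≤ 4v≤other (grows advance (not leader))
        ; served = ≤-trans (gap-serve Z r t₀ used R) (+-monoˡ-≤ ∣ r - t₀ ∣ served)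
        ; targets = targets′ advance
        }
        where
        t₀ = place Z free used (Q (not leader)) r

  -- Serving online

  module _ {S I O : Set} (f : S → I → S × O) where

    scan : ∀ {n} → S → Vec I n → Vec O n
    scan s []       = []
    scan s (x ∷ xs) = proj₂ (f s x) ∷ scan (proj₁ (f s x)) xs

    scan-causal : ∀ {n} s (xs ys : Vec I n) i → (∀ j → toℕ j ≤ toℕ i → lookup xs j ≡ lookup ys j) →
                  lookup (scan s xs) i ≡ lookup (scan s ys) i
    scan-causal s (x ∷ xs) (y ∷ ys) Fin.zero    h = cong (proj₂ ∘ f s) (h Fin.zero z≤n)
    scan-causal s (x ∷ xs) (y ∷ ys) (Fin.suc i) h with h Fin.zero z≤n
    ... | refl = scan-causal (proj₁ (f s x)) xs ys i (λ j j≤i → h (Fin.suc j) (s≤s j≤i))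

  Legal : ∀ {n} → Free → Vec ℕ n → Set
  Legal f []       = ⊤
  Legal f (t ∷ ts) = f t ≢ 0 × Legal (take f t) ts

  travel : ∀ {n} → Vec ℕ n → Vec ℕ n → ℕ
  travel []       []       = 0
  travel (r ∷ rs) (t ∷ ts) = ∣ r - t ∣ + travel rs ts

  record Online : Set where
    field
      follower    : Follow
      greedyFree  : Free
      greedyState : ℕ → ℤ

  module Serving (X W : ℕ) where

    private
      Z : ℕ
      Z = X + W + X

    open Greedy Z using (location; imbalance)

    module Step (S : Online) (r : ℕ) (p : Count) where

      open Online S
      open Follow follower

      greedyTarget : ℕ
      greedyTarget = location greedyFree greedyState r

      -- Following the predictions costs the distance from the previous prediction together with r
      -- to the new one.
      costs : Bool → ℕ
      costs false = gap Z (add r (targetOf false)) p + cost false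
      costs true  = ∣ r - greedyTarget ∣ + cost true

      targets : Bool → Count
      targets false = p
      targets true  = add greedyTarget (targetOf true)

      chosen : Bool
      chosen = nextLeader costs leader

      result : ℕ
      result = follow Z follower targets chosen r

      next : Online
      next = record { follower = followed Z follower costs targets chosen r
                    ; greedyFree = take greedyFree greedyTarget ; greedyState = imbalance greedyFree greedyState r }

    serve : Online → ℕ × Count → Online × ℕ
    serve S (r , p) = Step.next S r p , Step.result S r p

    initial : Free → Online
    initial f = record { follower = record { free = f ; used = λ _ → 0 ; cost = λ _ → 0 ; targetOf = λ _ _ → 0 ; leader = false }
                       ; greedyFree = f ; greedyState = λ _ → 0ℤ }

    predictionCost : ∀ {n} → Count → Vec (ℕ × Count) n → ℕ
    predictionCost P []             = 0
    predictionCost P ((r , p) ∷ xs) = gap Z (add r P) p + predictionCost p xs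

    module _ (W<X : W < X) (E : ℕ → ℤ) (E-low : ∀ z → z < X → E z ≡ 0ℤ) (E-high : ∀ z → X + W ≤ z → E z ≡ 0ℤ)
             (C : Count) (C-zero : C 0 ≡ 0) where

      open Analysis X W W<X E E-low E-high hiding (Z)

      -- This is required of both targets, the greedy configuration included. The field `capacity`
      -- says that p has no more points in an interval than there are servers, so that p is a part
      -- of the server multiset.
      record Prediction (k : ℕ) (p : Count) : Set where
        field
          p-zero   : p 0 ≡ 0
          p-top    : p (X + W) ≡ suc k
          capacity : ∀ {z z′} → z ≤ z′ → p z′ + C z ≤ p z + C z′

      Predictions : ∀ {n} → ℕ → Vec (ℕ × Count) n → Set
      Predictions k []             = ⊤
      Predictions k ((r , p) ∷ xs) = Prediction k p × Predictions (suc k) xs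

      record Good (S : Online) (T : ℕ) (R : Count) (k : ℕ) (rs : List ℕ) : Set where
        open Online S
        open Follow follower
        field
          used+free   : ∀ z → used z + upTo free z ≡ C z
          used-top    : used (X + W) ≡ k
          support     : ∀ t → free t ≢ 0 → InRange t
          greedy+free : ∀ z → targetOf true z + upTo greedyFree z ≡ C z
          greedy-top  : targetOf true (X + W) ≡ k
          greedy-inv  : Inv greedyFree greedyState rs
          tracks      : Tracks Z T R follower

      upTo-mono : ∀ f {z z′} → z ≤ z′ → upTo f z ≤ upTo f z′
      upTo-mono f {z} {zero} z≤n = ≤-refl
      upTo-mono f {z} {suc z′} z≤ with z ≟ suc z′
      ... | yes refl = ≤-refl
      ... | no z≢    = m≤n⇒m≤o+n (f (suc z′)) (upTo-mono f (s≤s⁻¹ (≤∧≢⇒< z≤ z≢)))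

      add+take : ∀ {U f t} → (∀ z → U z + upTo f z ≡ C z) → f t ≢ 0 → ∀ z → add t U z + upTo (take f t) z ≡ C z
      add+take {U} {f} {t} h ft≢0 z = trans (+-assoc (U z) _ _)
        (trans (cong (U z +_) (trans (+-comm (𝟙 (t ≤? z)) _) (upTo-take f t z ft≢0))) (h z))

      add-top : ∀ {U t k} → U (X + W) ≡ k → InRange t → add t U (X + W) ≡ suc k
      add-top {U} {t} {k} h (_ , t≤) = trans (cong₂ _+_ h (𝟙-yes (t ≤? X + W) t≤)) (+-comm k 1)

      module _ {S T R k r rs p} (G : Good S T R k (r ∷ rs)) (pred : Prediction k p) where

        open Online S
        open Follow follower
        open Good G
        open Step S r p

        private
          greedy-free : greedyFree greedyTarget ≢ 0
          greedy-free = location-free greedy-inv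

          target-prediction : ∀ a → Prediction k (targets a)
          target-prediction false = pred
          target-prediction true  = record
            { p-zero   = n≤0⇒n≡0 (≤-trans (m≤m+n _ _) (≤-reflexive (trans (sum 0) C-zero)))
            ; p-top    = add-top {targetOf true} greedy-top (Inv.supported greedy-inv greedyTarget greedy-free)
            ; capacity = λ {z} {z′} z≤z′ → linear 6 (λ b b′ f f′ c c′ → 1 · c :≤ b :+ f ∷ 1 · f :≤ f′ ∷ 1 · b′ :+ f′ :≤ c′ ∷ [] ⊢ b′ :+ c :≤ b :+ c′)
                (targets true z) (targets true z′) (upTo (take greedyFree greedyTarget) z) (upTo (take greedyFree greedyTarget) z′) (C z) (C z′)
                (≤-reflexive (sym (sum z))) (upTo-mono (take greedyFree greedyTarget) z≤z′) (≤-reflexive (sum z′))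
            }
            where
            sum : ∀ z → targets true z + upTo (take greedyFree greedyTarget) z ≡ C z
            sum = add+take {targetOf true} greedy+free greedy-free

          r-ok : InRange r
          r-ok = r-range greedy-inv

          top<Z : X + W < Z
          top<Z = range<Z (m≤m+n X W , ≤-refl)

          module Place (a : Bool) where
            open Prediction (target-prediction a)
            top-size : targets a (X + W) ≡ suc (used (X + W))
            top-size = trans p-top (cong suc (sym used-top))
            nonempty : free (follow Z follower targets a r) ≢ 0
            nonempty = place-free Z {C} {targets a} {used} {free} used+free capacity p-zero top-size (r>0 greedy-inv) (proj₂ r-ok) top<Z
            closer : ∣ r - follow Z follower targets a r ∣ + gap Z (add (follow Z follower targets a r) used) (targets a) ≤ gap Z (add r used) (targets a)
            closer = place-gap Z {C} {targets a} {used} {free} used+free capacity p-zero top-size (r>0 greedy-inv) (proj₂ r-ok) top<Z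

          advance : ∀ a → gap Z (add r (targetOf a)) (targets a) + cost a ≤ costs a
          advance false = ≤-refl
          advance true  = +-monoˡ-≤ (cost true) (gap-move Z r greedyTarget (targetOf true))

        serve-free : free result ≢ 0
        serve-free = Place.nonempty chosen

        serve-good : Good next (T + ∣ r - result ∣) (add r R) (suc k) rs
        serve-good = record
          { used+free   = add+take {used} used+free serve-free
          ; used-top    = add-top {used} used-top (support result serve-free)
          ; support     = λ t h → support t (λ e → h (n≤0⇒n≡0 (subst (take free result t ≤_) e (take-≤ free result t))))
          ; greedy+free = add+take {targetOf true} greedy+free greedy-free
          ; greedy-top  = add-top {targetOf true} greedy-top (Inv.supported greedy-inv greedyTarget greedy-free)
          ; greedy-inv  = location-inv greedy-inv
          ; tracks      = tracks-followed Z tracks advance (nextLeader-spec costs leader) (Place.closer chosen)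
          }

      -- The cost T already paid and the costs already charged to the targets are carried along, so
      -- that the invariant is evaluated only once, at the end.
      run-good : ∀ {n S T R k} (xs : Vec (ℕ × Count) n) → Good S T R k (toList (Vec.map proj₁ xs)) → Predictions k xs →
                 let ts = scan serve S xs ; F = Online.follower S in
                 Legal (Follow.free F) ts
                 × T + travel (Vec.map proj₁ xs) ts ≤ 68 * (predictionCost (Follow.targetOf F false) xs + Follow.cost F false)
                 × T + travel (Vec.map proj₁ xs) ts ≤ 68 * (Greedy.cost Z (Online.greedyFree S) (Online.greedyState S) (toList (Vec.map proj₁ xs)) + Follow.cost F true)
      run-good {T = T} [] G _ = tt , ≤-trans (≤-reflexive (+-identityʳ T)) (total≤ false) , ≤-trans (≤-reflexive (+-identityʳ T)) (total≤ true)
        where open Tracks (Good.tracks G)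
      run-good {S = S} {T} ((r , p) ∷ xs) G (pred , preds) with run-good xs (serve-good G pred) preds
      ... | legal , by-prediction , by-greedy =
        (serve-free G pred , legal)
        , regroup T ∣ r - Step.result S r p ∣ (travel (Vec.map proj₁ xs) (scan serve (Step.next S r p) xs)) (gap Z (add r (Follow.targetOf (Online.follower S) false)) p) (predictionCost p xs) (Follow.cost (Online.follower S) false) by-prediction
        , regroup T ∣ r - Step.result S r p ∣ (travel (Vec.map proj₁ xs) (scan serve (Step.next S r p) xs)) ∣ r - Step.greedyTarget S r p ∣
            (Greedy.cost Z (Online.greedyFree (Step.next S r p)) (Online.greedyState (Step.next S r p)) (toList (Vec.map proj₁ xs))) (Follow.cost (Online.follower S) true) by-greedy
        where
        regroup : ∀ a b c d e f → a + b + c ≤ 68 * (e + (d + f)) → a + (b + c) ≤ 68 * ((d + e) + f)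
        regroup = linear 6 (λ a b c d e f → 1 · a :+ b :+ c :≤ 68 :* (e :+ (d :+ f)) ∷ [] ⊢ a :+ (b :+ c) :≤ 68 :* ((d :+ e) :+ f))

      initial-good : ∀ {f rs} → (∀ z → upTo f z ≡ C z) → (∀ t → f t ≢ 0 → InRange t) → Inv f (λ _ → 0ℤ) rs →
                     Good (initial f) 0 (λ _ → 0) 0 rs
      initial-good h s inv = record
        { used+free = h ; used-top = refl ; support = s ; greedy+free = h ; greedy-top = refl ; greedy-inv = inv
        ; tracks = record { v = 0 ; v≤leader = z≤n ; 4v≤other = z≤n ; leader≤ = z≤n ; potential = zero-gap ; served = zero-gap ; targets = λ _ → zero-gap } }
        where
        zero-gap : gap Z (λ _ → 0) (λ _ → 0) ≤ 0
        zero-gap = ≤-reflexive (∑-0 Z)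

  -- Sums over servers

  open import Algebra.Properties.Semiring.Sum +-*-semiring using (sum; ∑-distrib-+; ∑-comm; *-distribˡ-sum; *-distribʳ-sum; sum-cong-≗; sum-replicate-zero)

  sum-mono : ∀ {n} {f g : Fin n → ℕ} → (∀ i → f i ≤ g i) → sum f ≤ sum g
  sum-mono {zero}  h = z≤n
  sum-mono {suc n} h = +-mono-≤ (h Fin.zero) (sum-mono (h ∘ Fin.suc))

  sum-0 : ∀ {n} {f : Fin n → ℕ} → (∀ i → f i ≡ 0) → sum f ≡ 0
  sum-0 {n} h = trans (sum-cong-≗ h) (sum-replicate-zero n)

  ∑-sum : ∀ Z {n} (f : Fin n → ℕ → ℕ) → ∑[ z < Z ] sum (λ i → f i z) ≡ sum (λ i → ∑ Z (f i))
  ∑-sum zero    {n} f = sym (sum-0 {n} (λ _ → refl))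
  ∑-sum (suc Z) f = trans (cong (sum (λ i → f i Z) +_) (∑-sum Z f)) (sym (∑-distrib-+ (λ i → f i Z) (λ i → ∑ Z (f i))))

  sum-term : ∀ {n} (f : Fin n → ℕ) i → f i ≤ sum f
  sum-term f Fin.zero    = m≤m+n _ _
  sum-term f (Fin.suc i) = m≤n⇒m≤o+n (f Fin.zero) (sum-term (f ∘ Fin.suc) i)

  sum-≤-single : ∀ {n} b (f : Fin n → ℕ) → (∀ i k → i ≢ k → f i ≢ 0 → f k ≡ 0) → (∀ i → f i ≤ b) → sum f ≤ b
  sum-≤-single {zero}  b f h f≤b = z≤n
  sum-≤-single {suc n} b f h f≤b with f Fin.zero ≟ 0
  ... | yes f0≡0 = ≤-trans (≤-reflexive (cong (_+ sum (f ∘ Fin.suc)) f0≡0))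
        (sum-≤-single b (f ∘ Fin.suc) (λ i k i≢k → h (Fin.suc i) (Fin.suc k) (i≢k ∘ Finₚ.suc-injective)) (f≤b ∘ Fin.suc))
  ... | no f0≢0 = ≤-trans (≤-reflexive (trans (cong (f Fin.zero +_) (sum-0 (λ k → h Fin.zero (Fin.suc k) (λ ()) f0≢0))) (+-identityʳ _))) (f≤b Fin.zero)

  sum-single : ∀ {n} (i : Fin n) (g : Fin n → ℕ) → sum (λ j → 𝟙 (i Finₚ.≟ j) * g j) ≡ g i
  sum-single i g = ≤-antisym
    (sum-≤-single (g i) _ (λ j k j≢k h → cong (_* g k) (𝟙-no (i Finₚ.≟ k) (λ i≡k → h (cong (_* g j) (𝟙-no (i Finₚ.≟ j) (λ i≡j → j≢k (trans (sym i≡j) i≡k)))))))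
      (λ j → bound j (i Finₚ.≟ j)))
    (≤-trans (≤-reflexive (sym (trans (cong (_* g i) (𝟙-yes (i Finₚ.≟ i) refl)) (*-identityˡ (g i))))) (sum-term (λ j → 𝟙 (i Finₚ.≟ j) * g j) i))
    where
    bound : ∀ j (d : Dec (i ≡ j)) → 𝟙 d * g j ≤ g i
    bound j (yes refl) = ≤-reflexive (*-identityˡ (g i))
    bound j (no _)     = z≤n

  -- x and y are the indicators of the source and of the target of a map that is injective on the source.
  sum-injection : ∀ {n k} (m : Fin n → Fin k) (x : Fin n → ℕ) (y : Fin k → ℕ) → (∀ i → x i ≤ y (m i)) →
                  (∀ i j → x i ≢ 0 → x j ≢ 0 → m i ≡ m j → i ≡ j) → ∀ g → sum (λ i → x i * g (m i)) ≤ sum (λ j → y j * g j)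
  sum-injection m x y x≤y inj g = begin
    sum (λ i → x i * g (m i))                                  ≡⟨ sum-cong-≗ (λ i → cong (x i *_) (sym (sum-single (m i) g))) ⟩
    sum (λ i → x i * sum (λ j → 𝟙 (m i Finₚ.≟ j) * g j))       ≡⟨ sum-cong-≗ (λ i → *-distribˡ-sum (x i) (λ j → 𝟙 (m i Finₚ.≟ j) * g j)) ⟩
    sum (λ i → sum (λ j → x i * (𝟙 (m i Finₚ.≟ j) * g j)))     ≡⟨ ∑-comm (λ i j → x i * (𝟙 (m i Finₚ.≟ j) * g j)) ⟩
    sum (λ j → sum (λ i → x i * (𝟙 (m i Finₚ.≟ j) * g j)))     ≡⟨ sum-cong-≗ (λ j → sum-cong-≗ (λ i → sym (*-assoc (x i) (𝟙 (m i Finₚ.≟ j)) (g j)))) ⟩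
    sum (λ j → sum (λ i → x i * 𝟙 (m i Finₚ.≟ j) * g j))       ≡⟨ sum-cong-≗ (λ j → sym (*-distribʳ-sum (g j) (λ i → x i * 𝟙 (m i Finₚ.≟ j)))) ⟩
    sum (λ j → sum (λ i → x i * 𝟙 (m i Finₚ.≟ j)) * g j)       ≤⟨ sum-mono (λ j → *-monoˡ-≤ (g j) (fibre j)) ⟩
    sum (λ j → y j * g j)                                      ∎
    where
    open ≤-Reasoning
    fibre : ∀ j → sum (λ i → x i * 𝟙 (m i Finₚ.≟ j)) ≤ y j
    fibre j = sum-≤-single (y j) (λ i → x i * 𝟙 (m i Finₚ.≟ j)) apart (λ i → below i (m i Finₚ.≟ j))
      where
      below : ∀ i (d : Dec (m i ≡ j)) → x i * 𝟙 d ≤ y j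
      below i (yes e) = ≤-trans (≤-reflexive (*-identityʳ (x i))) (subst (λ k → x i ≤ y k) e (x≤y i))
      below i (no _)  = ≤-trans (≤-reflexive (*-zeroʳ (x i))) z≤n
      apart : ∀ i k → i ≢ k → x i * 𝟙 (m i Finₚ.≟ j) ≢ 0 → x k * 𝟙 (m k Finₚ.≟ j) ≡ 0
      apart i k i≢k h with m i Finₚ.≟ j | m k Finₚ.≟ j | x k ≟ 0
      ... | no _   | _     | _ = contradiction (*-zeroʳ (x i)) h
      ... | yes _  | no _  | _ = *-zeroʳ (x k)
      ... | yes _  | yes _ | yes e = cong (_* 1) e
      ... | yes e₁ | yes e₂ | no xk≢0 = contradiction (inj i k (λ e → h (cong (_* 1) e)) xk≢0 (trans e₁ (sym e₂))) i≢k

  -- Apply `sum-injection` to P and to its complement. The two bounds add up to equal totals, so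
  -- neither can be strict.
  sum-injection-≡ : ∀ {n k} (m : Fin n → Fin k) (x : Fin n → ℕ) (y : Fin k → ℕ) → (∀ i → x i ≤ y (m i)) →
                    (∀ i j → x i ≢ 0 → x j ≢ 0 → m i ≡ m j → i ≡ j) → sum x ≡ sum y →
                    ∀ {P : Fin k → Set} (P? : ∀ j → Dec (P j)) → sum (λ i → x i * 𝟙 (P? (m i))) ≡ sum (λ j → y j * 𝟙 (P? j))
  sum-injection-≡ m x y x≤y inj sizes P? = ≤-antisym (sum-injection m x y x≤y inj (λ j → 𝟙 (P? j)))
    (linear 6 (λ a b c d s t → 1 · c :≤ d ∷ 1 · s :≤ a :+ c ∷ 1 · b :+ d :≤ t ∷ 1 · t :≤ s ∷ [] ⊢ b :≤ a)
      (sum (λ i → x i * 𝟙 (P? (m i)))) (sum (λ j → y j * 𝟙 (P? j))) (sum (λ i → x i * off (m i))) (sum (λ j → y j * off j)) (sum x) (sum y)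
      (sum-injection m x y x≤y inj off)
      (≤-reflexive (parts x (λ i → P? (m i))))
      (≤-reflexive (sym (parts y P?)))
      (≤-reflexive (sym sizes)))
    where
    off : _ → ℕ
    off j = 1 ∸ 𝟙 (P? j)
    parts : ∀ {n} (x : Fin n → ℕ) {Q : Fin n → Set} (Q? : ∀ j → Dec (Q j)) →
            sum x ≡ sum (λ j → x j * 𝟙 (Q? j)) + sum (λ j → x j * (1 ∸ 𝟙 (Q? j)))
    parts x Q? = trans (sum-cong-≗ (λ j → split (x j) (Q? j))) (∑-distrib-+ (λ j → x j * 𝟙 (Q? j)) (λ j → x j * (1 ∸ 𝟙 (Q? j))))
      where
      split : ∀ a {Q : Set} (d : Dec Q) → a ≡ a * 𝟙 d + a * (1 ∸ 𝟙 d)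
      split a (yes _) = sym (trans (cong₂ _+_ (*-identityʳ a) (*-zeroʳ a)) (+-identityʳ a))
      split a (no _)  = sym (cong₂ _+_ (*-zeroʳ a) (*-identityʳ a))

  toBit : Bool → ℕ
  toBit b = if b then 1 else 0

  remove : ∀ {n} → (Fin n → Bool) → Fin n → Fin n → Bool
  remove av j k with k Finₚ.≟ j
  ... | yes _ = false
  ... | no _  = av k

  remove-true : ∀ {n} (av : Fin n → Bool) j k → remove av j k ≡ true → av k ≡ true × k ≢ j
  remove-true av j k h with k Finₚ.≟ j
  ... | no k≢j = h , k≢j

  sum-remove : ∀ {n} (av : Fin n → Bool) j → av j ≡ true → ∀ g →
               sum (λ i → toBit (av i) * g i) ≡ sum (λ i → toBit (remove av j i) * g i) + g j
  sum-remove av j avj g = begin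
    sum (λ i → toBit (av i) * g i)                                          ≡⟨ sum-cong-≗ cell ⟩
    sum (λ i → toBit (remove av j i) * g i + 𝟙 (j Finₚ.≟ i) * g i)          ≡⟨ ∑-distrib-+ (λ i → toBit (remove av j i) * g i) (λ i → 𝟙 (j Finₚ.≟ i) * g i) ⟩
    sum (λ i → toBit (remove av j i) * g i) + sum (λ i → 𝟙 (j Finₚ.≟ i) * g i) ≡⟨ cong (sum (λ i → toBit (remove av j i) * g i) +_) (sum-single j g) ⟩
    sum (λ i → toBit (remove av j i) * g i) + g j                           ∎
    where
    open ≡-Reasoning
    cell : ∀ i → toBit (av i) * g i ≡ toBit (remove av j i) * g i + 𝟙 (j Finₚ.≟ i) * g i
    cell i with i Finₚ.≟ j
    ... | yes refl = cong (_* g i) (trans (cong toBit avj) (sym (𝟙-yes (i Finₚ.≟ i) refl)))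
    ... | no i≢j   = trans (sym (+-identityʳ _)) (cong (toBit (av i) * g i +_) (cong (_* g i) (sym (𝟙-no (j Finₚ.≟ i) (i≢j ∘ sym)))))

  -- From locations back to servers

  module Servers {m : ℕ} (p : Fin (suc m) → ℕ) where

    Available : Set
    Available = Fin (suc m) → Bool

    stock : Available → Free
    stock av k = sum (λ j → toBit (av j) * 𝟙 (p j ≟ k))

    -- Several servers may share a location, so the locations chosen above still have to be turned
    -- into distinct servers. The fallback does not occur at a location with positive stock.
    pick : Available → ℕ → Fin (suc m)
    pick av t with Finₚ.any? (λ j → (av j Boolₚ.≟ true) ×-dec (p j ≟ t))
    ... | yes (j , _) = j
    ... | no _        = Fin.zero

    assignStep : Available → ℕ → Available × Fin (suc m)
    assignStep av t = remove av (pick av t) , pick av t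

    assign : ∀ {n} → Available → Vec ℕ n → Vec (Fin (suc m)) n
    assign = scan assignStep

    pick-spec : ∀ av t → stock av t ≢ 0 → av (pick av t) ≡ true × p (pick av t) ≡ t
    pick-spec av t h with Finₚ.any? (λ j → (av j Boolₚ.≟ true) ×-dec (p j ≟ t))
    ... | yes (j , q) = q
    ... | no none = contradiction (sum-0 empty) h
      where
      empty : ∀ j → toBit (av j) * 𝟙 (p j ≟ t) ≡ 0
      empty j with av j in e | p j ≟ t
      ... | false | _ = refl
      ... | true  | no _ = refl
      ... | true  | yes q = contradiction (j , e , q) none

    stock-remove : ∀ av j → av j ≡ true → ∀ k → stock av k ≡ stock (remove av j) k + 𝟙 (p j ≟ k)
    stock-remove av j avj k = sum-remove av j avj (λ i → 𝟙 (p i ≟ k))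

    record Assigned {n} (av : Available) (ts : Vec ℕ n) (js : Vec (Fin (suc m)) n) : Set where
      field
        at         : ∀ i → p (lookup js i) ≡ lookup ts i
        from       : ∀ i → av (lookup js i) ≡ true
        injective  : ∀ i j → lookup js i ≡ lookup js j → i ≡ j

    assign-legal : ∀ {n} f av (ts : Vec ℕ n) → (∀ k → f k ≡ stock av k) → Legal f ts → Assigned av ts (assign av ts)
    assign-legal f av [] h _ = record { at = λ () ; from = λ () ; injective = λ () }
    assign-legal f av (t ∷ ts) h (ft≢0 , legal) = record { at = at′ ; from = from′ ; injective = injective′ }
      where
      j = pick av t
      spec : av j ≡ true × p j ≡ t
      spec = pick-spec av t (λ e → ft≢0 (trans (h t) e))
      h′ : ∀ k → take f t k ≡ stock (remove av j) k
      h′ k with k ≟ t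
      ... | yes k≡t = cong pred (trans (h k) (trans (stock-remove av j (proj₁ spec) k)
                        (trans (cong (stock (remove av j) k +_) (𝟙-yes (p j ≟ k) (trans (proj₂ spec) (sym k≡t)))) (+-comm _ 1))))
      ... | no k≢t = trans (h k) (trans (stock-remove av j (proj₁ spec) k)
                        (trans (cong (stock (remove av j) k +_) (𝟙-no (p j ≟ k) (λ e → k≢t (trans (sym e) (proj₂ spec))))) (+-identityʳ _)))
      open Assigned (assign-legal (take f t) (remove av j) ts h′ legal)
      at′ : ∀ i → p (lookup (assign av (t ∷ ts)) i) ≡ lookup (t ∷ ts) i
      at′ Fin.zero    = proj₂ spec
      at′ (Fin.suc i) = at i
      from′ : ∀ i → av (lookup (assign av (t ∷ ts)) i) ≡ true
      from′ Fin.zero    = proj₁ spec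
      from′ (Fin.suc i) = proj₁ (remove-true av j _ (from i))
      injective′ : ∀ i k → lookup (assign av (t ∷ ts)) i ≡ lookup (assign av (t ∷ ts)) k → i ≡ k
      injective′ Fin.zero    Fin.zero    e = refl
      injective′ Fin.zero    (Fin.suc k) e = contradiction (sym e) (proj₂ (remove-true av j _ (from k)))
      injective′ (Fin.suc i) Fin.zero    e = contradiction e (proj₂ (remove-true av j _ (from i)))
      injective′ (Fin.suc i) (Fin.suc k) e = cong Fin.suc (injective i k e)

  travel-sum : ∀ {n} (rs ts : Vec ℕ n) → travel rs ts ≡ sum (λ i → ∣ lookup rs i - lookup ts i ∣)
  travel-sum []       []       = refl
  travel-sum (r ∷ rs) (t ∷ ts) = cong (∣ r - t ∣ +_) (travel-sum rs ts)

  -- O counts the offline configuration before the first request of xs, ss the locations it uses from then on.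
  module Errors (Z : ℕ) where

    errors : ∀ {n} → Count → Vec (ℕ × Count) n → Vec ℕ n → ℕ
    errors O []             []       = 0
    errors O ((r , p) ∷ xs) (s ∷ ss) = gap Z (add s O) p + errors (add s O) xs ss

    prefix : ∀ {n} → Count → Vec ℕ n → Fin n → Count
    prefix O (s ∷ ss) Fin.zero    = add s O
    prefix O (s ∷ ss) (Fin.suc i) = prefix (add s O) ss i

    errors-sum : ∀ {n} O (xs : Vec (ℕ × Count) n) (ss : Vec ℕ n) →
                 errors O xs ss ≡ sum (λ i → gap Z (prefix O ss i) (proj₂ (lookup xs i)))
    errors-sum O []       []       = refl
    errors-sum O (x ∷ xs) (s ∷ ss) = cong (gap Z (add s O) (proj₂ x) +_) (errors-sum (add s O) xs ss)

    prefix-sum : ∀ {n} O (ss : Vec ℕ n) i z → prefix O ss i z ≡ O z + sum (λ j → 𝟙 (toℕ j ≤? toℕ i) * 𝟙 (lookup ss j ≤? z))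
    prefix-sum O (s ∷ ss) Fin.zero z = cong (O z +_) (sym (trans (cong₂ _+_ (*-identityˡ _) (sum-0 {_} {λ j → 𝟙 (suc (toℕ j) ≤? 0) * 𝟙 (lookup ss j ≤? z)} (λ j → refl))) (+-identityʳ _)))
    prefix-sum O (s ∷ ss) (Fin.suc i) z = trans (prefix-sum (add s O) ss i z) (trans (+-assoc (O z) _ _) (cong (O z +_)
      (cong₂ _+_ (sym (*-identityˡ _)) (sum-cong-≗ (λ j → cong (_* 𝟙 (lookup ss j ≤? z)) (𝟙-cong (toℕ j ≤? toℕ i) (suc (toℕ j) ≤? suc (toℕ i)) s≤s s≤s⁻¹))))))

  module _ (X W : ℕ) where

    private
      Z : ℕ
      Z = X + W + X

    open Errors Z
    open Serving X W

    -- The distance from the old prediction plus r to the new prediction is at most the old error,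
    -- the offline cost of the round and the new error. Each error thus appears twice, once in its
    -- own round and once in the next.
    prediction-errors : ∀ {n} P O (xs : Vec (ℕ × Count) n) (ss : Vec ℕ n) →
                        predictionCost P xs ≤ gap Z P O + (travel (Vec.map proj₁ xs) ss + 2 * errors O xs ss)
    prediction-errors P O [] [] = z≤n
    prediction-errors P O ((r , p) ∷ xs) (s ∷ ss) =
      combine (gap-triangle Z (add r P) (add r O) p) (gap-triangle Z (add r O) (add s O) p) (≤-reflexive (gap-add Z r P O)) (gap-move Z r s O)
              (prediction-errors p (add s O) xs ss) (≤-reflexive (gap-sym Z p (add s O)))
      where
      combine : ∀ {g a b c e g₀ d k t er g′} → g ≤ a + b → b ≤ c + e → a ≤ g₀ → c ≤ d → k ≤ g′ + (t + 2 * er) → g′ ≤ e →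
                g + k ≤ g₀ + ((d + t) + 2 * (e + er))
      combine {g} {a} {b} {c} {e} {g₀} {d} {k} {t} {er} {g′} = linear 11
        (λ g a b c e g₀ d k t er g′ → 1 · g :≤ a :+ b ∷ 1 · b :≤ c :+ e ∷ 1 · a :≤ g₀ ∷ 1 · c :≤ d ∷ 1 · k :≤ g′ :+ (t :+ 2 :* er) ∷ 1 · g′ :≤ e ∷ []
          ⊢ g :+ k :≤ g₀ :+ ((d :+ t) :+ 2 :* (e :+ er)))
        g a b c e g₀ d k t er g′

  -- Matchings

  ∧-true : ∀ {a b} → a ∧ b ≡ true → a ≡ true × b ≡ true
  ∧-true {true} {true} _ = refl , refl

  allB-sound : ∀ {A : Set} (p : A → Bool) {xs x} → allB p xs ≡ true → x ∈ xs → p x ≡ true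
  allB-sound p {y ∷ xs} h (here refl) = proj₁ (∧-true h)
  allB-sound p {y ∷ xs} h (there x∈)  = allB-sound p (proj₂ (∧-true {p y} h)) x∈

  allB-complete : ∀ {A : Set} (p : A → Bool) xs → (∀ x → p x ≡ true) → allB p xs ≡ true
  allB-complete p []       h = refl
  allB-complete p (x ∷ xs) h = cong₂ _∧_ (h x) (allB-complete p xs h)

  anyB-sound : ∀ {A : Set} (p : A → Bool) xs → anyB p xs ≡ true → ∃ λ x → p x ≡ true
  anyB-sound p (x ∷ xs) h with p x in e
  ... | true  = x , e
  ... | false = anyB-sound p xs h

  anyB-complete : ∀ {A : Set} (p : A → Bool) {xs x} → x ∈ xs → p x ≡ true → anyB p xs ≡ true
  anyB-complete p {y ∷ xs} (here refl) h = cong (_∨ anyB p xs) h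
  anyB-complete p {y ∷ xs} (there x∈)  h = trans (cong (p y ∨_) (anyB-complete p x∈ h)) (Boolₚ.∨-zeroʳ (p y))

  ==-sound : ∀ {n} {i j : Fin n} → (i == j) ≡ true → i ≡ j
  ==-sound {i = i} {j} h with i Finₚ.≟ j
  ... | yes e = e

  ==-refl : ∀ {n} (i : Fin n) → (i == i) ≡ true
  ==-refl i with i Finₚ.≟ i
  ... | yes _ = refl
  ... | no ≢  = contradiction refl ≢

  record Matching {n} (X Y : Fin n → Bool) (m : Fin n → Fin n) : Set where
    constructor matching
    field
      into      : ∀ j → X j ≡ true → Y (m j) ≡ true
      injective : ∀ j k → X j ≡ true → X k ≡ true → m j ≡ m k → j ≡ k

  isMatching-sound : ∀ {n} (X Y : Subset n) m → isMatching X Y m ≡ true → Matching (lookup X) (lookup Y) m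
  isMatching-sound {n} X Y m h = matching into injective
    where
    into : ∀ j → lookup X j ≡ true → lookup Y (m j) ≡ true
    into j Xj = subst (λ b → not b ∨ lookup Y (m j) ≡ true) Xj (allB-sound _ (proj₁ (∧-true h)) (∈-allFin j))
    injective : ∀ j k → lookup X j ≡ true → lookup X k ≡ true → m j ≡ m k → j ≡ k
    injective j k Xj Xk mj≡mk = ==-sound (subst (λ b → not b ∨ (j == k) ≡ true)
      (cong₂ _∧_ Xj (cong₂ _∧_ Xk (trans (cong (m j ==_) (sym mj≡mk)) (==-refl (m j)))))
      (allB-sound _ (allB-sound _ (proj₂ (∧-true {allB (λ j → not (lookup X j) ∨ lookup Y (m j)) (allFin n)} h)) (∈-allFin j)) (∈-allFin k)))

  isMatching-complete : ∀ {n} (X Y : Subset n) m → Matching (lookup X) (lookup Y) m → isMatching X Y m ≡ true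
  isMatching-complete {n} X Y m (matching into injective) =
    cong₂ _∧_ (allB-complete _ (allFin n) into′) (allB-complete _ (allFin n) (λ j → allB-complete _ (allFin n) (injective′ j)))
    where
    into′ : ∀ j → not (lookup X j) ∨ lookup Y (m j) ≡ true
    into′ j with lookup X j in e
    ... | true  = into j e
    ... | false = refl
    injective′ : ∀ j k → not (lookup X j ∧ lookup X k ∧ (m j == m k)) ∨ (j == k) ≡ true
    injective′ j k with lookup X j in ej | lookup X k in ek | m j Finₚ.≟ m k
    ... | false | _     | _     = refl
    ... | true  | false | _     = refl
    ... | true  | true  | no _  = refl
    ... | true  | true  | yes e = trans (cong (j ==_) (sym (injective j k ej ek e))) (==-refl j)

  size-sum : ∀ {n} (X : Subset n) → size X ≡ sum (λ j → toBit (lookup X j))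
  size-sum []          = refl
  size-sum (true ∷ X)  = cong suc (size-sum X)
  size-sum (false ∷ X) = size-sum X

  some-true : ∀ {n} (x : Fin n → Bool) → sum (λ j → toBit (x j)) ≢ 0 → ∃ λ j → x j ≡ true
  some-true {zero}  x h = contradiction refl h
  some-true {suc n} x h with x Fin.zero in e
  ... | true  = Fin.zero , e
  ... | false with some-true (x ∘ Fin.suc) h
  ...   | j , p = Fin.suc j , p

  size-remove : ∀ {n} (x : Fin n → Bool) j → x j ≡ true → ∀ {k} → sum (λ i → toBit (x i)) ≡ suc k →
                sum (λ i → toBit (remove x j i)) ≡ k
  size-remove x j xj {k} h = suc-injective (begin
    suc (sum (λ i → toBit (remove x j i)))        ≡⟨ +-comm 1 _ ⟩
    sum (λ i → toBit (remove x j i)) + 1          ≡⟨ cong (_+ 1) (sym (sum-cong-≗ (λ i → *-identityʳ (toBit (remove x j i))))) ⟩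
    sum (λ i → toBit (remove x j i) * 1) + 1      ≡⟨ sym (sum-remove x j xj (λ _ → 1)) ⟩
    sum (λ i → toBit (x i) * 1)                   ≡⟨ sum-cong-≗ (λ i → *-identityʳ (toBit (x i))) ⟩
    sum (λ i → toBit (x i))                       ≡⟨ h ⟩
    suc k                                         ∎)
    where open ≡-Reasoning

  -- Any pairing will do: remove one element from each set and continue. Its cost is irrelevant, as
  -- it only shows that the minimum in `dist` is over a nonempty list.
  matching-exists : ∀ {n} k (x y : Fin n → Bool) → sum (λ j → toBit (x j)) ≡ k → sum (λ j → toBit (y j)) ≡ k → ∃ (Matching x y)
  matching-exists zero x y hx hy = id , matching (λ j xj → contradiction xj (none j)) (λ j k xj → contradiction xj (none j))
    where
    none : ∀ j → x j ≢ true
    none j xj = contradiction (≤-trans (≤-reflexive (cong toBit (sym xj))) (≤-trans (sum-term (λ j → toBit (x j)) j) (≤-reflexive hx))) (λ ())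
  matching-exists {n} (suc k) x y hx hy
    with some-true x (λ e → contradiction (trans (sym hx) e) (λ ())) | some-true y (λ e → contradiction (trans (sym hy) e) (λ ()))
  ... | a , xa | b , yb with matching-exists k (remove x a) (remove y b) (size-remove x a xa hx) (size-remove y b yb hy)
  ...   | m , matching into injective = m′ , matching into′ injective′
    where
    m′ : Fin n → Fin n
    m′ j with j Finₚ.≟ a
    ... | yes _ = b
    ... | no _  = m j
    keep : ∀ j → j ≢ a → x j ≡ true → remove x a j ≡ true
    keep j j≢a xj with j Finₚ.≟ a
    ... | yes e = contradiction e j≢a
    ... | no _  = xj
    into′ : ∀ j → x j ≡ true → y (m′ j) ≡ true
    into′ j xj with j Finₚ.≟ a
    ... | yes _  = yb
    ... | no j≢a = proj₁ (remove-true y b (m j) (into j (keep j j≢a xj)))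
    injective′ : ∀ i j → x i ≡ true → x j ≡ true → m′ i ≡ m′ j → i ≡ j
    injective′ i j xi xj e with i Finₚ.≟ a | j Finₚ.≟ a
    ... | yes i≡a | yes j≡a = trans i≡a (sym j≡a)
    ... | yes _   | no j≢a  = contradiction (sym e) (proj₂ (remove-true y b (m j) (into j (keep j j≢a xj))))
    ... | no i≢a  | yes _   = contradiction e (proj₂ (remove-true y b (m i) (into i (keep i i≢a xi))))
    ... | no i≢a  | no j≢a  = injective i j (keep i i≢a xi) (keep j j≢a xj) e

  allVecs-complete : ∀ {n k} (v : Vec (Fin n) k) → v ∈ allVecs k
  allVecs-complete []      = here refl
  allVecs-complete {n} {suc k} (i ∷ v) = ∈-concatMap⁺ (λ i → List.map (i ∷_) (allVecs k)) (lose (∈-allFin i) (∈-map⁺ (i ∷_) (allVecs-complete v)))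

  minList-∈ : ∀ {x} xs → x ∈ xs → minList xs ∈ xs
  minList-∈ (x ∷ xs) _ = go x xs
    where
    go : ∀ x xs → List.foldr ℚ._⊓_ x xs ∈ x ∷ xs
    go x []       = here refl
    go x (y ∷ ys) with ℚₚ.⊓-sel y (List.foldr ℚ._⊓_ x ys)
    ... | inj₁ e = there (here e)
    ... | inj₂ e with go x ys
    ...   | here e′   = here (trans e e′)
    ...   | there t   = there (there (subst (_∈ ys) (sym e) t))

  -- As the sizes agree, some candidate exists, so the value of `dist` is the cost of an actual
  -- matching and not the default 0 of `minList`.
  dist-attained : ∀ {n} (s : Fin n → ℚ) (X Y : Subset n) → size X ≡ size Y →
                  ∃ λ m → Matching (lookup X) (lookup Y) m × dist s X Y ≡ matchingCost s X m
  dist-attained {n} s X Y sizes with matching-exists (size X) (lookup X) (lookup Y) (sym (size-sum X)) (trans (sym (size-sum Y)) (sym sizes))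
  ... | m₀ , matching into injective
    with ∈-map⁻ cost (minList-∈ (List.map cost candidates) (∈-map⁺ cost (∈-filter⁺ good? (allVecs-complete (tabulate m₀)) m₀-good)))
    where
    cost = λ v → matchingCost s X (lookup v)
    good? = λ (v : Vec (Fin n) n) → isMatching X Y (lookup v) Boolₚ.≟ true
    candidates = List.filter good? (allVecs n)
    m₀≡ : ∀ j → lookup (tabulate m₀) j ≡ m₀ j
    m₀≡ = lookup∘tabulate m₀
    m₀-good : isMatching X Y (lookup (tabulate m₀)) ≡ true
    m₀-good = isMatching-complete X Y _ (matching (λ j Xj → trans (cong (lookup Y) (m₀≡ j)) (into j Xj))
      (λ j k Xj Xk e → injective j k Xj Xk (trans (sym (m₀≡ j)) (trans e (m₀≡ k)))))
  ... | v , v∈ , e = lookup v , isMatching-sound X Y (lookup v) (proj₂ (∈-filter⁻ (λ v → isMatching X Y (lookup v) Boolₚ.≟ true) {xs = allVecs n} v∈)) , e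

  -- Counting

  sum-const-1 : ∀ n → sum {n} (λ _ → 1) ≡ n
  sum-const-1 zero    = refl
  sum-const-1 (suc n) = cong suc (sum-const-1 n)

  ∣-∣-+ : ∀ a b c d → ∣ a + b - c + d ∣ ≤ ∣ a - c ∣ + ∣ b - d ∣
  ∣-∣-+ a b c d = begin
    ∣ a + b - c + d ∣                         ≤⟨ ∣-∣-triangle (a + b) (c + b) (c + d) ⟩
    ∣ a + b - c + b ∣ + ∣ c + b - c + d ∣     ≡⟨ cong₂ _+_ (trans (cong₂ ∣_-_∣ (+-comm a b) (+-comm c b)) (∣m+n-m+o∣≡∣n-o∣ b a c)) (∣m+n-m+o∣≡∣n-o∣ c b d) ⟩
    ∣ a - c ∣ + ∣ b - d ∣                     ∎
    where open ≤-Reasoning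

  sum-∣-∣ : ∀ {n} (f g : Fin n → ℕ) → ∣ sum f - sum g ∣ ≤ sum (λ i → ∣ f i - g i ∣)
  sum-∣-∣ {zero}  f g = z≤n
  sum-∣-∣ {suc n} f g = ≤-trans (∣-∣-+ (f Fin.zero) _ (g Fin.zero) _) (+-monoʳ-≤ ∣ f Fin.zero - g Fin.zero ∣ (sum-∣-∣ (f ∘ Fin.suc) (g ∘ Fin.suc)))

  ∑-sum-gap : ∀ Z {n} (w : Fin n → ℕ) (a b : Fin n → ℕ) →
              ∑[ z < Z ] ∣ sum (λ i → w i * 𝟙 (a i ≤? z)) - sum (λ i → w i * 𝟙 (b i ≤? z)) ∣ ≤ sum (λ i → w i * ∣ a i - b i ∣)
  ∑-sum-gap Z w a b = begin
    ∑[ z < Z ] ∣ sum (λ i → w i * 𝟙 (a i ≤? z)) - sum (λ i → w i * 𝟙 (b i ≤? z)) ∣   ≤⟨ ∑-mono Z (λ z _ → sum-∣-∣ (λ i → w i * 𝟙 (a i ≤? z)) (λ i → w i * 𝟙 (b i ≤? z))) ⟩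
    ∑[ z < Z ] sum (λ i → ∣ w i * 𝟙 (a i ≤? z) - w i * 𝟙 (b i ≤? z) ∣)               ≡⟨ ∑-sum Z (λ i z → ∣ w i * 𝟙 (a i ≤? z) - w i * 𝟙 (b i ≤? z) ∣) ⟩
    sum (λ i → ∑[ z < Z ] ∣ w i * 𝟙 (a i ≤? z) - w i * 𝟙 (b i ≤? z) ∣)               ≤⟨ sum-mono row ⟩
    sum (λ i → w i * ∣ a i - b i ∣)                                                  ∎
    where
    open ≤-Reasoning
    row : ∀ i → ∑[ z < Z ] ∣ w i * 𝟙 (a i ≤? z) - w i * 𝟙 (b i ≤? z) ∣ ≤ w i * ∣ a i - b i ∣
    row i = begin
      ∑[ z < Z ] ∣ w i * 𝟙 (a i ≤? z) - w i * 𝟙 (b i ≤? z) ∣  ≡⟨ ∑-cong Z (λ z _ → sym (*-distribˡ-∣-∣ (w i) (𝟙 (a i ≤? z)) (𝟙 (b i ≤? z)))) ⟩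
      ∑[ z < Z ] (w i * ∣ 𝟙 (a i ≤? z) - 𝟙 (b i ≤? z) ∣)      ≡⟨ ∑-* Z (w i) (λ z → ∣ 𝟙 (a i ≤? z) - 𝟙 (b i ≤? z) ∣) ⟩
      w i * ∑[ z < Z ] ∣ 𝟙 (a i ≤? z) - 𝟙 (b i ≤? z) ∣        ≤⟨ *-monoʳ-≤ (w i) (point-gap Z (a i) (b i)) ⟩
      w i * ∣ a i - b i ∣                                     ∎

  ∑-point : ∀ n a → ∑[ k < n ] 𝟙 (a ≟ k) ≡ 𝟙 (a <? n)
  ∑-point zero    a = sym (𝟙-no (a <? 0) (λ ()))
  ∑-point (suc n) a with a ≟ n
  ... | yes refl = trans (cong suc (trans (∑-point n a) (𝟙-no (a <? a) (<-irrefl refl)))) (sym (𝟙-yes (a <? suc a) ≤-refl))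
  ... | no a≢n   = trans (∑-point n a) (𝟙-cong (a <? n) (a <? suc n) m<n⇒m<1+n (λ a<1+n → ≤∧≢⇒< (s≤s⁻¹ a<1+n) a≢n))

  log-bound : ∀ n → 128 * n ≤ 2 ^ (7 + suc ⌊log₂ n ⌋)
  log-bound n = ≤-trans (*-monoʳ-≤ 128 (<⇒≤ (≰⇒> too-big))) (≤-reflexive (sym (^-distribˡ-+-* 2 7 (suc ⌊log₂ n ⌋))))
    where
    too-big : ¬ (2 ^ suc ⌊log₂ n ⌋ ≤ n)
    too-big h = <-irrefl refl (≤-trans (≤-reflexive (sym (⌊log₂[2^n]⌋≡n (suc ⌊log₂ n ⌋)))) (⌊log₂⌋-mono-≤ h))

  requestsUpTo-sum : ∀ {n} (rs : Vec ℕ n) z → requestsUpTo (toList rs) z ≡ sum (λ i → 𝟙 (lookup rs i ≤? z))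
  requestsUpTo-sum []       z = refl
  requestsUpTo-sum (r ∷ rs) z = cong (𝟙 (r ≤? z) +_) (requestsUpTo-sum rs z)

  toList-All : ∀ {n} {P : ℕ → Set} (rs : Vec ℕ n) → (∀ i → P (lookup rs i)) → All P (toList rs)
  toList-All []       h = []
  toList-All (r ∷ rs) h = h Fin.zero ∷ toList-All rs (h ∘ Fin.suc)

  sum-initial : ∀ {n} (i : Fin n) → sum {n} (λ j → 𝟙 (toℕ j ≤? toℕ i)) ≡ suc (toℕ i)
  sum-initial {suc n} Fin.zero    = cong suc (sum-0 {n} {λ j → 𝟙 (suc (toℕ j) ≤? 0)} (λ j → refl))
  sum-initial {suc n} (Fin.suc i) = cong suc (trans (sum-cong-≗ {n} (λ j → 𝟙-cong (suc (toℕ j) ≤? suc (toℕ i)) (toℕ j ≤? toℕ i) s≤s⁻¹ s≤s)) (sum-initial i))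

  offConfig-sound : ∀ {n} (σ : Fin n → Fin n) i t → lookup (offConfig σ i) t ≡ true → ∃ λ j → toℕ j ≤ toℕ i × σ j ≡ t
  offConfig-sound {n} σ i t h with anyB-sound _ (allFin n) (trans (sym (lookup∘tabulate _ t)) h)
  ... | j , p with ∧-true {⌊ toℕ j ≤? toℕ i ⌋} p
  ...   | a , b with toℕ j ≤? toℕ i
  ...     | yes j≤i = j , j≤i , ==-sound b

  offConfig-complete : ∀ {n} (σ : Fin n → Fin n) i j → toℕ j ≤ toℕ i → lookup (offConfig σ i) (σ j) ≡ true
  offConfig-complete {n} σ i j j≤i = trans (lookup∘tabulate _ (σ j)) (anyB-complete _ (∈-allFin j) (cong₂ _∧_ decided (==-refl (σ j))))
    where
    decided : ⌊ toℕ j ≤? toℕ i ⌋ ≡ true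
    decided with toℕ j ≤? toℕ i
    ... | yes _ = refl
    ... | no ¬p = contradiction j≤i ¬p

  module Locations {n : ℕ} (p : Fin n → ℕ) where

    countOf : Subset n → Count
    countOf Y z = sum (λ j → toBit (lookup Y j) * 𝟙 (p j ≤? z))

    -- The map σ sends the rounds up to i bijectively onto the configuration: one inequality is
    -- injectivity, the other holds because every server in the configuration has a preimage.
    offConfig-sum : ∀ (σ : Fin n → Fin n) → (∀ i j → σ i ≡ σ j → i ≡ j) → ∀ i {P : Fin n → Set} (P? : ∀ t → Dec (P t)) →
                    sum (λ j → 𝟙 (toℕ j ≤? toℕ i) * 𝟙 (P? (σ j))) ≡ sum (λ t → toBit (lookup (offConfig σ i) t) * 𝟙 (P? t))
    offConfig-sum σ inj i {P} P? = ≤-antisym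
      (sum-injection σ x y (λ j → x≤y j (toℕ j ≤? toℕ i)) (λ j k _ _ → inj j k) g)
      (begin
        sum (λ t → y t * g t)                                    ≤⟨ sum-mono (λ t → *-monoˡ-≤ (g t) (y≤ t)) ⟩
        sum (λ t → sum (λ j → 𝟙 (σ j Finₚ.≟ t) * x j) * g t)     ≡⟨ sum-cong-≗ (λ t → *-distribʳ-sum (g t) (λ j → 𝟙 (σ j Finₚ.≟ t) * x j)) ⟩
        sum (λ t → sum (λ j → 𝟙 (σ j Finₚ.≟ t) * x j * g t))     ≡⟨ ∑-comm (λ t j → 𝟙 (σ j Finₚ.≟ t) * x j * g t) ⟩
        sum (λ j → sum (λ t → 𝟙 (σ j Finₚ.≟ t) * x j * g t))     ≡⟨ sum-cong-≗ (λ j → sum-cong-≗ (λ t → *-assoc (𝟙 (σ j Finₚ.≟ t)) (x j) (g t))) ⟩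
        sum (λ j → sum (λ t → 𝟙 (σ j Finₚ.≟ t) * (x j * g t)))   ≡⟨ sum-cong-≗ (λ j → sum-single (σ j) (λ t → x j * g t)) ⟩
        sum (λ j → x j * g (σ j))                                ∎)
      where
      open ≤-Reasoning
      x : Fin n → ℕ
      x j = 𝟙 (toℕ j ≤? toℕ i)
      y g : Fin n → ℕ
      y t = toBit (lookup (offConfig σ i) t)
      g t = 𝟙 (P? t)
      x≤y : ∀ j (d : Dec (toℕ j ≤ toℕ i)) → 𝟙 d ≤ y (σ j)
      x≤y j (yes j≤i) = ≤-reflexive (cong toBit (sym (offConfig-complete σ i j j≤i)))
      x≤y j (no _)    = z≤n
      y≤ : ∀ t → y t ≤ sum (λ j → 𝟙 (σ j Finₚ.≟ t) * x j)
      y≤ t with lookup (offConfig σ i) t in e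
      ... | false = z≤n
      ... | true with offConfig-sound σ i t e
      ...   | j , j≤i , σj≡t = ≤-trans (≤-reflexive (sym (cong₂ _*_ (𝟙-yes (σ j Finₚ.≟ t) σj≡t) (𝟙-yes (toℕ j ≤? toℕ i) j≤i))))
                                       (sum-term (λ j → 𝟙 (σ j Finₚ.≟ t) * x j) j)

    offConfig-size : ∀ (σ : Fin n → Fin n) → (∀ i j → σ i ≡ σ j → i ≡ j) → ∀ i → size (offConfig σ i) ≡ suc (toℕ i)
    offConfig-size σ inj i = begin
      size (offConfig σ i)                                               ≡⟨ size-sum (offConfig σ i) ⟩
      sum (λ t → toBit (lookup (offConfig σ i) t))                       ≡⟨ sum-cong-≗ {n} (λ t → sym (*-identityʳ (toBit (lookup (offConfig σ i) t)))) ⟩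
      sum (λ t → toBit (lookup (offConfig σ i) t) * 𝟙 (0 ≤? toℕ t))      ≡⟨ sym (offConfig-sum σ inj i (λ t → 0 ≤? toℕ t)) ⟩
      sum (λ j → 𝟙 (toℕ j ≤? toℕ i) * 𝟙 (0 ≤? toℕ (σ j)))                ≡⟨ sum-cong-≗ {n} (λ j → *-identityʳ (𝟙 (toℕ j ≤? toℕ i))) ⟩
      sum {n} (λ j → 𝟙 (toℕ j ≤? toℕ i))                                 ≡⟨ sum-initial i ⟩
      suc (toℕ i)                                                        ∎
      where open ≡-Reasoning

    -- As the sizes agree, the images of X fill Y, so the two counting functions differ by the sum
    -- of the shifts of single points. Each shift contributes at most the distance of its pair.
    matching-gap : ∀ Z (X Y : Subset n) m → Matching (lookup X) (lookup Y) m → size X ≡ size Y →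
                   gap Z (countOf Y) (countOf X) ≤ sum (λ j → toBit (lookup X j) * ∣ p j - p (m j) ∣)
    matching-gap Z X Y m (matching into injective) sizes = begin
      gap Z (countOf Y) (countOf X)                                                ≡⟨ gap-sym Z (countOf Y) (countOf X) ⟩
      gap Z (countOf X) (countOf Y)                                                ≡⟨ ∑-cong Z (λ z _ → cong (∣ countOf X z -_∣) (sym (images z))) ⟩
      ∑[ z < Z ] ∣ countOf X z - sum (λ j → toBit (lookup X j) * 𝟙 (p (m j) ≤? z)) ∣ ≤⟨ ∑-sum-gap Z (λ j → toBit (lookup X j)) p (p ∘ m) ⟩
      sum (λ j → toBit (lookup X j) * ∣ p j - p (m j) ∣)                           ∎
      where
      open ≤-Reasoning
      bit : ∀ {b} → toBit b ≢ 0 → b ≡ true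
      bit {true}  _ = refl
      bit {false} h = contradiction refl h
      into′ : ∀ j → toBit (lookup X j) ≤ toBit (lookup Y (m j))
      into′ j with lookup X j in e
      ... | true  = ≤-reflexive (cong toBit (sym (into j e)))
      ... | false = z≤n
      images : ∀ z → sum (λ j → toBit (lookup X j) * 𝟙 (p (m j) ≤? z)) ≡ countOf Y z
      images z = sum-injection-≡ m (λ j → toBit (lookup X j)) (λ j → toBit (lookup Y j)) into′
        (λ j k hj hk → injective j k (bit hj) (bit hk)) (trans (sym (size-sum X)) (trans sizes (size-sum Y))) (λ t → p t ≤? z)

  -- Instances

  ∣pos-pos∣ : ∀ a b → ℤ.∣ pos a ℤ.- pos b ∣ ≡ ∣ a - b ∣
  ∣pos-pos∣ a b = trans (cong ℤ.∣_∣ (ℤₚ.[+m]-[+n]≡m⊖n a b)) (∣⊖∣ a b)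
    where
    ∣⊖∣ : ∀ a b → ℤ.∣ a ℤ.⊖ b ∣ ≡ ∣ a - b ∣
    ∣⊖∣ a b with ≤-total a b
    ... | inj₁ a≤b = trans (ℤₚ.∣⊖∣-≤ a≤b) (sym (m≤n⇒∣m-n∣≡n∸m a≤b))
    ... | inj₂ b≤a = trans (cong ℤ.∣_∣ (ℤₚ.⊖-≥ b≤a)) (sym (m≤n⇒∣n-m∣≡n∸m b≤a))

  module Instance {m : ℕ} (p : Fin (suc m) → ℕ) (X W : ℕ) (W<X : W < X) (p-range : ∀ j → X ≤ p j × p j ≤ X + W) where

    private
      n Z : ℕ
      n = suc m
      Z = X + W + X

    open Servers p
    open Serving X W
    open Locations p
    open Errors Z

    stocked : Free
    stocked = stock (λ _ → true)

    input : (Fin n → Fin n) → (Fin n → Subset n) → Vec (ℕ × Count) n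
    input ρ P = tabulate (λ i → p (ρ i) , countOf (P i))

    places : (Fin n → Fin n) → (Fin n → Subset n) → Vec ℕ n
    places ρ P = scan serve (initial stocked) (input ρ P)

    answers : (Fin n → Fin n) → (Fin n → Subset n) → Vec (Fin n) n
    answers ρ P = assign (λ _ → true) (places ρ P)

    module Bounds (ρ : Fin n → Fin n) (P : Fin n → Subset n) (valid : ValidPredictions P) where

      private
        xs : Vec (ℕ × Count) n
        xs = input ρ P

        rs : Vec ℕ n
        rs = Vec.map proj₁ xs

        rs-lookup : ∀ i → lookup rs i ≡ p (ρ i)
        rs-lookup i = trans (lookup-map i proj₁ xs) (cong proj₁ (lookup∘tabulate (λ i → p (ρ i) , countOf (P i)) i))

        -- The factor 1 makes this an instance of the weighted sums to which `∑-sum-gap` and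
        -- `sum-injection-≡` apply.
        C : Count
        C z = sum (λ j → 1 * 𝟙 (p j ≤? z))

        R : Count
        R z = sum (λ i → 1 * 𝟙 (p (ρ i) ≤? z))

        R≡ : ∀ z → requestsUpTo (toList rs) z ≡ R z
        R≡ z = trans (requestsUpTo-sum rs z) (sum-cong-≗ (λ i → trans (cong (λ t → 𝟙 (t ≤? z)) (rs-lookup i)) (sym (*-identityˡ _))))

        E : ℕ → ℤ
        E z = pos (C z) ℤ.- pos (R z)

        ∣E∣ : ∀ z → ℤ.∣ E z ∣ ≡ ∣ C z - R z ∣
        ∣E∣ z = ∣pos-pos∣ (C z) (R z)

        count-low : ∀ {k} (w a : Fin k → ℕ) z → z < X → (∀ i → X ≤ a i) → sum (λ i → w i * 𝟙 (a i ≤? z)) ≡ 0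
        count-low w a z z<X h = sum-0 (λ i → trans (cong (w i *_) (𝟙-no (a i ≤? z) (λ a≤z → <-irrefl refl (<-≤-trans z<X (≤-trans (h i) a≤z))))) (*-zeroʳ (w i)))

        count-high : ∀ {k} (w a : Fin k → ℕ) z → X + W ≤ z → (∀ i → a i ≤ X + W) → sum (λ i → w i * 𝟙 (a i ≤? z)) ≡ sum w
        count-high w a z h below = sum-cong-≗ (λ i → trans (cong (w i *_) (𝟙-yes (a i ≤? z) (≤-trans (below i) h))) (*-identityʳ (w i)))

        E-low : ∀ z → z < X → E z ≡ 0ℤ
        E-low z z<X = cong₂ (λ a b → pos a ℤ.- pos b) (count-low (λ _ → 1) p z z<X (proj₁ ∘ p-range)) (count-low (λ _ → 1) (p ∘ ρ) z z<X (λ i → proj₁ (p-range (ρ i))))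

        E-high : ∀ z → X + W ≤ z → E z ≡ 0ℤ
        E-high z h = trans (cong₂ (λ a b → pos a ℤ.- pos b) (count-high (λ _ → 1) p z h (proj₂ ∘ p-range)) (count-high (λ _ → 1) (p ∘ ρ) z h (λ i → proj₂ (p-range (ρ i)))))
                           (ℤₚ.+-inverseʳ (pos (sum {n} (λ _ → 1))))

        C-zero : C 0 ≡ 0
        C-zero = count-low (λ _ → 1) p 0 (≤-<-trans z≤n W<X) (proj₁ ∘ p-range)

        open Analysis X W W<X E E-low E-high hiding (Z)

        stocked-sum : ∀ k → ∑ k stocked ≡ sum (λ j → 1 * 𝟙 (p j <? k))
        stocked-sum k = trans (∑-sum k (λ j i → 1 * 𝟙 (p j ≟ i))) (sum-cong-≗ (λ j → trans (∑-* k 1 (λ i → 𝟙 (p j ≟ i))) (cong (1 *_) (∑-point k (p j)))))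

        stocked-upTo : ∀ z → upTo stocked z ≡ C z
        stocked-upTo z = trans (stocked-sum (suc z)) (sum-cong-≗ (λ j → cong (1 *_) (𝟙-cong (p j <? suc z) (p j ≤? z) s≤s⁻¹ s≤s)))

        stocked-range : ∀ t → stocked t ≢ 0 → InRange t
        stocked-range t h with pick-spec (λ _ → true) t h
        ... | _ , e = subst (λ k → X ≤ k × k ≤ X + W) e (p-range (pick (λ _ → true) t))

        inv : Inv stocked (λ _ → 0ℤ) (toList rs)
        inv = record
          { balance   = λ z → trans (ℤₚ.+-identityˡ _) (trans (cong pos (stocked-upTo z)) (trans (rearrange (pos (C z)) (pos (R z))) (cong (λ t → E z ℤ.+ pos t) (sym (R≡ z)))))
          ; supported = stocked-range
          ; requests  = toList-All rs (λ i → subst InRange (sym (rs-lookup i)) (p-range (ρ i)))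
          ; enough    = trans (stocked-sum Z) (trans (sum-cong-≗ (λ j → cong (1 *_) (𝟙-yes (p j <? Z) (range<Z (p-range j)))))
                          (trans (sum-const-1 n) (sym (length-toList rs))))
          }
          where
          rearrange : ∀ c r → c ≡ (c ℤ.- r) ℤ.+ r
          rearrange = ℤ-Solver.solve-∀

        prediction : ∀ i → Prediction W<X E E-low E-high C C-zero (toℕ i) (countOf (P i))
        prediction i = record
          { p-zero   = count-low (λ j → toBit (lookup (P i) j)) p 0 (≤-<-trans z≤n W<X) (proj₁ ∘ p-range)
          ; p-top    = trans (count-high (λ j → toBit (lookup (P i) j)) p (X + W) ≤-refl (proj₂ ∘ p-range)) (trans (sym (size-sum (P i))) (valid i))
          ; capacity = λ {z} {z′} z≤z′ → subst₂ _≤_ (∑-distrib-+ (λ j → bit j * at z′ j) (λ j → 1 * at z j)) (∑-distrib-+ (λ j → bit j * at z j) (λ j → 1 * at z′ j))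
              (sum-mono (λ j → exchange (lookup (P i) j) (𝟙-mono (p j ≤? z) (p j ≤? z′) (λ h → ≤-trans h z≤z′))))
          }
          where
          bit : Fin n → ℕ
          bit j = toBit (lookup (P i) j)
          at : ℕ → Fin n → ℕ
          at z j = 𝟙 (p j ≤? z)
          exchange : ∀ b {x y} → x ≤ y → toBit b * y + 1 * x ≤ toBit b * x + 1 * y
          exchange true  {x} {y} _ = ≤-reflexive (+-comm (1 * y) (1 * x))
          exchange false {x} {y} h = *-monoʳ-≤ 1 h

        predictions : ∀ {k} j (g : Fin k → ℕ × Count) → (∀ i → Prediction W<X E E-low E-high C C-zero (j + toℕ i) (proj₂ (g i))) →
                      Predictions W<X E E-low E-high C C-zero j (tabulate g)
        predictions {zero}  j g h = tt
        predictions {suc k} j g h = subst (λ t → Prediction W<X E E-low E-high C C-zero t (proj₂ (g Fin.zero))) (+-identityʳ j) (h Fin.zero)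
          , predictions (suc j) (g ∘ Fin.suc) (λ i → subst (λ t → Prediction W<X E E-low E-high C C-zero t (proj₂ (g (Fin.suc i)))) (+-suc j (toℕ i)) (h (Fin.suc i)))

        good : Legal stocked (places ρ P)
               × travel rs (places ρ P) ≤ 68 * (predictionCost (λ _ → 0) xs + 0)
               × travel rs (places ρ P) ≤ 68 * (Greedy.cost Z stocked (λ _ → 0ℤ) (toList rs) + 0)
        good = run-good W<X E E-low E-high C C-zero {n} {initial stocked} {0} {λ _ → 0} {0} xs (initial-good W<X E E-low E-high C C-zero stocked-upTo stocked-range inv)
                 (predictions 0 (λ i → p (ρ i) , countOf (P i)) prediction)

        assigned : Assigned (λ _ → true) (places ρ P) (answers ρ P)
        assigned = assign-legal stocked (λ _ → true) (places ρ P) (λ _ → refl) (proj₁ good)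

      answers-injective : ∀ i j → lookup (answers ρ P) i ≡ lookup (answers ρ P) j → i ≡ j
      answers-injective = Assigned.injective assigned

      expense : ℕ
      expense = sum (λ i → ∣ p (ρ i) - p (lookup (answers ρ P) i) ∣)

      private
        expense≡ : expense ≡ travel rs (places ρ P)
        expense≡ = trans (sum-cong-≗ (λ i → cong₂ ∣_-_∣ (sym (rs-lookup i)) (Assigned.at assigned i))) (sym (travel-sum rs (places ρ P)))

      module _ (σ : Fin n → Fin n) (σ-injective : ∀ i j → σ i ≡ σ j → i ≡ j) where

        offline : ℕ
        offline = sum (λ i → ∣ p (ρ i) - p (σ i) ∣)

        deviation : ℕ
        deviation = sum (λ i → gap Z (countOf (offConfig σ i)) (countOf (P i)))

        private
          Ω≤ : Window.Ω Z E ≤ offline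
          Ω≤ = begin
            ∑[ z < Z ] ℤ.∣ E z ∣                                       ≡⟨ ∑-cong Z (λ z _ → trans (∣E∣ z) (trans (∣-∣-comm (C z) (R z)) (cong (∣ R z -_∣) (sym (permuted z))))) ⟩
            ∑[ z < Z ] ∣ R z - sum (λ i → 1 * 𝟙 (p (σ i) ≤? z)) ∣      ≤⟨ ∑-sum-gap Z (λ _ → 1) (p ∘ ρ) (p ∘ σ) ⟩
            sum (λ i → 1 * ∣ p (ρ i) - p (σ i) ∣)                      ≡⟨ sum-cong-≗ {n} (λ i → *-identityˡ ∣ p (ρ i) - p (σ i) ∣) ⟩
            offline                                                    ∎
            where
            open ≤-Reasoning
            permuted : ∀ z → sum (λ i → 1 * 𝟙 (p (σ i) ≤? z)) ≡ C z
            permuted z = sum-injection-≡ σ (λ _ → 1) (λ _ → 1) (λ _ → ≤-refl) (λ i j _ _ → σ-injective i j) refl (λ j → p j ≤? z)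

          ss : Vec ℕ n
          ss = tabulate (p ∘ σ)

          prefix≡ : ∀ i z → prefix (λ _ → 0) ss i z ≡ countOf (offConfig σ i) z
          prefix≡ i z = trans (prefix-sum (λ _ → 0) ss i z)
            (trans (sum-cong-≗ (λ j → cong (λ t → 𝟙 (toℕ j ≤? toℕ i) * 𝟙 (t ≤? z)) (lookup∘tabulate (p ∘ σ) j)))
                   (offConfig-sum σ σ-injective i (λ t → p t ≤? z)))

          errors≡ : errors (λ _ → 0) xs ss ≡ deviation
          errors≡ = trans (errors-sum (λ _ → 0) xs ss) (sum-cong-≗ (λ i → ∑-cong Z (λ z _ → cong₂ ∣_-_∣ (prefix≡ i z)
            (cong (λ x → proj₂ x z) (lookup∘tabulate (λ i → p (ρ i) , countOf (P i)) i)))))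

          travel≡ : travel rs ss ≡ offline
          travel≡ = trans (travel-sum rs ss) (sum-cong-≗ (λ i → cong₂ ∣_-_∣ (rs-lookup i) (lookup∘tabulate (p ∘ σ) i)))

        expense-error : expense ≤ 68 * (offline + 2 * deviation)
        expense-error = begin
          expense                                                                        ≡⟨ expense≡ ⟩
          travel rs (places ρ P)                                                         ≤⟨ proj₁ (proj₂ good) ⟩
          68 * (predictionCost (λ _ → 0) xs + 0)                                         ≤⟨ *-monoʳ-≤ 68 (≤-reflexive (+-identityʳ (predictionCost (λ _ → 0) xs))) ⟩
          68 * predictionCost (λ _ → 0) xs                                               ≤⟨ *-monoʳ-≤ 68 (prediction-errors X W (λ _ → 0) (λ _ → 0) xs ss) ⟩
          68 * (gap Z (λ _ → 0) (λ _ → 0) + (travel rs ss + 2 * errors (λ _ → 0) xs ss)) ≡⟨ cong (68 *_) (cong₂ _+_ (∑-0 Z) (cong₂ (λ a b → a + 2 * b) travel≡ errors≡)) ⟩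
          68 * (offline + 2 * deviation)                                                 ∎
          where open ≤-Reasoning

        expense-log : expense ≤ logConstant * (suc ⌊log₂ n ⌋ * offline)
        expense-log = begin
          expense                                                     ≡⟨ expense≡ ⟩
          travel rs (places ρ P)                                      ≤⟨ proj₂ (proj₂ good) ⟩
          68 * (Greedy.cost Z stocked (λ _ → 0ℤ) (toList rs) + 0)     ≤⟨ *-monoʳ-≤ 68 (≤-reflexive (trans (+-identityʳ _) (cost-length (toList rs) inv))) ⟩
          68 * total pathLength (λ _ → 0ℤ) moved                         ≤⟨ *-monoʳ-≤ 68 (Scales.history-bound Z E n K (log-bound n) {λ _ → 0ℤ} {moved} (history (toList rs) inv) (λ _ → refl)
                                                                           (≤-trans (moves-length (toList rs) stocked (λ _ → 0ℤ)) (≤-reflexive (length-toList rs)))) ⟩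
          68 * logBound Ω (K * Ω)                                     ≤⟨ logBound-linear Ω (K * Ω) (L * offline) Ω≤L KΩ≤ ⟩
          logConstant * (L * offline)                                 ∎
          where
          open ≤-Reasoning
          L K Ω : ℕ
          L = suc ⌊log₂ n ⌋
          -- The 7 is for the factor 128 = 2 ^ 7 of `history-bound`; as L ≥ 1, K is at most 8 L.
          K = 7 + L
          Ω = Window.Ω Z E
          moved = Greedy.moves Z stocked (λ _ → 0ℤ) (toList rs)
          Ω≤L : Ω ≤ L * offline
          Ω≤L = ≤-trans Ω≤ (m≤n*m offline L)
          KΩ≤ : K * Ω ≤ 8 * (L * offline)
          KΩ≤ = begin
            K * Ω              ≤⟨ *-mono-≤ {K} {8 * L} (linear 1 (λ l → [] ⊢ # 7 :+ (# 1 :+ l) :≤ 8 :* (# 1 :+ l)) ⌊log₂ n ⌋) Ω≤ ⟩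
            8 * L * offline    ≡⟨ *-assoc 8 L offline ⟩
            8 * (L * offline)  ∎

-- From rational coordinates to integer positions

module Rational where

  open import Data.Nat as ℕ using (ℕ; zero; suc)
  import Data.Nat.Properties as ℕₚ
  open import Data.Nat.Logarithm using (⌊log₂_⌋)
  open import Data.Integer as ℤ using (ℤ; 0ℤ) renaming (+_ to pos)
  import Data.Integer.Properties as ℤₚ
  import Data.Integer.Tactic.RingSolver as ℤ-Solver
  open import Data.Rational hiding (pos; neg)
  open import Data.Rational.Properties
  open import Data.Rational.Solver
  import Data.Rational.Unnormalised as ℚᵘ
  import Data.Rational.Unnormalised.Properties as ℚᵘₚ
  open import Data.Bool using (true; false; if_then_else_)
  open import Data.Fin using (Fin; toℕ)
  open import Data.Fin.Subset using (Subset) renaming (∣_∣ to size)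
  open import Data.List as List using ()
  open import Data.Vec using (lookup)
  open import Data.Vec.Properties using (lookup∘tabulate)
  open import Data.Product using (_×_; _,_; proj₁; proj₂; ∃)
  open import Function using (_∘_)
  open import Algebra.Bundles using (CommutativeMonoid)
  open import Algebra.Properties.Semiring.Sum ℕₚ.+-*-semiring using (sum)
  open import Relation.Nullary using (yes; no)
  open import Relation.Binary.PropositionalEquality
  open Line using (-i≤∣i∣; logConstant; Count; gap; scan-causal; toBit; dist-attained; Matching; ∣pos-pos∣; module Serving; module Servers; module Locations; module Instance)
  open +-*-Solver using (solve; _:+_; _:*_; _:-_; :-_; _:=_; con)

  ι : ℤ → ℚ
  ι a = a / 1

  private
    toℚᵘ-ι : ∀ a → toℚᵘ (ι a) ℚᵘ.≃ ℚᵘ.mkℚᵘ a 0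
    toℚᵘ-ι a = toℚᵘ-fromℚᵘ (ℚᵘ.mkℚᵘ a 0)

  ι-+ : ∀ a b → ι (a ℤ.+ b) ≡ ι a + ι b
  ι-+ a b = toℚᵘ-injective (begin
    toℚᵘ (ι (a ℤ.+ b))                   ≈⟨ toℚᵘ-ι (a ℤ.+ b) ⟩
    ℚᵘ.mkℚᵘ (a ℤ.+ b) 0                  ≈⟨ ℚᵘ.*≡* (lemma a b) ⟩
    ℚᵘ.mkℚᵘ a 0 ℚᵘ.+ ℚᵘ.mkℚᵘ b 0         ≈⟨ ℚᵘₚ.+-cong (ℚᵘₚ.≃-sym (toℚᵘ-ι a)) (ℚᵘₚ.≃-sym (toℚᵘ-ι b)) ⟩
    toℚᵘ (ι a) ℚᵘ.+ toℚᵘ (ι b)           ≈⟨ ℚᵘₚ.≃-sym (toℚᵘ-homo-+ (ι a) (ι b)) ⟩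
    toℚᵘ (ι a + ι b)                     ∎)
    where
    open import Relation.Binary.Reasoning.Setoid ℚᵘₚ.≃-setoid
    lemma : ∀ a b → (a ℤ.+ b) ℤ.* ℤ.1ℤ ≡ (a ℤ.* ℤ.1ℤ ℤ.+ b ℤ.* ℤ.1ℤ) ℤ.* ℤ.1ℤ
    lemma = ℤ-Solver.solve-∀

  ι-* : ∀ a b → ι (a ℤ.* b) ≡ ι a * ι b
  ι-* a b = toℚᵘ-injective (begin
    toℚᵘ (ι (a ℤ.* b))                   ≈⟨ toℚᵘ-ι (a ℤ.* b) ⟩
    ℚᵘ.mkℚᵘ a 0 ℚᵘ.* ℚᵘ.mkℚᵘ b 0         ≈⟨ ℚᵘₚ.*-cong (ℚᵘₚ.≃-sym (toℚᵘ-ι a)) (ℚᵘₚ.≃-sym (toℚᵘ-ι b)) ⟩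
    toℚᵘ (ι a) ℚᵘ.* toℚᵘ (ι b)           ≈⟨ ℚᵘₚ.≃-sym (toℚᵘ-homo-* (ι a) (ι b)) ⟩
    toℚᵘ (ι a * ι b)                     ∎)
    where open import Relation.Binary.Reasoning.Setoid ℚᵘₚ.≃-setoid

  ι-∣∣ : ∀ a → ι (pos ℤ.∣ a ∣) ≡ ∣ ι a ∣
  ι-∣∣ a = toℚᵘ-injective (begin
    toℚᵘ (ι (pos ℤ.∣ a ∣))               ≈⟨ toℚᵘ-ι (pos ℤ.∣ a ∣) ⟩
    ℚᵘ.∣ ℚᵘ.mkℚᵘ a 0 ∣                   ≈⟨ ℚᵘₚ.∣-∣-cong (ℚᵘₚ.≃-sym (toℚᵘ-ι a)) ⟩
    ℚᵘ.∣ toℚᵘ (ι a) ∣                    ≈⟨ ℚᵘₚ.≃-sym (toℚᵘ-homo-∣-∣ (ι a)) ⟩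
    toℚᵘ ∣ ι a ∣                         ∎)
    where open import Relation.Binary.Reasoning.Setoid ℚᵘₚ.≃-setoid

  ι-mono : ∀ {a b} → a ℤ.≤ b → ι a ≤ ι b
  ι-mono {a} {b} a≤b = toℚᵘ-cancel-≤ (ℚᵘₚ.≤-respˡ-≃ (ℚᵘₚ.≃-sym (toℚᵘ-ι a)) (ℚᵘₚ.≤-respʳ-≃ (ℚᵘₚ.≃-sym (toℚᵘ-ι b))
    (ℚᵘ.*≤* (ℤₚ.*-monoʳ-≤-nonNeg ℤ.1ℤ a≤b))))

  ι-neg : ∀ a → ι (ℤ.- a) ≡ - ι a
  ι-neg a = begin
    ι (ℤ.- a)                  ≡⟨ sym (+-identityʳ _) ⟩
    ι (ℤ.- a) + 0ℚ             ≡⟨ cong (λ t → ι (ℤ.- a) + t) (sym (+-inverseʳ (ι a))) ⟩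
    ι (ℤ.- a) + (ι a + - ι a)  ≡⟨ sym (+-assoc (ι (ℤ.- a)) (ι a) (- ι a)) ⟩
    ι (ℤ.- a) + ι a + - ι a    ≡⟨ cong (_+ - ι a) (trans (sym (ι-+ (ℤ.- a) a)) (cong ι (ℤₚ.+-inverseˡ a))) ⟩
    0ℚ + - ι a                 ≡⟨ +-identityˡ _ ⟩
    - ι a                      ∎
    where open ≡-Reasoning

  ι-denominator : ∀ x → ι (↧ x) * x ≡ ι (↥ x)
  ι-denominator x@(mkℚ n d-1 _) = toℚᵘ-injective (begin
    toℚᵘ (ι (↧ x) * x)                       ≈⟨ toℚᵘ-homo-* (ι (↧ x)) x ⟩
    toℚᵘ (ι (↧ x)) ℚᵘ.* toℚᵘ x               ≈⟨ ℚᵘₚ.*-congʳ {toℚᵘ x} (toℚᵘ-ι (↧ x)) ⟩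
    ℚᵘ.mkℚᵘ (↧ x) 0 ℚᵘ.* ℚᵘ.mkℚᵘ n d-1       ≈⟨ ℚᵘ.*≡* (trans (lemma′ (pos (suc d-1)) n) (cong (λ k → n ℤ.* pos (suc k)) (sym (ℕₚ.+-identityʳ d-1)))) ⟩
    ℚᵘ.mkℚᵘ n 0                              ≈⟨ ℚᵘₚ.≃-sym (toℚᵘ-ι n) ⟩
    toℚᵘ (ι n)                               ∎)
    where
    open import Relation.Binary.Reasoning.Setoid ℚᵘₚ.≃-setoid
    lemma′ : ∀ d n → (d ℤ.* n) ℤ.* ℤ.1ℤ ≡ n ℤ.* d
    lemma′ = ℤ-Solver.solve-∀

  integral : ∀ n (s : Fin n → ℚ) → ∃ λ M → ℕ.NonZero M × ∃ λ (a : Fin n → ℤ) → ∀ i → ι (pos M) * s i ≡ ι (a i)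
  integral zero    s = 1 , _ , (λ ()) , λ ()
  integral (suc n) s with integral n (s ∘ Fin.suc)
  ... | M , M≢0 , a , h = ↧ₙ (s Fin.zero) ℕ.* M , ℕₚ.m*n≢0 (↧ₙ (s Fin.zero)) M {{_}} {{M≢0}} , a′ , h′
    where
    open ≡-Reasoning
    a′ : Fin (suc n) → ℤ
    a′ Fin.zero    = pos M ℤ.* ↥ (s Fin.zero)
    a′ (Fin.suc i) = ↧ (s Fin.zero) ℤ.* a i
    h′ : ∀ i → ι (pos (↧ₙ (s Fin.zero) ℕ.* M)) * s i ≡ ι (a′ i)
    h′ Fin.zero = begin
      ι (pos (↧ₙ s₀ ℕ.* M)) * s₀      ≡⟨ cong (λ t → ι t * s₀) (trans (ℤₚ.pos-* (↧ₙ s₀) M) (ℤₚ.*-comm (↧ s₀) (pos M))) ⟩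
      ι (pos M ℤ.* ↧ s₀) * s₀         ≡⟨ cong (_* s₀) (ι-* (pos M) (↧ s₀)) ⟩
      ι (pos M) * ι (↧ s₀) * s₀       ≡⟨ *-assoc (ι (pos M)) (ι (↧ s₀)) s₀ ⟩
      ι (pos M) * (ι (↧ s₀) * s₀)     ≡⟨ cong (ι (pos M) *_) (ι-denominator s₀) ⟩
      ι (pos M) * ι (↥ s₀)            ≡⟨ sym (ι-* (pos M) (↥ s₀)) ⟩
      ι (pos M ℤ.* ↥ s₀)              ∎
      where s₀ = s Fin.zero
    h′ (Fin.suc i) = begin
      ι (pos (↧ₙ s₀ ℕ.* M)) * s (Fin.suc i)      ≡⟨ cong (λ t → ι t * s (Fin.suc i)) (ℤₚ.pos-* (↧ₙ s₀) M) ⟩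
      ι (↧ s₀ ℤ.* pos M) * s (Fin.suc i)         ≡⟨ cong (_* s (Fin.suc i)) (ι-* (↧ s₀) (pos M)) ⟩
      ι (↧ s₀) * ι (pos M) * s (Fin.suc i)       ≡⟨ *-assoc (ι (↧ s₀)) (ι (pos M)) (s (Fin.suc i)) ⟩
      ι (↧ s₀) * (ι (pos M) * s (Fin.suc i))     ≡⟨ cong (ι (↧ s₀) *_) (h i) ⟩
      ι (↧ s₀) * ι (a i)                         ≡⟨ sym (ι-* (↧ s₀) (a i)) ⟩
      ι (↧ s₀ ℤ.* a i)                           ∎
      where s₀ = s Fin.zero

  bounded : ∀ n (a : Fin n → ℤ) → ∃ λ B → ∀ i → ℤ.∣ a i ∣ ℕ.≤ B
  bounded zero    a = 0 , λ ()
  bounded (suc n) a with bounded n (a ∘ Fin.suc)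
  ... | B , h = ℤ.∣ a Fin.zero ∣ ℕ.+ B , λ { Fin.zero → ℕₚ.m≤m+n _ B ; (Fin.suc i) → ℕₚ.≤-trans (h i) (ℕₚ.m≤n+m B _) }

  argmin : ∀ {n} → (Fin (suc n) → ℚ) → Fin (suc n)
  argmin {zero}  f = Fin.zero
  argmin {suc n} f with f Fin.zero ≤? f (Fin.suc (argmin (f ∘ Fin.suc)))
  ... | yes _ = Fin.zero
  ... | no _  = Fin.suc (argmin (f ∘ Fin.suc))

  argmin-≤ : ∀ {n} (f : Fin (suc n) → ℚ) j → f (argmin f) ≤ f j
  argmin-≤ {zero}  f Fin.zero = ≤-refl
  argmin-≤ {suc n} f j with f Fin.zero ≤? f (Fin.suc (argmin (f ∘ Fin.suc)))
  argmin-≤ {suc n} f Fin.zero    | yes _ = ≤-refl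
  argmin-≤ {suc n} f (Fin.suc j) | yes h = ≤-trans h (argmin-≤ (f ∘ Fin.suc) j)
  argmin-≤ {suc n} f Fin.zero    | no h  = <⇒≤ (≰⇒> h)
  argmin-≤ {suc n} f (Fin.suc j) | no h  = argmin-≤ (f ∘ Fin.suc) j

  sumℚ : ∀ {n} → (Fin n → ℚ) → ℚ
  sumℚ {zero}  f = 0ℚ
  sumℚ {suc n} f = f Fin.zero + sumℚ (f ∘ Fin.suc)

  sumFin≡sumℚ : ∀ {n} (f : Fin n → ℚ) → sumFin f ≡ sumℚ f
  sumFin≡sumℚ {n} f = go n (λ i → i)
    where
    go : ∀ k (g : Fin k → Fin n) → List.foldr (λ i acc → f i + acc) 0ℚ (List.tabulate g) ≡ sumℚ (f ∘ g)
    go zero    g = refl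
    go (suc k) g = cong (f (g Fin.zero) +_) (go k (g ∘ Fin.suc))

  sumℚ-mono : ∀ {n} {f g : Fin n → ℚ} → (∀ i → f i ≤ g i) → sumℚ f ≤ sumℚ g
  sumℚ-mono {zero}  h = ≤-refl
  sumℚ-mono {suc n} h = +-mono-≤ (h Fin.zero) (sumℚ-mono (h ∘ Fin.suc))

  sumℚ-cong : ∀ {n} {f g : Fin n → ℚ} → (∀ i → f i ≡ g i) → sumℚ f ≡ sumℚ g
  sumℚ-cong {zero}  h = refl
  sumℚ-cong {suc n} h = cong₂ _+_ (h Fin.zero) (sumℚ-cong (h ∘ Fin.suc))

  sumℚ-+ : ∀ {n} (f g : Fin n → ℚ) → sumℚ (λ i → f i + g i) ≡ sumℚ f + sumℚ g
  sumℚ-+ {zero}  f g = refl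
  sumℚ-+ {suc n} f g = trans (cong (f Fin.zero + g Fin.zero +_) (sumℚ-+ (f ∘ Fin.suc) (g ∘ Fin.suc))) (interchange (f Fin.zero) (g Fin.zero) (sumℚ (f ∘ Fin.suc)) (sumℚ (g ∘ Fin.suc)))
    where
    open import Algebra.Properties.CommutativeSemigroup (CommutativeMonoid.commutativeSemigroup +-0-commutativeMonoid) using (interchange)

  sumℚ-* : ∀ {n} c (f : Fin n → ℚ) → sumℚ (λ i → c * f i) ≡ c * sumℚ f
  sumℚ-* {zero}  c f = sym (*-zeroʳ c)
  sumℚ-* {suc n} c f = trans (cong (c * f Fin.zero +_) (sumℚ-* c (f ∘ Fin.suc))) (sym (*-distribˡ-+ c (f Fin.zero) _))

  sumℚ-ι : ∀ {n} (f : Fin n → ℕ) → sumℚ (λ i → ℕ→ℚ (f i)) ≡ ℕ→ℚ (sum f)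
  sumℚ-ι {zero}  f = refl
  sumℚ-ι {suc n} f = trans (cong (ℕ→ℚ (f Fin.zero) +_) (sumℚ-ι (f ∘ Fin.suc))) (sym (ι-+ (pos (f Fin.zero)) (pos (sum (f ∘ Fin.suc)))))

  0≤ℕ→ℚ : ∀ k → 0ℚ ≤ ℕ→ℚ k
  0≤ℕ→ℚ k = ι-mono {0ℤ} {pos k} (ℤ.+≤+ ℕ.z≤n)

  *-monoʳ : ∀ {r p q} → 0ℚ ≤ r → p ≤ q → r * p ≤ r * q
  *-monoʳ {r} 0≤r = *-monoˡ-≤-nonNeg r {{nonNegative 0≤r}}

  *-monoˡ : ∀ {r p q} → 0ℚ ≤ r → p ≤ q → p * r ≤ q * r
  *-monoˡ {r} 0≤r = *-monoʳ-≤-nonNeg r {{nonNegative 0≤r}}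

  0≤* : ∀ {p q} → 0ℚ ≤ p → 0ℚ ≤ q → 0ℚ ≤ p * q
  0≤* {p} {q} 0≤p 0≤q = subst (_≤ p * q) (*-zeroʳ p) (*-monoʳ 0≤p 0≤q)

  ℕ→ℚ-* : ∀ a b → ℕ→ℚ (a ℕ.* b) ≡ ℕ→ℚ a * ℕ→ℚ b
  ℕ→ℚ-* a b = trans (cong ι (ℤₚ.pos-* a b)) (ι-* (pos a) (pos b))

  sumℚ-nonneg : ∀ {n} (f : Fin n → ℚ) → (∀ i → 0ℚ ≤ f i) → 0ℚ ≤ sumℚ f
  sumℚ-nonneg {zero}  f h = ≤-refl
  sumℚ-nonneg {suc n} f h = +-mono-≤ (h Fin.zero) (sumℚ-nonneg (f ∘ Fin.suc) (h ∘ Fin.suc))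

  ∣-∣-triangle : ∀ x y z → ∣ x - z ∣ ≤ ∣ x - y ∣ + ∣ y - z ∣
  ∣-∣-triangle x y z = subst (λ t → ∣ t ∣ ≤ ∣ x - y ∣ + ∣ y - z ∣)
    (solve 3 (λ x y z → (x :- y) :+ (y :- z) := x :- z) refl x y z) (∣p+q∣≤∣p∣+∣q∣ (x - y) (y - z))

  ∣-∣-sym : ∀ x y → ∣ x - y ∣ ≡ ∣ y - x ∣
  ∣-∣-sym x y = trans (cong ∣_∣ (solve 2 (λ x y → x :- y := :- (y :- x)) refl x y)) (∣-p∣≡∣p∣ (y - x))

  module Embedding {m : ℕ} (s : Fin (suc m) → ℚ) (scale : ℕ) (a : Fin (suc m) → ℤ) (scaled-integral : ∀ i → ι (pos scale) * s i ≡ ι (a i))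
                   (B : ℕ) (a-bound : ∀ j → ℤ.∣ a j ∣ ℕ.≤ B) where

    private
      offset : Fin (suc m) → ℕ
      offset j = ℤ.∣ a j ℤ.+ pos B ∣

      pos-offset : ∀ j → pos (offset j) ≡ a j ℤ.+ pos B
      pos-offset j = ℤₚ.0≤i⇒+∣i∣≡i (subst (0ℤ ℤ.≤_) (rearrange (a j) (pos B))
        (ℤₚ.i≤j⇒0≤j-i (ℤₚ.≤-trans (-i≤∣i∣ (a j)) (ℤ.+≤+ (a-bound j)))))
        where
        rearrange : ∀ a b → b ℤ.- (ℤ.- a) ≡ a ℤ.+ b
        rearrange = ℤ-Solver.solve-∀

    -- Shifting by B maps the scaled servers into the range from 0 to 2 B. The further shift by 2 B
    -- + 1 makes room for outer parts that are longer than the middle part.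
    width origin : ℕ
    width  = B ℕ.+ B
    origin = suc width

    position : Fin (suc m) → ℕ
    position j = origin ℕ.+ offset j

    position-range : ∀ j → origin ℕ.≤ position j × position j ℕ.≤ origin ℕ.+ width
    position-range j = ℕₚ.m≤m+n origin (offset j) , ℕₚ.+-monoʳ-≤ origin (ℕₚ.≤-trans (ℤₚ.∣i+j∣≤∣i∣+∣j∣ (a j) (pos B)) (ℕₚ.+-monoˡ-≤ B (a-bound j)))

    position-distance : ∀ i j → ℕ.∣ position i - position j ∣ ≡ ℤ.∣ a i ℤ.- a j ∣
    position-distance i j = begin
      ℕ.∣ position i - position j ∣                      ≡⟨ ℕₚ.∣m+n-m+o∣≡∣n-o∣ origin (offset i) (offset j) ⟩
      ℕ.∣ offset i - offset j ∣                          ≡⟨ sym (∣pos-pos∣ (offset i) (offset j)) ⟩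
      ℤ.∣ pos (offset i) ℤ.- pos (offset j) ∣            ≡⟨ cong₂ (λ x y → ℤ.∣ x ℤ.- y ∣) (pos-offset i) (pos-offset j) ⟩
      ℤ.∣ (a i ℤ.+ pos B) ℤ.- (a j ℤ.+ pos B) ∣          ≡⟨ cong ℤ.∣_∣ (cancel (a i) (a j) (pos B)) ⟩
      ℤ.∣ a i ℤ.- a j ∣                                  ∎
      where
      open ≡-Reasoning
      cancel : ∀ x y b → (x ℤ.+ b) ℤ.- (y ℤ.+ b) ≡ x ℤ.- y
      cancel = ℤ-Solver.solve-∀

    scaled : ∀ i j → ℕ→ℚ scale * ∣ s i - s j ∣ ≡ ℕ→ℚ (ℕ.∣ position i - position j ∣)
    scaled i j = begin
      ℕ→ℚ scale * ∣ s i - s j ∣                  ≡⟨ cong (_* ∣ s i - s j ∣) (ι-∣∣ (pos scale)) ⟩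
      ∣ ℕ→ℚ scale ∣ * ∣ s i - s j ∣              ≡⟨ sym (∣p*q∣≡∣p∣*∣q∣ (ℕ→ℚ scale) (s i - s j)) ⟩
      ∣ ℕ→ℚ scale * (s i - s j) ∣                ≡⟨ cong ∣_∣ (solve 3 (λ k x y → k :* (x :- y) := k :* x :- k :* y) refl (ℕ→ℚ scale) (s i) (s j)) ⟩
      ∣ ℕ→ℚ scale * s i - ℕ→ℚ scale * s j ∣      ≡⟨ cong₂ (λ x y → ∣ x - y ∣) (scaled-integral i) (scaled-integral j) ⟩
      ∣ ι (a i) - ι (a j) ∣                      ≡⟨ cong (λ t → ∣ ι (a i) + t ∣) (sym (ι-neg (a j))) ⟩
      ∣ ι (a i) + ι (ℤ.- a j) ∣                  ≡⟨ cong ∣_∣ (sym (ι-+ (a i) (ℤ.- a j))) ⟩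
      ∣ ι (a i ℤ.- a j) ∣                        ≡⟨ sym (ι-∣∣ (a i ℤ.- a j)) ⟩
      ι (pos ℤ.∣ a i ℤ.- a j ∣)                  ≡⟨ cong ℕ→ℚ (sym (position-distance i j)) ⟩
      ℕ→ℚ (ℕ.∣ position i - position j ∣)        ∎
      where open ≡-Reasoning

  module Response {m : ℕ} (s : Fin (suc m) → ℚ) (scale : ℕ) (position : Fin (suc m) → ℕ) (origin width : ℕ) (width<origin : width ℕ.< origin)
                  (position-range : ∀ j → origin ℕ.≤ position j × position j ℕ.≤ origin ℕ.+ width)
                  (scaled : ∀ i j → ℕ→ℚ scale * ∣ s i - s j ∣ ≡ ℕ→ℚ (ℕ.∣ position i - position j ∣)) where

    nearest : ℚ → Fin (suc m)
    nearest x = argmin (λ j → ∣ s j - x ∣)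

    module I = Instance position origin width width<origin position-range

    response : (Fin (suc m) → ℚ) → (Fin (suc m) → Subset (suc m)) → Fin (suc m) → Fin (suc m)
    response r P i = lookup (I.answers (nearest ∘ r) P) i

    response-online : ∀ r r′ P P′ i → (∀ j → toℕ j ℕ.≤ toℕ i → r j ≡ r′ j) → (∀ j → toℕ j ℕ.≤ toℕ i → P j ≡ P′ j) →
                      response r P i ≡ response r′ P′ i
    response-online r r′ P P′ i hr hP = scan-causal (Servers.assignStep position) (λ _ → true) (I.places (nearest ∘ r) P) (I.places (nearest ∘ r′) P′) i (λ j j≤i →
      scan-causal (Serving.serve origin width) (Serving.initial origin width I.stocked) (I.input (nearest ∘ r) P) (I.input (nearest ∘ r′) P′) j (λ k k≤j → same k (ℕₚ.≤-trans k≤j j≤i)))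
      where
      same : ∀ k → toℕ k ℕ.≤ toℕ i → lookup (I.input (nearest ∘ r) P) k ≡ lookup (I.input (nearest ∘ r′) P′) k
      same k k≤i = trans (lookup∘tabulate (λ k → position (nearest (r k)) , Locations.countOf position (P k)) k) (trans (cong₂ (λ x Y → position (nearest x) , Locations.countOf position Y) (hr k k≤i) (hP k k≤i))
                                                      (sym (lookup∘tabulate (λ k → position (nearest (r′ k)) , Locations.countOf position (P′ k)) k)))

    module _ (r : Fin (suc m) → ℚ) (P : Fin (suc m) → Subset (suc m)) (valid : ValidPredictions P)
             (σ : Fin (suc m) → Fin (suc m)) (σ-injective : ∀ i j → σ i ≡ σ j → i ≡ j) where

      open I.Bounds (nearest ∘ r) P valid

      private
        M O H A : ℚ
        M = ℕ→ℚ scale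
        O = totalCost s r σ
        H = predError s P σ
        A = totalCost s r (response r P)

        ρ : Fin (suc m) → Fin (suc m)
        ρ = nearest ∘ r

        0≤M : 0ℚ ≤ M
        0≤M = 0≤ℕ→ℚ scale

        offlineCost : Fin (suc m) → ℚ
        offlineCost i = ∣ s (σ i) - r i ∣

        O≡ : O ≡ sumℚ offlineCost
        O≡ = sumFin≡sumℚ offlineCost

      0≤O : 0ℚ ≤ O
      0≤O = subst (0ℚ ≤_) (sym O≡) (sumℚ-nonneg offlineCost (λ i → 0≤∣p∣ (s (σ i) - r i)))

      -- Serving the nearest server location instead of the request costs at most O more.
      scaled-response : M * A ≤ ℕ→ℚ expense + M * O
      scaled-response = begin
        M * A                                                       ≡⟨ cong (M *_) (sumFin≡sumℚ (λ i → ∣ s (response r P i) - r i ∣)) ⟩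
        M * sumℚ (λ i → ∣ s (response r P i) - r i ∣)               ≤⟨ *-monoʳ 0≤M (sumℚ-mono (λ i → detour i)) ⟩
        M * sumℚ (λ i → moved i + offlineCost i)                    ≡⟨ cong (M *_) (trans (sumℚ-+ moved offlineCost) (cong (sumℚ moved +_) (sym O≡))) ⟩
        M * (sumℚ moved + O)                                        ≡⟨ *-distribˡ-+ M (sumℚ moved) O ⟩
        M * sumℚ moved + M * O                                      ≡⟨ cong (_+ M * O) (trans (sym (sumℚ-* M moved)) (trans (sumℚ-cong (λ i → scaled (ρ i) (response r P i))) (sumℚ-ι (λ i → ℕ.∣ position (ρ i) - position (response r P i) ∣)))) ⟩
        ℕ→ℚ expense + M * O                                         ∎
        where
        open ≤-Reasoning
        moved : Fin (suc m) → ℚ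
        moved i = ∣ s (ρ i) - s (response r P i) ∣
        detour : ∀ i → ∣ s (response r P i) - r i ∣ ≤ moved i + ∣ s (σ i) - r i ∣
        detour i = ≤-trans (∣-∣-triangle (s (response r P i)) (s (ρ i)) (r i))
          (+-mono-≤ (≤-reflexive (∣-∣-sym (s (response r P i)) (s (ρ i)))) (argmin-≤ (λ j → ∣ s j - r i ∣) (σ i)))

      -- The server nearest to a request is no farther from it than the offline server, so replacing
      -- the request by it at most doubles the offline cost.
      scaled-offline : ℕ→ℚ (offline σ σ-injective) ≤ M * (O + O)
      scaled-offline = begin
        ℕ→ℚ (offline σ σ-injective)                                 ≡⟨ sym (sumℚ-ι (λ i → ℕ.∣ position (ρ i) - position (σ i) ∣)) ⟩
        sumℚ (λ i → ℕ→ℚ (ℕ.∣ position (ρ i) - position (σ i) ∣))    ≡⟨ sumℚ-cong (λ i → sym (scaled (ρ i) (σ i))) ⟩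
        sumℚ (λ i → M * ∣ s (ρ i) - s (σ i) ∣)                      ≡⟨ sumℚ-* M (λ i → ∣ s (ρ i) - s (σ i) ∣) ⟩
        M * sumℚ (λ i → ∣ s (ρ i) - s (σ i) ∣)                      ≤⟨ *-monoʳ 0≤M (sumℚ-mono (λ i → through i)) ⟩
        M * sumℚ (λ i → offlineCost i + offlineCost i)              ≡⟨ cong (M *_) (trans (sumℚ-+ offlineCost offlineCost) (cong₂ _+_ (sym O≡) (sym O≡))) ⟩
        M * (O + O)                                                 ∎
        where
        open ≤-Reasoning
        through : ∀ i → ∣ s (ρ i) - s (σ i) ∣ ≤ ∣ s (σ i) - r i ∣ + ∣ s (σ i) - r i ∣
        through i = ≤-trans (∣-∣-triangle (s (ρ i)) (r i) (s (σ i)))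
          (+-mono-≤ (argmin-≤ (λ j → ∣ s j - r i ∣) (σ i)) (≤-reflexive (∣-∣-sym (r i) (s (σ i)))))

      scaled-deviation : ℕ→ℚ (deviation σ σ-injective) ≤ M * H
      scaled-deviation = begin
        ℕ→ℚ (deviation σ σ-injective)                               ≡⟨ sym (sumℚ-ι deviations) ⟩
        sumℚ (λ i → ℕ→ℚ (deviations i))                             ≤⟨ sumℚ-mono each ⟩
        sumℚ (λ i → M * dist s (P i) (offConfig σ i))               ≡⟨ sumℚ-* M (λ i → dist s (P i) (offConfig σ i)) ⟩
        M * sumℚ (λ i → dist s (P i) (offConfig σ i))               ≡⟨ cong (M *_) (sym (sumFin≡sumℚ (λ i → dist s (P i) (offConfig σ i)))) ⟩
        M * H                                                       ∎
        where
        open ≤-Reasoning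
        open Locations position
        deviations : Fin (suc m) → ℕ
        deviations i = gap (origin ℕ.+ width ℕ.+ origin) (countOf (offConfig σ i)) (countOf (P i))
        module _ (i : Fin (suc m)) (μ : Fin (suc m) → Fin (suc m)) where
          lengths : Fin (suc m) → ℕ
          lengths j = toBit (lookup (P i) j) ℕ.* ℕ.∣ position j - position (μ j) ∣
          costs : Fin (suc m) → ℚ
          costs j = if lookup (P i) j then ∣ s j - s (μ j) ∣ else 0ℚ
          term : ∀ j b → ℕ→ℚ (toBit b ℕ.* ℕ.∣ position j - position (μ j) ∣) ≡ M * (if b then ∣ s j - s (μ j) ∣ else 0ℚ)
          term j true  = trans (cong ℕ→ℚ (ℕₚ.*-identityˡ ℕ.∣ position j - position (μ j) ∣)) (sym (scaled j (μ j)))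
          term j false = sym (*-zeroʳ M)
          lengths-costs : ℕ→ℚ (sum lengths) ≡ M * matchingCost s (P i) μ
          lengths-costs = begin-equality
            ℕ→ℚ (sum lengths)               ≡⟨ sym (sumℚ-ι lengths) ⟩
            sumℚ (λ j → ℕ→ℚ (lengths j))    ≡⟨ sumℚ-cong (λ j → term j (lookup (P i) j)) ⟩
            sumℚ (λ j → M * costs j)        ≡⟨ sumℚ-* M costs ⟩
            M * sumℚ costs                  ≡⟨ cong (M *_) (sym (sumFin≡sumℚ costs)) ⟩
            M * matchingCost s (P i) μ      ∎
        sizes : ∀ i → size (P i) ≡ size (offConfig σ i)
        sizes i = trans (valid i) (sym (offConfig-size σ σ-injective i))
        each : ∀ i → ℕ→ℚ (deviations i) ≤ M * dist s (P i) (offConfig σ i)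
        each i = below (dist-attained s (P i) (offConfig σ i) (sizes i))
          where
          below : (∃ λ μ → Matching (lookup (P i)) (lookup (offConfig σ i)) μ × dist s (P i) (offConfig σ i) ≡ matchingCost s (P i) μ) →
                  ℕ→ℚ (deviations i) ≤ M * dist s (P i) (offConfig σ i)
          below (μ , μ-matching , attained) = begin
            ℕ→ℚ (deviations i)                    ≤⟨ ι-mono (ℤ.+≤+ (matching-gap (origin ℕ.+ width ℕ.+ origin) (P i) (offConfig σ i) μ μ-matching (sizes i))) ⟩
            ℕ→ℚ (sum (lengths i μ))               ≡⟨ lengths-costs i μ ⟩
            M * matchingCost s (P i) μ            ≡⟨ cong (M *_) (sym attained) ⟩
            M * dist s (P i) (offConfig σ i)      ∎

      private
        N e L c q : ℚ
        N = ℕ→ℚ (offline σ σ-injective)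
        e = ℕ→ℚ (deviation σ σ-injective)
        L = logFactor (suc m)
        c = ℕ→ℚ logConstant
        q = ℕ→ℚ 68

      response-log : M * A ≤ M * ((c + c + 1ℚ) * (L * O))
      response-log = begin
        M * A                                   ≤⟨ scaled-response ⟩
        ℕ→ℚ expense + M * O                     ≤⟨ +-mono-≤ expense≤ (*-monoʳ 0≤M O≤L*O) ⟩
        c * (L * (M * (O + O))) + M * (L * O)   ≡⟨ solve 4 (λ c l m o → c :* (l :* (m :* (o :+ o))) :+ m :* (l :* o) := m :* ((c :+ c :+ con 1ℚ) :* (l :* o))) refl c L M O ⟩
        M * ((c + c + 1ℚ) * (L * O))            ∎
        where
        open ≤-Reasoning
        expense≤ : ℕ→ℚ expense ≤ c * (L * (M * (O + O)))
        expense≤ = begin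
          ℕ→ℚ expense                                                                        ≤⟨ ι-mono (ℤ.+≤+ (expense-log σ σ-injective)) ⟩
          ℕ→ℚ (logConstant ℕ.* (suc ⌊log₂ suc m ⌋ ℕ.* offline σ σ-injective))                ≡⟨ ℕ→ℚ-* logConstant (suc ⌊log₂ suc m ⌋ ℕ.* offline σ σ-injective) ⟩
          c * ℕ→ℚ (suc ⌊log₂ suc m ⌋ ℕ.* offline σ σ-injective)                              ≡⟨ cong (c *_) (ℕ→ℚ-* (suc ⌊log₂ suc m ⌋) (offline σ σ-injective)) ⟩
          c * (L * N)                                                                        ≤⟨ *-monoʳ (0≤ℕ→ℚ logConstant) (*-monoʳ (0≤ℕ→ℚ (suc ⌊log₂ suc m ⌋)) scaled-offline) ⟩
          c * (L * (M * (O + O)))                                                            ∎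
        O≤L*O : O ≤ L * O
        O≤L*O = subst (_≤ L * O) (*-identityˡ O) (*-monoˡ 0≤O (ι-mono {pos 1} {pos (suc ⌊log₂ suc m ⌋)} (ℤ.+≤+ (ℕ.s≤s ℕ.z≤n))))

      response-error : M * A ≤ M * ((q + q + 1ℚ) * (O + H))
      response-error = begin
        M * A                                                   ≤⟨ scaled-response ⟩
        ℕ→ℚ expense + M * O                                     ≤⟨ +-monoˡ-≤ (M * O) expense≤ ⟩
        q * (M * (O + O) + (M * H + M * H)) + M * O             ≡⟨ sym (+-identityʳ (q * (M * (O + O) + (M * H + M * H)) + M * O)) ⟩
        -- A nonnegative term M * H is added so that O and H get the same factor 2 q + 1.
        q * (M * (O + O) + (M * H + M * H)) + M * O + 0ℚ        ≤⟨ +-monoʳ-≤ (q * (M * (O + O) + (M * H + M * H)) + M * O) (≤-trans (0≤ℕ→ℚ (deviation σ σ-injective)) scaled-deviation) ⟩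
        q * (M * (O + O) + (M * H + M * H)) + M * O + M * H     ≡⟨ solve 4 (λ q m o h → q :* (m :* (o :+ o) :+ (m :* h :+ m :* h)) :+ m :* o :+ m :* h := m :* ((q :+ q :+ con 1ℚ) :* (o :+ h))) refl q M O H ⟩
        M * ((q + q + 1ℚ) * (O + H))                            ∎
        where
        open ≤-Reasoning
        expense≤ : ℕ→ℚ expense ≤ q * (M * (O + O) + (M * H + M * H))
        expense≤ = begin
          ℕ→ℚ expense                                                            ≤⟨ ι-mono (ℤ.+≤+ (expense-error σ σ-injective)) ⟩
          ℕ→ℚ (68 ℕ.* (offline σ σ-injective ℕ.+ 2 ℕ.* deviation σ σ-injective)) ≡⟨ ℕ→ℚ-* 68 (offline σ σ-injective ℕ.+ 2 ℕ.* deviation σ σ-injective) ⟩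
          q * ℕ→ℚ (offline σ σ-injective ℕ.+ 2 ℕ.* deviation σ σ-injective)      ≡⟨ cong (q *_) (trans (ι-+ (pos (offline σ σ-injective)) (pos (2 ℕ.* deviation σ σ-injective))) (cong (N +_) twice)) ⟩
          q * (N + (e + e))                                                      ≤⟨ *-monoʳ (0≤ℕ→ℚ 68) (+-mono-≤ scaled-offline (+-mono-≤ scaled-deviation scaled-deviation)) ⟩
          q * (M * (O + O) + (M * H + M * H))                                    ∎
          where
          twice : ℕ→ℚ (2 ℕ.* deviation σ σ-injective) ≡ e + e
          twice = trans (cong (λ t → ℕ→ℚ (deviation σ σ-injective ℕ.+ t)) (ℕₚ.+-identityʳ (deviation σ σ-injective))) (ι-+ (pos (deviation σ σ-injective)) (pos (deviation σ σ-injective)))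

  -- The sum of the two ratios dominates each of them, so both bounds hold with the same factor and
  -- combine to a bound by the minimum.
  logRatio errorRatio ratio : ℚ
  logRatio   = ℕ→ℚ logConstant + ℕ→ℚ logConstant + 1ℚ
  errorRatio = ℕ→ℚ 68 + ℕ→ℚ 68 + 1ℚ
  ratio      = logRatio + errorRatio

  0≤log-ratio : 0ℚ ≤ logRatio
  0≤log-ratio = +-mono-≤ (+-mono-≤ (0≤ℕ→ℚ logConstant) (0≤ℕ→ℚ logConstant)) (0≤ℕ→ℚ 1)

  0≤error-ratio : 0ℚ ≤ errorRatio
  0≤error-ratio = +-mono-≤ (+-mono-≤ (0≤ℕ→ℚ 68) (0≤ℕ→ℚ 68)) (0≤ℕ→ℚ 1)

  0≤ratio : 0ℚ ≤ ratio
  0≤ratio = +-mono-≤ 0≤log-ratio 0≤error-ratio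

  ratio-⊓ : ∀ {A x y} → A ≤ ratio * x → A ≤ ratio * y → A ≤ ratio * (x ⊓ y) + 0ℚ
  ratio-⊓ {A} {x} {y} hx hy = subst (A ≤_) (trans (sym (*-distribˡ-⊓-nonNeg ratio {{nonNegative 0≤ratio}} x y)) (sym (+-identityʳ _))) (⊓-glb hx hy)

  unscale : ∀ {k} .{{_ : ℕ.NonZero k}} {A c d x} → 0ℚ ≤ d → 0ℚ ≤ x → ℕ→ℚ k * A ≤ ℕ→ℚ k * (c * x) → A ≤ (c + d) * x
  unscale {k} {A} {c} {d} {x} 0≤d 0≤x h = ≤-trans (*-cancelˡ-≤-pos (ℕ→ℚ k) {{normalize-pos k 1}} h)
    (*-monoˡ 0≤x (subst (_≤ c + d) (+-identityʳ c) (+-monoʳ-≤ c 0≤d)))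

  -- Only the servers are scaled, as they are known in advance. The requests have unknown
  -- denominators and get a position through their nearest server, which keeps the algorithm online.
  positioned : ∀ {m} (s : Fin (suc m) → ℚ) → ∃ λ scale → ℕ.NonZero scale × ∃ λ (position : Fin (suc m) → ℕ) → ∃ λ origin → ∃ λ width →
               width ℕ.< origin × (∀ j → origin ℕ.≤ position j × position j ℕ.≤ origin ℕ.+ width)
               × (∀ i j → ℕ→ℚ scale * ∣ s i - s j ∣ ≡ ℕ→ℚ (ℕ.∣ position i - position j ∣))
  positioned {m} s = from-integral (integral (suc m) s)
    where
    from-integral : (∃ λ M → ℕ.NonZero M × ∃ λ (a : Fin (suc m) → ℤ) → ∀ i → ι (pos M) * s i ≡ ι (a i)) → _
    from-integral (scale , scale≢0 , a , h) = from-bounded (bounded (suc m) a)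
      where
      from-bounded : (∃ λ B → ∀ i → ℤ.∣ a i ∣ ℕ.≤ B) → _
      from-bounded (B , a-bound) = scale , scale≢0 , E.position , E.origin , E.width , ℕₚ.≤-refl , E.position-range , E.scaled
        where module E = Embedding s scale a h B a-bound

  module Algorithm {m : ℕ} (s : Fin (suc m) → ℚ) where

    private
      scale : ℕ
      scale = proj₁ (positioned s)

      position : Fin (suc m) → ℕ
      position = proj₁ (proj₂ (proj₂ (positioned s)))

      origin width : ℕ
      origin = proj₁ (proj₂ (proj₂ (proj₂ (positioned s))))
      width  = proj₁ (proj₂ (proj₂ (proj₂ (proj₂ (positioned s)))))
      facts  = proj₂ (proj₂ (proj₂ (proj₂ (proj₂ (positioned s)))))

    open Response s scale position origin width (proj₁ facts) (proj₁ (proj₂ facts)) (proj₂ (proj₂ facts)) public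

    response-injective : ∀ r P → ValidPredictions P → ∀ i j → response r P i ≡ response r P j → i ≡ j
    response-injective r P valid = I.Bounds.answers-injective (nearest ∘ r) P valid

    response-competitive : ∀ r P → ValidPredictions P → ∀ σ → (∀ i j → σ i ≡ σ j → i ≡ j) →
                           totalCost s r (response r P) ≤ ratio * ((logFactor (suc m) * totalCost s r σ) ⊓ (totalCost s r σ + predError s P σ)) + 0ℚ
    response-competitive r P valid σ σ-injective = ratio-⊓
      (unscale {scale} {{scale≢0}} {totalCost s r (response r P)} {logRatio} {errorRatio} {logFactor (suc m) * totalCost s r σ}
        0≤error-ratio (0≤* (0≤ℕ→ℚ (suc ⌊log₂ suc m ⌋)) (0≤O r P valid σ σ-injective)) (response-log r P valid σ σ-injective))
      (subst (λ t → totalCost s r (response r P) ≤ t * (totalCost s r σ + predError s P σ)) (+-comm errorRatio logRatio)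
        (unscale {scale} {{scale≢0}} {totalCost s r (response r P)} {errorRatio} {logRatio} {totalCost s r σ + predError s P σ}
          0≤log-ratio (+-mono-≤ (0≤O r P valid σ σ-injective) 0≤H) (response-error r P valid σ σ-injective)))
      where
      scale≢0 : ℕ.NonZero scale
      scale≢0 = proj₁ (proj₂ (positioned s))
      0≤H : 0ℚ ≤ predError s P σ
      0≤H = *-cancelˡ-≤-pos (ℕ→ℚ scale) {{normalize-pos scale 1 {{_}} {{scale≢0}}}}
        (subst (_≤ ℕ→ℚ scale * predError s P σ) (sym (*-zeroʳ (ℕ→ℚ scale))) (≤-trans (0≤ℕ→ℚ (I.Bounds.deviation (nearest ∘ r) P valid σ σ-injective)) (scaled-deviation r P valid σ σ-injective)))

-- The algorithm and its competitive ratio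

import Data.Rational.Properties as ℚₚ
open import Data.Nat using (ℕ; zero; suc)
open import Data.Rational using (ℚ; 0ℚ; _+_; _*_; _⊓_; _≤_)
open import Data.Fin using (Fin)
open import Data.Fin.Subset using (Subset)
open import Data.Product using (Σ; _,_)
open import Relation.Binary.PropositionalEquality using (_≡_; cong; cong₂; sym; trans; subst; refl)

algorithm : OnlineAlgorithm
algorithm = record { choose = choice ; online = causal ; legal = distinct }
  where
  choice : (n : ℕ) → (Fin n → ℚ) → (Fin n → ℚ) → (Fin n → Subset n) → Fin n → Fin n
  choice zero    s r P ()
  choice (suc m) s = Rational.Algorithm.response s
  causal : ∀ n s r r′ P P′ (i : Fin n) → _ → _ → choice n s r P i ≡ choice n s r′ P′ i
  causal zero    s r r′ P P′ ()
  causal (suc m) s = Rational.Algorithm.response-online s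
  distinct : ∀ n s r P → ValidPredictions P → ∀ (i j : Fin n) → choice n s r P i ≡ choice n s r P j → i ≡ j
  distinct zero    s r P valid ()
  distinct (suc m) s = Rational.Algorithm.response-injective s

theorem4 : Σ OnlineAlgorithm λ A → Σ ℚ λ C → Σ ℚ λ b →
    ∀ (n : ℕ) (s r : Fin n → ℚ) (P : Fin n → Subset n) → ValidPredictions P →
    ∀ (σ : Fin n → Fin n) → (∀ i j → σ i ≡ σ j → i ≡ j) →
    totalCost s r (choose A n s r P)
    ≤ C * ((logFactor n * totalCost s r σ) ⊓ (totalCost s r σ + predError s P σ)) + b
theorem4 = algorithm , Rational.ratio , 0ℚ , competitive
  where
  competitive : ∀ (n : ℕ) (s r : Fin n → ℚ) (P : Fin n → Subset n) → ValidPredictions P →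
    ∀ (σ : Fin n → Fin n) → (∀ i j → σ i ≡ σ j → i ≡ j) →
    totalCost s r (choose algorithm n s r P)
    ≤ Rational.ratio * ((logFactor n * totalCost s r σ) ⊓ (totalCost s r σ + predError s P σ)) + 0ℚ
  -- Without servers all sums are empty and both sides are 0.
  competitive zero s r P valid σ σ-injective =
    ℚₚ.≤-reflexive (sym (trans (ℚₚ.+-identityʳ _) (trans (cong (λ t → Rational.ratio * (t ⊓ 0ℚ)) (ℚₚ.*-zeroʳ (logFactor 0))) (ℚₚ.*-zeroʳ Rational.ratio))))
  competitive (suc m) s r P = Rational.Algorithm.response-competitive s r P
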